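{- Let $r\ge 4$ be even, let $q$ be an odd prime power, let $\mathcal L$ be an $m$-cover of $\mathcal Q(r,q)$ and let $\bar{\mathcal L}$ be the set of points of $\mathcal Q(r,q^2)$ lying on the extended lines of $\mathcal L$. Then $\bar{\mathcal L}$ is an $(m(q^2-q)+q+1)$-tight set of $\mathcal Q(r,q^2)$ if and only if $\mathcal L$ is an $(r-2)$-dual cover of parabolic type $II$.
   Context: $\theta_{n,q}=q^n+\dots+q+1$ for $n\ge0$, $\theta_{ -1,q}=0$; $\theta_{n,q^2}$ is the same expression with $q^2$ in place of $q$. $\mathcal Q(r,q)$ is the parabolic quadric (polar space) of $\Sigma=\mathrm{PG}(r,q)$, $q$ odd, $r\ge4$ even, given by a nondegenerate quadratic form $Q$ on $\mathbb F_q^{r+1}$, with orthogonal polarity $\perp$. Lines of $\mathcal Q(r,q)$ are the lines of $\Sigma$ contained in the quadric. An $m$-cover of lines of $\mathcal Q(r,q)$ ($m>0$) is a set $\mathcal L$ of lines of $\mathcal Q(r,q)$ such that every point of $\mathcal Q(r,q)$ lies on exactly $m$ lines of $\mathcal L$. An $m$-cover $\mathcal L$ of $\mathcal Q(r,q)$ is $(r-2)$-dual of parabolic type $II$ if, for every line $\ell$ of $\Sigma$, the number of lines of $\mathcal L$ contained in $\ell^\perp$ equals $\frac{m\theta_{r-5,q}}{q+1}+q^{r-4}$ if $\ell\in\mathcal L$, and equals $\frac{m\theta_{r-5,q}}{q+1}$ if $\ell\notin\mathcal L$ and $|\ell\cap\mathcal Q(r,q)|\in\{0,q+1\}$. $\Sigma$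 is embedded in $\mathrm{PG}(r,q^2)$ by extension of scalars; the extended line of a line $\ell$ of $\Sigma$ is the line of $\mathrm{PG}(r,q^2)$ containing the $q+1$ points of $\ell$. $\mathcal Q(r,q^2)$ is the parabolic quadric of $\mathrm{PG}(r,q^2)$ given by the extension of $Q$ to $\mathbb F_{q^2}^{r+1}$; its orthogonal polarity is also denoted $\perp$. A subset $\mathcal X$ of points of $\mathcal Q(r,q^2)$ is $i$-tight if for every point $P$ of $\mathcal Q(r,q^2)$, $|P^{\perp}\cap\mathcal X|$ equals $i\,\theta_{\frac{r-4}{2},q^2}+q^{r-2}$ if $P\in\mathcal X$ and $i\,\theta_{\frac{r-4}{2},q^2}$ if $P\notin\mathcal X$. -}

module Defs where

open import Algebra.Apartness.Bundles using (HeytingField; module HeytingCommutativeRing)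
open import Algebra.Apartness.Structures using (IsHeytingField)
open import Algebra.Bundles using (RawRing; module CommutativeRing)
open import Algebra.Morphism.Structures using (module RingMorphisms)
import Algebra.Properties.Ring as RingProperties
open import Data.Fin.Base using (Fin)
open import Data.Nat.Base as ℕ using (ℕ; zero; suc)
open import Data.Nat.DivMod using (_/_)
open import Data.Nat.Primality using (Prime)
open import Data.Product.Base using (Σ; ∃; ∃₂; _×_; _,_; proj₁; proj₂)
open import Data.Sum.Base using (_⊎_)
open import Data.Vec.Base as Vec using (Vec; []; _∷_; map; zipWith; replicate)
open import Data.Vec.Properties using (map-cong; map-∘; map-id; ∷-injective)
open import Function.Base using (_∘_)
open import Function.Bundles using (_↔_; _⇔_; Inverse; Equivalence; mk⇔)
open import Function.Properties.Equivalence using (⇔-isEquivalence)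
open import Level using (0ℓ)
open import Relation.Binary.Bundles using (Setoid)
import Relation.Binary.Construct.On as On
open import Relation.Binary.PropositionalEquality
open import Relation.Binary.Structures using (IsEquivalence)
open import Relation.Nullary.Negation using (¬_)
open import Relation.Unary using (Pred)

IsPrimePower : ℕ → Set
IsPrimePower q = ∃₂ λ p h → Prime p × q ≡ p ℕ.^ suc h

-- θ< k q = q ^ (k - 1) + … + q + 1 is the number usually written θ_{k-1,q};
-- the shift makes θ_{-1,q} = 0 the case k = 0.
θ< : ℕ → ℕ → ℕ
θ< zero    q = 0
θ< (suc k) q = q ℕ.^ k ℕ.+ θ< k q

-- The subset P of the setoid S has exactly n elements, counted up to the
-- equality of S.
HasSize : (S : Setoid 0ℓ 0ℓ) → Pred (Setoid.Carrier S) 0ℓ → ℕ → Set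
HasSize S P n = Inverse (On.setoid S (proj₁ {B = P})) (setoid (Fin n))

-- Apartness is taken to be inequality: a finite field is discrete.
record FiniteField (q : ℕ) : Set₁ where
  infixl 6 _+_
  infixl 7 _*_
  field
    Carrier        : Set
    _+_ _*_        : Carrier → Carrier → Carrier
    -_             : Carrier → Carrier
    0# 1#          : Carrier
    isHeytingField : IsHeytingField _≡_ _≢_ _+_ _*_ -_ 0# 1#
    enumeration    : Carrier ↔ Fin q

  heytingField : HeytingField 0ℓ 0ℓ 0ℓ
  heytingField = record { isHeytingField = isHeytingField }

  open HeytingField heytingField public
    using (_-_; #⇒invertible; *-assoc; *-identityˡ; zeroˡ)

  rawRing : RawRing 0ℓ 0ℓ
  rawRing = record
    { _≈_ = _≡_ ; _+_ = _+_ ; _*_ = _*_ ; -_ = -_ ; 0# = 0# ; 1# = 1# }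

  inverse : ∀ c → c ≢ 0# → ∃ λ d → d * c ≡ 1#
  inverse c c≢0 with #⇒invertible c≢0
  ... | d , dc≡1 , _ =
    d , trans (cong (d *_) (sym (x-0≡x c))) dc≡1
    where
    open HeytingField heytingField using (heytingCommutativeRing; +-identityʳ)
    open HeytingCommutativeRing heytingCommutativeRing using (commutativeRing)
    open RingProperties (CommutativeRing.ring commutativeRing) using (-0#≈0#)
    x-0≡x : ∀ x → x - 0# ≡ x
    x-0≡x x = trans (cong (x +_) -0#≈0#) (+-identityʳ x)

-- The projective space of Fⁿ, of projective dimension n - 1.
module Projective {q : ℕ} (F : FiniteField q) (n : ℕ) where
  open FiniteField F

  Vector : Set
  Vector = Vec Carrier n

  0ᵛ : Vector
  0ᵛ = replicate n 0#

  infixl 6 _⊕_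
  infixr 7 _•_

  _⊕_ : Vector → Vector → Vector
  _⊕_ = zipWith _+_

  _•_ : Carrier → Vector → Vector
  c • x = map (c *_) x

  dot : Vector → Vector → Carrier
  dot x y = Vec.foldr′ _+_ 0# (zipWith _*_ x y)

  record Point : Set where
    constructor point
    field
      rep     : Vector
      nonzero : rep ≢ 0ᵛ
  open Point public

  _≈ᵖ_ : Point → Point → Set
  P ≈ᵖ R = ∃ λ c → rep P ≡ c • rep R

  private
    1•x : ∀ x → 1# • x ≡ x
    1•x x = trans (map-cong *-identityˡ x) (map-id x)

    •-• : ∀ c d x → c • d • x ≡ (c * d) • x
    •-• c d x = trans (sym (map-∘ (c *_) (d *_) x))
                      (map-cong (λ y → sym (*-assoc c d y)) x)

    0•x : ∀ {k} (x : Vec Carrier k) → map (0# *_) x ≡ replicate k 0#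
    0•x []      = refl
    0•x (a ∷ x) = cong₂ _∷_ (zeroˡ a) (0•x x)

  ≈ᵖ-isEquivalence : IsEquivalence _≈ᵖ_
  ≈ᵖ-isEquivalence = record
    { refl  = λ {P} → 1# , sym (1•x (rep P))
    ; sym   = λ {P} {R} → ≈ᵖ-sym P R
    ; trans = λ { {P} {R} {S} (c , e) (d , f) →
        c * d , trans e (trans (cong (c •_) f) (•-• c d (rep S))) }
    }
    where
    ≈ᵖ-sym : ∀ P R → P ≈ᵖ R → R ≈ᵖ P
    ≈ᵖ-sym P R (c , e) with inverse c (λ { refl → nonzero P (trans e (0•x (rep R))) })
    ... | d , dc≡1 = d , sym (trans (cong (d •_) e) (trans (•-• d c (rep R))
                          (trans (cong (_• rep R) dc≡1) (1•x (rep R)))))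

  Points : Setoid 0ℓ 0ℓ
  Points = record { isEquivalence = ≈ᵖ-isEquivalence }

  record Line : Set where
    constructor line
    field
      fst snd  : Point
      distinct : ¬ (fst ≈ᵖ snd)
  open Line public

  infix 4 _∈ˡ_
  _∈ˡ_ : Point → Line → Set
  P ∈ˡ ℓ = ∃₂ λ a b → rep P ≡ a • rep (fst ℓ) ⊕ b • rep (snd ℓ)

  _≈ˡ_ : Line → Line → Set
  ℓ ≈ˡ ℓ′ = ∀ P → P ∈ˡ ℓ ⇔ P ∈ˡ ℓ′

  Lines : Setoid 0ℓ 0ℓ
  Lines = record
    { Carrier = Line
    ; _≈_ = _≈ˡ_
    ; isEquivalence = record
      { refl  = λ P → E.refl
      ; sym   = λ f P → E.sym (f P)
      ; trans = λ f g P → E.trans (f P) (g P)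
      }
    }
    where module E = IsEquivalence (⇔-isEquivalence {0ℓ})

  infix 4 _⊆ˡ_
  _⊆ˡ_ : Line → Pred Point 0ℓ → Set
  ℓ ⊆ˡ X = ∀ P → P ∈ˡ ℓ → X P

  -- A square matrix A stands for the quadratic form x ↦ Σᵢⱼ aᵢⱼ xᵢ xⱼ; A is
  -- not assumed symmetric, so every quadratic form is of this shape.
  QuadraticForm : Set
  QuadraticForm = Vec (Vec Carrier n) n

  module Quadric (A : QuadraticForm) where

    Q : Vector → Carrier
    Q x = dot x (map (λ row → dot row x) A)

    polar : Vector → Vector → Carrier
    polar x y = Q (x ⊕ y) - Q x - Q y

    -- In odd characteristic nondegeneracy of Q is that of its polar form.
    Nondegenerate : Set
    Nondegenerate = ∀ x → (∀ y → polar x y ≡ 0#) → x ≡ 0ᵛ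

    OnQuadric : Pred Point 0ℓ
    OnQuadric P = Q (rep P) ≡ 0#

    infix 8 _^⊥ _^⊥ˡ
    _^⊥ : Point → Pred Point 0ℓ
    (P ^⊥) R = polar (rep P) (rep R) ≡ 0#

    _^⊥ˡ : Line → Pred Point 0ℓ
    (ℓ ^⊥ˡ) R = ∀ P → P ∈ˡ ℓ → (P ^⊥) R

module Cover {q : ℕ} (F : FiniteField q) (r : ℕ)
             (A : Projective.QuadraticForm F (suc r)) where
  open Projective F (suc r)
  open Quadric A

  record IsCover (m : ℕ) (𝓛 : Pred Line 0ℓ) : Set where
    field
      positive : 0 ℕ.< m
      singular : ∀ ℓ → 𝓛 ℓ → ℓ ⊆ˡ OnQuadric
      covers   : ∀ P → OnQuadric P → HasSize Lines (λ ℓ → 𝓛 ℓ × P ∈ˡ ℓ) m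

  -- The division is exact for even r ≥ 4: r - 5 is then odd, so q + 1
  -- divides θ_{r-5,q}.
  record IsDualOfTypeII (m : ℕ) (𝓛 : Pred Line 0ℓ) : Set where
    field
      inside  : ∀ ℓ → 𝓛 ℓ →
        HasSize Lines (λ ℓ′ → 𝓛 ℓ′ × ℓ′ ⊆ˡ ℓ ^⊥ˡ)
          (m ℕ.* θ< (r ℕ.∸ 4) q / suc q ℕ.+ q ℕ.^ (r ℕ.∸ 4))
      outside : ∀ ℓ → ¬ 𝓛 ℓ →
        HasSize Points (λ P → P ∈ˡ ℓ × OnQuadric P) 0 ⊎
        HasSize Points (λ P → P ∈ˡ ℓ × OnQuadric P) (suc q) →
        HasSize Lines (λ ℓ′ → 𝓛 ℓ′ × ℓ′ ⊆ˡ ℓ ^⊥ˡ)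
          (m ℕ.* θ< (r ℕ.∸ 4) q / suc q)

module Tight {q : ℕ} (K : FiniteField (q ℕ.^ 2)) (r : ℕ)
             (A : Projective.QuadraticForm K (suc r)) where
  open Projective K (suc r)
  open Quadric A

  -- θ< (suc ((r - 4) / 2)) (q²) is θ_{(r-4)/2,q²}.
  record IsTight (i : ℕ) (X : Pred Point 0ℓ) : Set where
    field
      onQuadric : ∀ P → X P → OnQuadric P
      inside    : ∀ P → OnQuadric P → X P →
        HasSize Points (λ R → (P ^⊥) R × X R)
          (i ℕ.* θ< (suc ((r ℕ.∸ 4) / 2)) (q ℕ.^ 2) ℕ.+ q ℕ.^ (r ℕ.∸ 2))
      outside   : ∀ P → OnQuadric P → ¬ X P →
        HasSize Points (λ R → (P ^⊥) R × X R)
          (i ℕ.* θ< (suc ((r ℕ.∸ 4) / 2)) (q ℕ.^ 2))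

record Embedding {q s : ℕ} (F : FiniteField q) (K : FiniteField s) : Set where
  private
    module F = FiniteField F
    module K = FiniteField K
  field
    embed : F.Carrier → K.Carrier
    isRingMonomorphism :
      RingMorphisms.IsRingMonomorphism F.rawRing K.rawRing embed

module Extension {q s : ℕ} {F : FiniteField q} {K : FiniteField s}
                 (E : Embedding F K) (n : ℕ) where
  open Embedding E
  private
    module F  = FiniteField F
    module K  = FiniteField K
    module PF = Projective F n
    module PK = Projective K n
    open RingMorphisms.IsRingMonomorphism isRingMonomorphism
      using (injective; 0#-homo)

    embed-0 : ∀ {k} (x : Vec F.Carrier k) →
              map embed x ≡ replicate k K.0# → x ≡ replicate k F.0#
    embed-0 []      _ = refl
    embed-0 (a ∷ x) e with ∷-injective e
    ... | ea , ex = cong₂ _∷_ (injective (trans ea (sym 0#-homo))) (embed-0 x ex)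

  extendPoint : PF.Point → PK.Point
  extendPoint (PF.point x x≢0) = PK.point (map embed x) (x≢0 ∘ embed-0 x)

  extendForm : PF.QuadraticForm → PK.QuadraticForm
  extendForm = map (map embed)

  IsExtendedLine : PF.Line → PK.Line → Set
  IsExtendedLine ℓ ℓ′ = ∀ P → P PF.∈ˡ ℓ → extendPoint P PK.∈ˡ ℓ′

  extendedPoints : PF.QuadraticForm → Pred PF.Line 0ℓ → Pred PK.Point 0ℓ
  extendedPoints A 𝓛 P =
    PK.Quadric.OnQuadric (extendForm A) P ×
    Σ PF.Line λ ℓ → 𝓛 ℓ ×
    Σ PK.Line λ ℓ′ → IsExtendedLine ℓ ℓ′ × P PK.∈ˡ ℓ′

-- Let T be the number of points of X = 𝓛̄ in P^⊥, h the number of points of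
-- Q(r,q) in P^⊥, and a the number of lines of 𝓛 whose extension lies in P^⊥.
-- The extension of a line of 𝓛 meets P^⊥ in 1 or q² + 1 points, and a point of
-- X lies on m extended lines if it is rational and on just one otherwise, so
-- double counting gives
--     T + (m - 1) h = |𝓛| + q² a.
-- The same count over the small field gives (q + 1)|𝓛| = m |Q(r,q)| and, for a
-- rational point P, |𝓛| + q a = m h; so for rational P the value of T is forced.
-- A point P that is not rational lies on the extension of a unique line ℓ, and
-- P ∈ X if and only if ℓ ∈ 𝓛. If P is singular then ℓ lies on the quadric or is
-- disjoint from it, and every such ℓ carries a singular irrational point because
-- elements of the small field have square roots in the large one. As
-- P^⊥ ∩ Σ = ℓ^⊥, the number a counts the lines of 𝓛 in ℓ^⊥, and h = θ_{r-3,q} in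
-- both cases, so tightness at P is equivalent to the dual condition at ℓ.
-- The values of h come from the fact that a nondegenerate quadratic form in an
-- odd number d of variables has q^(d-1) zeros.
module Submission where

open import Defs
open import Algebra.Apartness.Bundles using (HeytingField; module HeytingCommutativeRing)
open import Algebra.Bundles using (CommutativeRing)
open import Algebra.Morphism.Structures using (module RingMorphisms)
import Algebra.Properties.Ring
import Algebra.Properties.Semiring.Mult.TCOptimised
import Algebra.Solver.Ring
open import Algebra.Solver.Ring.AlmostCommutativeRing using (fromCommutativeRing; _-Raw-AlmostCommutative⟶_)
open import Data.Fin.Base as Fin using (Fin)
open import Data.Fin.Properties as Fin using (¬Fin0)
import Data.Integer.Base as ℤ
import Data.Integer.Properties as ℤ
open import Data.List.Base as List using (List; []; _∷_; concatMap)
import Data.Maybe.Base as Maybe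
open import Data.Nat.Base as ℕ using (ℕ; zero; suc; _≤_; _<_; z≤n; s≤s)
open import Data.Nat.DivMod using (_/_; m*n/n≡m)
open import Data.Nat.Divisibility using (_∣_; divides)
import Data.Nat.Properties as ℕ
open import Data.Nat.Tactic.RingSolver using (solve-∀)
open import Data.Product.Base using (Σ; ∃; ∃₂; _×_; _,_; proj₁; proj₂)
open import Data.Sign.Base as Sign using (Sign)
open import Data.Sum.Base using (_⊎_; inj₁; inj₂)
open import Data.Unit.Base using (⊤; tt)
open import Data.Vec.Base as Vec using (Vec; []; _∷_; map; zipWith; replicate; foldr′)
open import Data.Vec.Properties using (∷-injective; ≡-dec)
open import Function.Base using (_∘_; case_of_)
open import Function.Bundles using (Inverse; _↔_; Equivalence; mk⇔; _⇔_)
open import Function.Properties.Equivalence using (⇔-isEquivalence)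
open import Level using (0ℓ)
open import Relation.Binary.Bundles using (Setoid)
open import Relation.Binary.Consequences using (dec⇒weaklyDec)
import Relation.Binary.Construct.On as On
open import Relation.Binary.Definitions as B using (WeaklyDecidable; DecidableEquality; tri<; tri≈; tri>; _Respects_)
open import Relation.Binary.PropositionalEquality
import Relation.Binary.Reasoning.Setoid
open import Relation.Binary.Structures using (IsEquivalence)
open import Relation.Nullary using (Dec; yes; no; ¬_; ¬?; contradiction)
open import Relation.Nullary.Decidable using (map′; _×-dec_)
open import Relation.Unary using (Pred; Decidable)

-- Put Θ = θ_{(r-4)/2,q²} and Ψ = θ_{(r-6)/2,q²}. At an irrational P one has |𝓛| = m (1 + q² Θ), h =
-- (q + 1) Θ and Θ = 1 + q² Ψ, and solving the double count gives T = (m (q² - q) + q + 1) Θ + q² (a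
-- - m Ψ). This is the origin of the tightness parameter. Since q^(r-2) = q² q^(r-4), the two values
-- allowed for T match the two values allowed for a. Three devices shape the development. Points and
-- lines are counted up to an equality, so cardinalities become sums of 0/1 indicators over lists of
-- representatives, and double counting is an exchange of sums. Subspaces carry no dimension: their
-- cardinality takes its place, and a vector pairing to 1 with x supplies the drop by a factor q on
-- passing to x^⊥. The large field is handled through a basis 1, κ over the small one instead of
-- Frobenius: an irrational point u + κ v has independent rational components u and v, which span
-- the line that carries it.

-- Finite sums and counting up to an equivalence.

module FiniteSums where
  open import Data.Fin.Base using (zero; suc)
  open import Data.List.Base using (length; _++_)
  open import Data.Nat.Base using (_+_; _*_; _^_)
  open import Data.Nat.Properties

  𝟙 : {P : Set} → Dec P → ℕ
  𝟙 (yes _) = 1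
  𝟙 (no _)  = 0

  𝟙-yes : {P : Set} (P? : Dec P) → P → 𝟙 P? ≡ 1
  𝟙-yes (yes _) _ = refl
  𝟙-yes (no ¬p) p = contradiction p ¬p

  𝟙-no : {P : Set} (P? : Dec P) → ¬ P → 𝟙 P? ≡ 0
  𝟙-no (yes p) ¬p = contradiction p ¬p
  𝟙-no (no _)  _  = refl

  𝟙-cong : {P R : Set} (P? : Dec P) (R? : Dec R) → (P → R) → (R → P) → 𝟙 P? ≡ 𝟙 R?
  𝟙-cong (yes p) R? f g = sym (𝟙-yes R? (f p))
  𝟙-cong (no ¬p) R? f g = sym (𝟙-no R? (¬p ∘ g))

  𝟙-× : {P R : Set} (P? : Dec P) (R? : Dec R) → 𝟙 (P? ×-dec R?) ≡ 𝟙 P? * 𝟙 R?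
  𝟙-× (yes _) (yes _) = refl
  𝟙-× (yes _) (no _)  = refl
  𝟙-× (no _)  _       = refl

  𝟙≤1 : {P : Set} (P? : Dec P) → 𝟙 P? ≤ 1
  𝟙≤1 (yes _) = ≤-refl
  𝟙≤1 (no _)  = z≤n

  𝟙-∁ : {P : Set} (P? : Dec P) → 𝟙 P? + 𝟙 (¬? P?) ≡ 1
  𝟙-∁ (yes _) = refl
  𝟙-∁ (no _)  = refl

  𝟙*-cong : {P : Set} (P? : Dec P) {a b : ℕ} → (P → a ≡ b) → 𝟙 P? * a ≡ 𝟙 P? * b
  𝟙*-cong (yes p) e = cong (1 *_) (e p)
  𝟙*-cong (no _)  e = refl

  private variable A B : Set

  ∑ : List A → (A → ℕ) → ℕ
  ∑ []       f = 0
  ∑ (x ∷ xs) f = f x + ∑ xs f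

  infixr 8 ∑
  syntax ∑ xs (λ x → e) = ∑[ x ∈ xs ] e

  ∑-cong : (xs : List A) {f g : A → ℕ} → (∀ x → f x ≡ g x) → ∑ xs f ≡ ∑ xs g
  ∑-cong []       e = refl
  ∑-cong (x ∷ xs) e = cong₂ _+_ (e x) (∑-cong xs e)

  ∑-mono : (xs : List A) {f g : A → ℕ} → (∀ x → f x ≤ g x) → ∑ xs f ≤ ∑ xs g
  ∑-mono []       e = z≤n
  ∑-mono (x ∷ xs) e = +-mono-≤ (e x) (∑-mono xs e)

  +-interchange : ∀ a b c d → (a + b) + (c + d) ≡ (a + c) + (b + d)
  +-interchange = solve-∀

  ∑-+ : (xs : List A) (f g : A → ℕ) → ∑[ x ∈ xs ] (f x + g x) ≡ ∑ xs f + ∑ xs g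
  ∑-+ []       f g = refl
  ∑-+ (x ∷ xs) f g = trans (cong (f x + g x +_) (∑-+ xs f g)) (+-interchange (f x) _ _ _)

  ∑-*ˡ : (xs : List A) (k : ℕ) (f : A → ℕ) → ∑[ x ∈ xs ] (k * f x) ≡ k * ∑ xs f
  ∑-*ˡ []       k f = sym (*-zeroʳ k)
  ∑-*ˡ (x ∷ xs) k f = trans (cong (k * f x +_) (∑-*ˡ xs k f)) (sym (*-distribˡ-+ k (f x) _))

  ∑-*ʳ : (xs : List A) (k : ℕ) (f : A → ℕ) → ∑[ x ∈ xs ] (f x * k) ≡ ∑ xs f * k
  ∑-*ʳ xs k f = trans (∑-cong xs (λ x → *-comm (f x) k)) (trans (∑-*ˡ xs k f) (*-comm k _))

  ∑-zero : (xs : List A) → ∑[ _ ∈ xs ] 0 ≡ 0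
  ∑-zero []       = refl
  ∑-zero (_ ∷ xs) = ∑-zero xs

  ∑-swap : (xs : List A) (ys : List B) (f : A → B → ℕ) →
           ∑[ x ∈ xs ] ∑[ y ∈ ys ] f x y ≡ ∑[ y ∈ ys ] ∑[ x ∈ xs ] f x y
  ∑-swap []       ys f = sym (∑-zero ys)
  ∑-swap (x ∷ xs) ys f =
    trans (cong (∑ ys (f x) +_) (∑-swap xs ys f)) (sym (∑-+ ys (f x) _))

  ∑-++ : (xs ys : List A) (f : A → ℕ) → ∑ (xs ++ ys) f ≡ ∑ xs f + ∑ ys f
  ∑-++ []       ys f = refl
  ∑-++ (x ∷ xs) ys f = trans (cong (f x +_) (∑-++ xs ys f)) (sym (+-assoc (f x) _ _))

  ∑-map : (h : A → B) (xs : List A) (f : B → ℕ) → ∑ (List.map h xs) f ≡ ∑ xs (f ∘ h)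
  ∑-map h []       f = refl
  ∑-map h (x ∷ xs) f = cong (f (h x) +_) (∑-map h xs f)

  ∑-concatMap : (h : A → List B) (xs : List A) (f : B → ℕ) →
                ∑ (concatMap h xs) f ≡ ∑[ x ∈ xs ] ∑ (h x) f
  ∑-concatMap h []       f = refl
  ∑-concatMap h (x ∷ xs) f =
    trans (∑-++ (h x) (concatMap h xs) f) (cong (∑ (h x) f +_) (∑-concatMap h xs f))

  ∑-witness : (xs : List A) {P : Pred A 0ℓ} (P? : Decidable P) →
              0 < ∑[ x ∈ xs ] 𝟙 (P? x) → ∃ P
  ∑-witness (x ∷ xs) P? 0< with P? x
  ... | yes p = x , p
  ... | no _  = ∑-witness xs P? 0<

  -- The list meets every class of the setoid exactly once, so a sum over `elems` is a sum over
  -- classes although only representatives are listed.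
  record Finite (S : Setoid 0ℓ 0ℓ) : Set where
    open Setoid S using (Carrier; _≈_)
    infix 4 _≈?_
    field
      _≈?_  : B.Decidable _≈_
      elems : List Carrier
      once  : ∀ a → ∑[ y ∈ elems ] 𝟙 (y ≈? a) ≡ 1

    count : {P : Pred Carrier 0ℓ} → Decidable P → ℕ
    count P? = ∑[ x ∈ elems ] 𝟙 (P? x)

    card : ℕ
    card = ∑[ _ ∈ elems ] 1


  module FiniteProperties {S : Setoid 0ℓ 0ℓ} (fin : Finite S) where
    open Setoid S using (Carrier; _≈_) renaming (refl to ≈-refl; sym to ≈-sym; trans to ≈-trans)
    open Finite fin

    -- The indicator acts as a Kronecker delta. Since the listed representative of the class of `a`
    -- need not be `a`, the summand has to respect the equality.
    ∑-pick : (a : Carrier) {f : Carrier → ℕ} → (∀ {x y} → x ≈ y → f x ≡ f y) →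
             ∑[ y ∈ elems ] (𝟙 (y ≈? a) * f y) ≡ f a
    ∑-pick a {f} resp = begin
      ∑[ y ∈ elems ] (𝟙 (y ≈? a) * f y) ≡⟨ ∑-cong elems (λ y → 𝟙*-cong (y ≈? a) resp) ⟩
      ∑[ y ∈ elems ] (𝟙 (y ≈? a) * f a) ≡⟨ ∑-*ʳ elems (f a) _ ⟩
      (∑[ y ∈ elems ] 𝟙 (y ≈? a)) * f a ≡⟨ cong (_* f a) (once a) ⟩
      1 * f a                           ≡⟨ *-identityˡ _ ⟩
      f a                               ∎
      where open ≡-Reasoning

    -- Grouping the terms by the value of `f`. With constant weight 1 it counts the domain by
    -- fibres; with one-element fibres it is a change of variables.
    ∑-pushforward : {A : Set} (xs : List A) (f : A → Carrier) {w : Carrier → ℕ} →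
                    (∀ {x y} → x ≈ y → w x ≡ w y) →
                    ∑[ x ∈ xs ] w (f x) ≡ ∑[ y ∈ elems ] (w y * ∑[ x ∈ xs ] 𝟙 (y ≈? f x))
    ∑-pushforward xs f {w} resp = begin
      ∑[ x ∈ xs ] w (f x)                                     ≡⟨ ∑-cong xs (λ x → ∑-pick (f x) resp) ⟨
      ∑[ x ∈ xs ] ∑[ y ∈ elems ] (𝟙 (y ≈? f x) * w y)         ≡⟨ ∑-swap xs elems _ ⟩
      ∑[ y ∈ elems ] ∑[ x ∈ xs ] (𝟙 (y ≈? f x) * w y)         ≡⟨ ∑-cong elems (λ y → ∑-*ʳ xs (w y) _) ⟩
      ∑[ y ∈ elems ] ((∑[ x ∈ xs ] 𝟙 (y ≈? f x)) * w y)       ≡⟨ ∑-cong elems (λ y → *-comm _ (w y)) ⟩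
      ∑[ y ∈ elems ] (w y * ∑[ x ∈ xs ] 𝟙 (y ≈? f x))         ∎
      where open ≡-Reasoning

    count-one : {P : Pred Carrier 0ℓ} (P? : Decidable P) (a : Carrier) →
                (∀ y → P y → y ≈ a) → (∀ y → y ≈ a → P y) → count P? ≡ 1
    count-one P? a f g = trans (∑-cong elems (λ y → 𝟙-cong (P? y) (y ≈? a) (f y) (g y))) (once a)

    count-none : {P : Pred Carrier 0ℓ} (P? : Decidable P) → (∀ y → ¬ P y) → count P? ≡ 0
    count-none P? ¬P = trans (∑-cong elems (λ y → 𝟙-no (P? y) (¬P y))) (∑-zero elems)

    count-cong : {P R : Pred Carrier 0ℓ} (P? : Decidable P) (R? : Decidable R) →
                 (∀ y → P y → R y) → (∀ y → R y → P y) → count P? ≡ count R?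
    count-cong P? R? f g = ∑-cong elems (λ y → 𝟙-cong (P? y) (R? y) (f y) (g y))

    count-split : {P C : Pred Carrier 0ℓ} (P? : Decidable P) (C? : Decidable C) →
                  count P? ≡ count (λ y → P? y ×-dec C? y) + count (λ y → P? y ×-dec ¬? (C? y))
    count-split P? C? = trans (∑-cong elems (λ y → begin
      𝟙 (P? y)                                                 ≡⟨ *-identityʳ _ ⟨
      𝟙 (P? y) * 1                                             ≡⟨ cong (𝟙 (P? y) *_) (𝟙-∁ (C? y)) ⟨
      𝟙 (P? y) * (𝟙 (C? y) + 𝟙 (¬? (C? y)))                    ≡⟨ *-distribˡ-+ (𝟙 (P? y)) _ _ ⟩
      𝟙 (P? y) * 𝟙 (C? y) + 𝟙 (P? y) * 𝟙 (¬? (C? y))           ≡⟨ cong₂ _+_ (𝟙-× (P? y) (C? y)) (𝟙-× (P? y) (¬? (C? y))) ⟨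
      𝟙 (P? y ×-dec C? y) + 𝟙 (P? y ×-dec ¬? (C? y))           ∎)) (∑-+ elems _ _)
      where open ≡-Reasoning

    -- Pigeonhole principle: a single term below the bound `k` would already push the whole sum
    -- below the sum of the bounds.
    ∑-bound-tight : {f : Carrier → ℕ} {k : ℕ} → (∀ {x y} → x ≈ y → f x ≡ f y) →
                    (∀ x → f x ≤ k) → ∑[ _ ∈ elems ] k ≤ ∑ elems f → ∀ a → f a ≡ k
    ∑-bound-tight {f} {k} resp f≤k ∑k≤∑f a with f a ≟ k
    ... | yes e = e
    ... | no ne = contradiction ∑k≤∑f (<⇒≱ strict)
      where
      -- Where `f a` misses the bound there is room for 1 more on the class of `a`.
      term : ∀ y → f y + 𝟙 (y ≈? a) ≤ k
      term y with y ≈? a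
      ... | yes y≈a = subst (λ u → u + 1 ≤ k) (sym (resp y≈a))
                        (subst (_≤ k) (+-comm 1 (f a)) (≤∧≢⇒< (f≤k a) ne))
      ... | no _    = subst (_≤ k) (sym (+-identityʳ (f y))) (f≤k y)
      strict : ∑ elems f < ∑[ _ ∈ elems ] k
      strict = subst (_≤ ∑[ _ ∈ elems ] k)
        (trans (∑-+ elems f _) (trans (cong (∑ elems f +_) (once a)) (+-comm _ 1)))
        (∑-mono elems term)

    term≤∑ : (a : Carrier) {f : Carrier → ℕ} → (∀ {x y} → x ≈ y → f x ≡ f y) → f a ≤ ∑ elems f
    term≤∑ a {f} resp = begin
      f a                                 ≡⟨ ∑-pick a resp ⟨
      ∑[ y ∈ elems ] (𝟙 (y ≈? a) * f y)   ≤⟨ ∑-mono elems (λ y → *-monoˡ-≤ (f y) (𝟙≤1 (y ≈? a))) ⟩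
      ∑[ y ∈ elems ] (1 * f y)            ≡⟨ ∑-cong elems (λ y → *-identityˡ (f y)) ⟩
      ∑ elems f                           ∎
      where open ≤-Reasoning

    -- Exhaustive search: a positive count yields a witness, while a count of zero refutes every
    -- witness, whose indicator is bounded by the count.
    find : {P : Pred Carrier 0ℓ} (P? : Decidable P) → P Respects _≈_ → Dec (∃ P)
    find {P} P? resp with count P? in eq
    ... | suc n = yes (∑-witness elems P? (subst (0 <_) (sym eq) (s≤s z≤n)))
    ... | zero  = no λ (a , p) → 1+n≰n (begin
      1                                          ≡⟨ 𝟙-yes (P? a) p ⟨
      𝟙 (P? a)                                   ≤⟨ term≤∑ a (λ e → 𝟙-cong (P? _) (P? _) (resp e) (resp (≈-sym e))) ⟩
      count P?                                   ≡⟨ eq ⟩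
      0                                          ∎)
      where open ≤-Reasoning

  open FiniteProperties

  module _ {S : Setoid 0ℓ 0ℓ} (_≈?_ : B.Decidable (Setoid._≈_ S)) where
    private module S = Setoid S
    open S using (Carrier; _≈_)

    occurrences : List Carrier → Carrier → ℕ
    occurrences xs a = ∑[ y ∈ xs ] 𝟙 (y ≈? a)

    dedup : List Carrier → List Carrier
    dedup []       = []
    dedup (x ∷ xs) with occurrences (dedup xs) x
    ... | zero  = x ∷ dedup xs
    ... | suc _ = dedup xs

    occurrences-cong : ∀ xs {a b} → a ≈ b → occurrences xs a ≡ occurrences xs b
    occurrences-cong xs e =
      ∑-cong xs (λ y → 𝟙-cong (y ≈? _) (y ≈? _) (λ f → S.trans f e) (λ f → S.trans f (S.sym e)))

    dedup-≤1 : ∀ xs a → occurrences (dedup xs) a ≤ 1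
    dedup-≤1 []       a = z≤n
    dedup-≤1 (x ∷ xs) a with occurrences (dedup xs) x in eq
    ... | suc _ = dedup-≤1 xs a
    ... | zero with x ≈? a
    ...   | yes x≈a = ≤-reflexive (cong suc (trans (sym (occurrences-cong (dedup xs) x≈a)) eq))
    ...   | no _    = dedup-≤1 xs a

    dedup-occurs : ∀ xs a → 0 < occurrences xs a → 0 < occurrences (dedup xs) a
    dedup-occurs (x ∷ xs) a 0< with occurrences (dedup xs) x in eq | x ≈? a
    ... | suc _ | yes x≈a = subst (0 <_) (occurrences-cong (dedup xs) x≈a) (subst (0 <_) (sym eq) (s≤s z≤n))
    ... | suc _ | no _    = dedup-occurs xs a 0<
    dedup-occurs (x ∷ xs) a 0< | zero | yes x≈a with x ≈? a
    ... | yes _ = s≤s z≤n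
    ... | no ne = contradiction x≈a ne
    dedup-occurs (x ∷ xs) a 0< | zero | no _ with x ≈? a
    ... | yes _ = s≤s z≤n
    ... | no _  = dedup-occurs xs a 0<

    -- A redundant list is enough, which is how points come from all nonzero vectors and lines from
    -- all pairs of independent vectors.
    finite-of-covering : (xs : List Carrier) → (∀ a → 0 < occurrences xs a) → Finite S
    finite-of-covering xs cover = record
      { _≈?_  = _≈?_
      ; elems = dedup xs
      ; once  = λ a → ≤-antisym (dedup-≤1 xs a) (dedup-occurs xs a (cover a))
      }

  ∑-term≤ : {A : Set} (xs : List A) (i : Fin (length xs)) (f : A → ℕ) →
            f (List.lookup xs i) ≤ ∑ xs f
  ∑-term≤ (x ∷ xs) zero    f = m≤m+n _ _
  ∑-term≤ (x ∷ xs) (suc i) f = ≤-trans (∑-term≤ xs i f) (m≤n+m _ (f x))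

  module _ {A : Set} {P : Pred A 0ℓ} (P? : Decidable P) where

    position : (xs : List A) → 0 < ∑[ x ∈ xs ] 𝟙 (P? x) → ∃ λ i → P (List.lookup xs i)
    position (x ∷ xs) 0< with P? x
    ... | yes p = zero , p
    ... | no _  with position xs 0<
    ...   | i , p = suc i , p

    position-unique : (xs : List A) → ∑[ x ∈ xs ] 𝟙 (P? x) ≤ 1 → ∀ i j →
                      P (List.lookup xs i) → P (List.lookup xs j) → i ≡ j
    position-unique (x ∷ xs) ≤1 zero    zero    p p′ = refl
    position-unique (x ∷ xs) ≤1 zero    (suc j) p p′ = contradiction ≤1 (<⇒≱ (two x xs j p p′))
      where
      two : ∀ x xs j → P x → P (List.lookup xs j) → 1 < ∑[ y ∈ x ∷ xs ] 𝟙 (P? y)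
      two x xs j p p′ rewrite 𝟙-yes (P? x) p =
        s≤s (subst (_≤ _) (𝟙-yes (P? _) p′) (∑-term≤ xs j (𝟙 ∘ P?)))
    position-unique (x ∷ xs) ≤1 (suc i) zero    p p′ = sym (position-unique (x ∷ xs) ≤1 zero (suc i) p′ p)
    position-unique (x ∷ xs) ≤1 (suc i) (suc j) p p′ =
      cong suc (position-unique xs (≤-trans (m≤n+m _ (𝟙 (P? x))) ≤1) i j p p′)

  length≡card : {A : Set} (xs : List A) → ∑[ _ ∈ xs ] 1 ≡ length xs
  length≡card []       = refl
  length≡card (_ ∷ xs) = cong suc (length≡card xs)

  module _ {T : Setoid 0ℓ 0ℓ} (fin : Finite T) where
    private module T = Setoid T
    open Finite fin

    enumerate : Inverse T (setoid (Fin card))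
    enumerate = subst (λ n → Inverse T (setoid (Fin n))) (sym (length≡card (Finite.elems fin))) record
      { to        = λ a → proj₁ (pos a)
      ; from      = List.lookup (Finite.elems fin)
      ; to-cong   = λ {a} {b} e → unique (proj₁ (pos a)) (proj₁ (pos b)) b
                      (T.trans (proj₂ (pos a)) e) (proj₂ (pos b))
      ; from-cong = λ { refl → T.refl }
      ; inverse   = (λ { {i} e → unique _ i _ (T.trans (proj₂ (pos _)) e) T.refl })
                  , (λ { {a} refl → proj₂ (pos a) })
      }
      where
      pos : ∀ a → ∃ λ i → List.lookup (Finite.elems fin) i T.≈ a
      pos a = position (_≈? a) (Finite.elems fin) (subst (0 <_) (sym (once a)) (s≤s z≤n))
      unique : ∀ i j a → List.lookup (Finite.elems fin) i T.≈ a → List.lookup (Finite.elems fin) j T.≈ a → i ≡ j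
      unique i j a = position-unique (_≈? a) (Finite.elems fin) (≤-reflexive (once a)) i j

  fin-elems : ∀ n → List (Fin n)
  fin-elems zero    = []
  fin-elems (suc n) = zero ∷ List.map suc (fin-elems n)

  fin-finite : ∀ n → Finite (setoid (Fin n))
  fin-finite n = record { _≈?_ = Fin._≟_ ; elems = fin-elems n ; once = once′ n }
    where
    once′ : ∀ n (a : Fin n) → ∑[ y ∈ fin-elems n ] 𝟙 (y Fin.≟ a) ≡ 1
    once′ (suc n) zero    = cong suc (trans (∑-map suc (fin-elems n) _) (∑-zero (fin-elems n)))
    once′ (suc n) (suc a) = trans (∑-map suc (fin-elems n) _) (trans
      (∑-cong (fin-elems n) (λ y → 𝟙-cong (suc y Fin.≟ suc a) (y Fin.≟ a) Fin.suc-injective (cong suc)))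
      (once′ n a))

  fin-card : ∀ n → Finite.card (fin-finite n) ≡ n
  fin-card zero    = refl
  fin-card (suc n) = cong suc (trans (∑-map suc (fin-elems n) _) (fin-card n))

  module _ {S : Setoid 0ℓ 0ℓ} (fin : Finite S) {P : Pred (Setoid.Carrier S) 0ℓ} (P? : Decidable P)
           (resp : P Respects Setoid._≈_ S) where
    private module S = Setoid S
    open Finite fin

    -- The map `proj₁ ∘ from` hits the class of `y` once if `P y` holds and never otherwise, so
    -- counting `Fin n` by fibres gives the indicator sum.
    HasSize⇒count : ∀ {n} → HasSize S P n → count P? ≡ n
    HasSize⇒count {n} size = sym (begin
      n                                                                ≡⟨ fin-card n ⟨
      ∑[ _ ∈ fin-elems n ] 1                                           ≡⟨ ∑-pushforward fin (fin-elems n) (proj₁ ∘ from) (λ _ → refl) ⟩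
      ∑[ y ∈ Finite.elems fin ] (1 * ∑[ i ∈ fin-elems n ] 𝟙 (y ≈? proj₁ (from i)))
        ≡⟨ ∑-cong (Finite.elems fin) (λ y → trans (*-identityˡ _) (fibre y)) ⟩
      count P?                                                         ∎)
      where
      open ≡-Reasoning
      open Inverse size
      fibre : ∀ y → ∑[ i ∈ fin-elems n ] 𝟙 (y ≈? proj₁ (from i)) ≡ 𝟙 (P? y)
      fibre y with P? y
      ... | yes p = trans (∑-cong (fin-elems n) (λ i → 𝟙-cong (y ≈? _) (i Fin.≟ to (y , p))
                      (λ e → sym (inverseˡ e)) (λ e → S.sym (inverseʳ e))))
                      (Finite.once (fin-finite n) (to (y , p)))
      ... | no ¬p = trans (∑-cong (fin-elems n) (λ i → 𝟙-no (y ≈? _)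
                      (λ e → ¬p (resp (S.sym e) (proj₂ (from i)))))) (∑-zero (fin-elems n))

    sub-finite : Finite (On.setoid S (proj₁ {B = P}))
    sub-finite = record
      { _≈?_  = λ a b → proj₁ a ≈? proj₁ b
      ; elems = keep (Finite.elems fin)
      ; once  = λ (a , p) → trans (∑-keep (Finite.elems fin) (λ y → 𝟙 (y ≈? a)))
                  (trans (∑-cong (Finite.elems fin) (λ y → trans (*-comm (𝟙 (P? y)) _)
                           (trans (𝟙*-cong (y ≈? a) (λ e → 𝟙-yes (P? y) (resp (S.sym e) p))) (*-identityʳ _))))
                    (once a))
      }
      where
      keep : List S.Carrier → List (Σ S.Carrier P)
      keep []       = []
      keep (x ∷ xs) with P? x
      ... | yes p = (x , p) ∷ keep xs
      ... | no _  = keep xs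
      ∑-keep : ∀ xs (f : S.Carrier → ℕ) → ∑ (keep xs) (f ∘ proj₁) ≡ ∑[ x ∈ xs ] (𝟙 (P? x) * f x)
      ∑-keep []       f = refl
      ∑-keep (x ∷ xs) f with P? x
      ... | yes p = cong₂ _+_ (sym (*-identityˡ (f x))) (∑-keep xs f)
      ... | no _  = ∑-keep xs f

  module _ {S : Setoid 0ℓ 0ℓ} (fin : Finite S) {P : Pred (Setoid.Carrier S) 0ℓ} (P? : Decidable P)
           (resp : P Respects Setoid._≈_ S) where

    -- The decided subset is itself finite and hence in bijection with some `Fin`; the passage from
    -- sizes to counts identifies its index with the count.
    count⇒HasSize : ∀ {n} → Finite.count fin P? ≡ n → HasSize S P n
    count⇒HasSize eq = subst (HasSize S P) (trans (sym (HasSize⇒count fin P? resp size)) eq) size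
      where
      size : HasSize S P (Finite.card (sub-finite fin P? resp))
      size = enumerate (sub-finite fin P? resp)

  module _ {A : Set} (fin : Finite (setoid A)) where
    private module A = Finite fin

    vec-elems : ∀ n → List (Vec A n)
    vec-elems zero    = [] ∷ []
    vec-elems (suc n) = concatMap (λ a → List.map (a ∷_) (vec-elems n)) A.elems

    ∑-vec-elems : ∀ n (f : Vec A (suc n) → ℕ) →
                  ∑ (vec-elems (suc n)) f ≡ ∑[ a ∈ A.elems ] ∑[ x ∈ vec-elems n ] f (a ∷ x)
    ∑-vec-elems n f = trans (∑-concatMap _ A.elems f)
      (∑-cong A.elems (λ a → ∑-map (a ∷_) (vec-elems n) f))

    vec-once : ∀ n (x : Vec A n) → ∑[ y ∈ vec-elems n ] 𝟙 (≡-dec A._≈?_ y x) ≡ 1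
    vec-once zero    []      = refl
    vec-once (suc n) (a ∷ x) = begin
      ∑[ y ∈ vec-elems (suc n) ] 𝟙 (≡-dec A._≈?_ y (a ∷ x))
        ≡⟨ ∑-vec-elems n _ ⟩
      ∑[ b ∈ A.elems ] ∑[ y ∈ vec-elems n ] 𝟙 (≡-dec A._≈?_ (b ∷ y) (a ∷ x))
        ≡⟨ ∑-cong A.elems (λ b → ∑-cong (vec-elems n) (λ y → trans
             (𝟙-cong (≡-dec A._≈?_ (b ∷ y) (a ∷ x)) ((b A.≈? a) ×-dec (≡-dec A._≈?_ y x)) ∷-injective (λ (e , f) → cong₂ _∷_ e f))
             (𝟙-× (b A.≈? a) _))) ⟩
      ∑[ b ∈ A.elems ] ∑[ y ∈ vec-elems n ] (𝟙 (b A.≈? a) * 𝟙 (≡-dec A._≈?_ y x))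
        ≡⟨ ∑-cong A.elems (λ b → trans (∑-*ˡ (vec-elems n) (𝟙 (b A.≈? a)) _)
             (trans (cong (𝟙 (b A.≈? a) *_) (vec-once n x)) (*-identityʳ _))) ⟩
      ∑[ b ∈ A.elems ] 𝟙 (b A.≈? a)
        ≡⟨ A.once a ⟩
      1 ∎
      where open ≡-Reasoning

    abstract
      vec-finite : ∀ n → Finite (setoid (Vec A n))
      vec-finite n = record { _≈?_ = ≡-dec A._≈?_ ; elems = vec-elems n ; once = vec-once n }

      vec-card : ∀ n → Finite.card (vec-finite n) ≡ A.card ^ n
      vec-card zero    = refl
      vec-card (suc n) = trans (∑-vec-elems n _) (trans
        (∑-cong A.elems (λ _ → trans (vec-card n) (sym (*-identityˡ _))))
        (∑-*ʳ A.elems (A.card ^ n) (λ _ → 1)))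

open FiniteSums

-- Ring identities with integer coefficients.

module IntegerCoefficients (R : CommutativeRing 0ℓ 0ℓ) where
  open CommutativeRing R hiding (setoid)
    renaming (refl to ≈-refl; sym to ≈-sym; trans to ≈-trans; reflexive to ≈-reflexive)
  open Algebra.Properties.Ring ring
  open Algebra.Properties.Semiring.Mult.TCOptimised semiring renaming (_×_ to _×′_)
  open Relation.Binary.Reasoning.Setoid (CommutativeRing.setoid R)

  -- The canonical homomorphism from the integers. Polynomial identities over an arbitrary
  -- commutative ring are normalised with integer coefficients, where equality, and so cancellation,
  -- is decidable.
  ⟦_⟧ℤ : ℤ.ℤ → Carrier
  ⟦ ℤ.+ n      ⟧ℤ = n ×′ 1#
  ⟦ ℤ.-[1+ n ] ⟧ℤ = - (suc n ×′ 1#)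

  ⊖-homo : ∀ m n → ⟦ m ℤ.⊖ n ⟧ℤ ≈ m ×′ 1# - n ×′ 1#
  ⊖-homo m       zero    = ≈-sym (≈-trans (+-congˡ -0#≈0#) (+-identityʳ _))
  ⊖-homo zero    (suc n) = ≈-sym (+-identityˡ _)
  ⊖-homo (suc m) (suc n) = begin
    ⟦ suc m ℤ.⊖ suc n ⟧ℤ                     ≈⟨ ≈-reflexive (cong ⟦_⟧ℤ (ℤ.[1+m]⊖[1+n]≡m⊖n m n)) ⟩
    ⟦ m ℤ.⊖ n ⟧ℤ                             ≈⟨ ⊖-homo m n ⟩
    m ×′ 1# - n ×′ 1#                          ≈⟨ +-congʳ (+-identityˡ (m ×′ 1#)) ⟨
    0# + m ×′ 1# - n ×′ 1#                     ≈⟨ +-congʳ (+-congʳ (-‿inverseʳ 1#)) ⟨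
    1# - 1# + m ×′ 1# - n ×′ 1#                ≈⟨ +-congʳ (+-assoc _ _ _) ⟩
    1# + (- 1# + m ×′ 1#) - n ×′ 1#            ≈⟨ +-congʳ (+-congˡ (+-comm _ _)) ⟩
    1# + (m ×′ 1# - 1#) - n ×′ 1#              ≈⟨ +-congʳ (+-assoc _ _ _) ⟨
    1# + m ×′ 1# - 1# - n ×′ 1#                ≈⟨ +-assoc _ _ _ ⟩
    1# + m ×′ 1# + (- 1# - n ×′ 1#)            ≈⟨ +-congˡ (-‿+-comm 1# (n ×′ 1#)) ⟩
    1# + m ×′ 1# - (1# + n ×′ 1#)              ≈⟨ +-cong (1+× m 1#) (-‿cong (1+× n 1#)) ⟨
    suc m ×′ 1# - suc n ×′ 1#                  ∎

  ◃-homo : ∀ n → ⟦ Sign.- ℤ.◃ n ⟧ℤ ≈ - (n ×′ 1#)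
  ◃-homo zero    = ≈-sym -0#≈0#
  ◃-homo (suc n) = ≈-refl

  +◃-homo : ∀ n → ⟦ Sign.+ ℤ.◃ n ⟧ℤ ≈ n ×′ 1#
  +◃-homo zero    = ≈-refl
  +◃-homo (suc n) = ≈-refl

  +-homo : ∀ i j → ⟦ i ℤ.+ j ⟧ℤ ≈ ⟦ i ⟧ℤ + ⟦ j ⟧ℤ
  +-homo (ℤ.+ m)      (ℤ.+ n)      = ×-homo-+ 1# m n
  +-homo (ℤ.+ m)      ℤ.-[1+ n ]   = ⊖-homo m (suc n)
  +-homo ℤ.-[1+ m ]   (ℤ.+ n)      = ≈-trans (⊖-homo n (suc m)) (+-comm _ _)
  +-homo ℤ.-[1+ m ]   ℤ.-[1+ n ]   = begin
    - (suc (suc (m ℕ.+ n)) ×′ 1#)     ≈⟨ -‿cong (≈-trans (1+× (suc (m ℕ.+ n)) 1#) (≈-trans (+-comm _ _) (+-congʳ (×-homo-+ 1# (suc m) n)))) ⟩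
    - (suc m ×′ 1# + n ×′ 1# + 1#)     ≈⟨ -‿cong (+-assoc _ _ _) ⟩
    - (suc m ×′ 1# + (n ×′ 1# + 1#))   ≈⟨ -‿cong (+-congˡ (≈-trans (+-comm _ _) (≈-sym (1+× n 1#)))) ⟩
    - (suc m ×′ 1# + suc n ×′ 1#)      ≈⟨ -‿+-comm _ _ ⟨
    - (suc m ×′ 1#) - suc n ×′ 1#      ∎

  *-homo : ∀ i j → ⟦ i ℤ.* j ⟧ℤ ≈ ⟦ i ⟧ℤ * ⟦ j ⟧ℤ
  *-homo (ℤ.+ m)    (ℤ.+ n)    = ≈-trans (+◃-homo (m ℕ.* n)) (×1-homo-* m n)
  *-homo (ℤ.+ m)    ℤ.-[1+ n ] = ≈-trans (◃-homo (m ℕ.* suc n))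
    (≈-trans (-‿cong (×1-homo-* m (suc n))) (-‿distribʳ-* _ _))
  *-homo ℤ.-[1+ m ] (ℤ.+ n)    = ≈-trans (◃-homo (suc m ℕ.* n))
    (≈-trans (-‿cong (×1-homo-* (suc m) n)) (-‿distribˡ-* _ _))
  *-homo ℤ.-[1+ m ] ℤ.-[1+ n ] = begin
    (suc m ℕ.* suc n) ×′ 1#                ≈⟨ ×1-homo-* (suc m) (suc n) ⟩
    suc m ×′ 1# * suc n ×′ 1#               ≈⟨ -‿involutive _ ⟨
    - - (suc m ×′ 1# * suc n ×′ 1#)         ≈⟨ -‿cong (-‿distribˡ-* _ _) ⟩
    - (- (suc m ×′ 1#) * suc n ×′ 1#)       ≈⟨ -‿distribʳ-* _ _ ⟩
    - (suc m ×′ 1#) * - (suc n ×′ 1#)       ∎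

  -‿homo : ∀ i → ⟦ ℤ.- i ⟧ℤ ≈ - ⟦ i ⟧ℤ
  -‿homo (ℤ.+ zero)  = ≈-sym -0#≈0#
  -‿homo ℤ.+[1+ n ]  = ≈-refl
  -‿homo ℤ.-[1+ n ]  = ≈-sym (-‿involutive _)

  ℤ⟶R : ℤ.+-*-rawRing -Raw-AlmostCommutative⟶ fromCommutativeRing R
  ℤ⟶R = record
    { ⟦_⟧ = ⟦_⟧ℤ ; +-homo = +-homo ; *-homo = *-homo ; -‿homo = -‿homo
    ; 0-homo = ≈-refl ; 1-homo = ≈-refl }

  ⟦⟧≟ : WeaklyDecidable (λ i j → ⟦ i ⟧ℤ ≈ ⟦ j ⟧ℤ)
  ⟦⟧≟ i j = Maybe.map (λ i≡j → ≈-reflexive (cong ⟦_⟧ℤ i≡j)) (dec⇒weaklyDec ℤ._≟_ i j)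

  open Algebra.Solver.Ring ℤ.+-*-rawRing (fromCommutativeRing R) ℤ⟶R ⟦⟧≟ public
    using (Polynomial; con; solve; _:=_; _:+_; _:*_; _:-_; :-_)

  :0 :1 : ∀ {n} → Polynomial n
  :0 = con ℤ.0ℤ
  :1 = con ℤ.1ℤ

-- Finite fields and the values of squares.

module _ {A : Set} {n : ℕ} (A↔Fin : A ↔ Fin n) where
  open Inverse A↔Fin

  abstract
    finite-↔ : Finite (setoid A)
    finite-↔ = record
      { _≈?_  = _≟_
      ; elems = List.map from (fin-elems n)
      ; once  = λ a → trans (∑-map from (fin-elems n) _) (trans
          (∑-cong (fin-elems n) λ i → 𝟙-cong (from i ≟ a) (i Fin.≟ to a)
            (λ e → sym (inverseˡ (sym e))) (λ e → inverseʳ e))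
          (Finite.once (fin-finite n) (to a)))
      }
      where
      _≟_ : DecidableEquality A
      x ≟ y = map′ (λ e → trans (sym (inverseʳ refl)) (trans (cong from e) (inverseʳ refl)))
                   (cong to) (to x Fin.≟ to y)

    card-↔ : Finite.card finite-↔ ≡ n
    card-↔ = trans (∑-map from (fin-elems n) _) (fin-card n)

module FieldTheory {q : ℕ} (F : FiniteField q) where
  open FiniteField F public
  open HeytingField heytingField using (heytingCommutativeRing; invertible⇒#)
  open HeytingCommutativeRing heytingCommutativeRing public using (commutativeRing)
  open CommutativeRing commutativeRing public
    using (+-comm; +-assoc; +-identityˡ; +-identityʳ; *-comm; *-identityʳ; zeroʳ;
           distribˡ; distribʳ; -‿inverseˡ; -‿inverseʳ; ring)
  open Algebra.Properties.Ring ring public using (-0#≈0#; -‿involutive; -‿distribˡ-*; -‿distribʳ-*)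
  open IntegerCoefficients commutativeRing public
    using (solve; _:=_; _:+_; _:*_; _:-_; :-_; :0; :1)

  finite : Finite (setoid Carrier)
  finite = finite-↔ enumeration

  card≡q : Finite.card finite ≡ q
  card≡q = card-↔ enumeration

  open Finite finite public using (elems; once; count) renaming (_≈?_ to _≟_)
  open FiniteProperties finite public using (find)
  open FiniteProperties finite hiding (find)

  -- Elements with invertible difference are apart, and apartness is inequality here; the difference
  -- in question is `1# - 0#`.
  1≢0 : 1# ≢ 0#
  1≢0 = invertible⇒# (1# , trans (*-identityˡ _) 1-0 , trans (*-identityʳ _) 1-0)
    where
    1-0 : 1# - 0# ≡ 1#
    1-0 = solve 0 (:1 :- :0 := :1) refl

  *-cancelˡ : ∀ {c x y} → c ≢ 0# → c * x ≡ c * y → x ≡ y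
  *-cancelˡ {c} {x} {y} c≢0 e with inverse c c≢0
  ... | d , dc≡1 = begin
    x             ≡⟨ *-identityˡ x ⟨
    1# * x        ≡⟨ cong (_* x) dc≡1 ⟨
    d * c * x     ≡⟨ *-assoc d c x ⟩
    d * (c * x)   ≡⟨ cong (d *_) e ⟩
    d * (c * y)   ≡⟨ *-assoc d c y ⟨
    d * c * y     ≡⟨ cong (_* y) dc≡1 ⟩
    1# * y        ≡⟨ *-identityˡ y ⟩
    y             ∎
    where open ≡-Reasoning

  *-nonzero : ∀ {x y} → x ≢ 0# → y ≢ 0# → x * y ≢ 0#
  *-nonzero {x} x≢0 y≢0 e = y≢0 (*-cancelˡ x≢0 (trans e (sym (zeroʳ x))))

  integral : ∀ {x y} → x * y ≡ 0# → x ≢ 0# → y ≡ 0#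
  integral {x} e x≢0 = *-cancelˡ x≢0 (trans e (sym (zeroʳ x)))

  x-y≡0⇒x≡y : ∀ {x y} → x - y ≡ 0# → x ≡ y
  x-y≡0⇒x≡y {x} {y} e =
    trans (solve 2 (λ x y → x := x :- y :+ y) refl x y) (trans (cong (_+ y) e) (+-identityˡ y))

  x+y≡0⇒x≡-y : ∀ {x y} → x + y ≡ 0# → x ≡ - y
  x+y≡0⇒x≡-y {x} {y} e =
    trans (solve 2 (λ x y → x := x :+ y :- y) refl x y) (trans (cong (_+ - y) e) (+-identityˡ (- y)))

  squares-equal : ∀ {x y} → x * x ≡ y * y → x ≡ y ⊎ x ≡ - y
  squares-equal {x} {y} e with (x - y) ≟ 0#
  ... | yes z = inj₁ (x-y≡0⇒x≡y z)
  ... | no nz = inj₂ (x+y≡0⇒x≡-y (integral product nz))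
    where
    product : (x - y) * (x + y) ≡ 0#
    product = trans (solve 2 (λ x y → (x :- y) :* (x :+ y) := x :* x :- y :* y) refl x y)
                    (trans (cong (_- y * y) e) (-‿inverseʳ _))

  square≡0 : ∀ {x} → x * x ≡ 0# → x ≡ 0#
  square≡0 {x} e with x ≟ 0#
  ... | yes z = z
  ... | no nz = integral e nz

  2≤q : 2 ≤ q
  2≤q = begin
    2                                                    ≡⟨ cong₂ ℕ._+_ (once 0#) (once 1#) ⟨
    ∑ elems (λ y → 𝟙 (y ≟ 0#)) ℕ.+ ∑ elems (λ y → 𝟙 (y ≟ 1#)) ≡⟨ ∑-+ elems _ _ ⟨
    ∑[ y ∈ elems ] (𝟙 (y ≟ 0#) ℕ.+ 𝟙 (y ≟ 1#))           ≤⟨ ∑-mono elems term ⟩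
    ∑[ _ ∈ elems ] 1                                     ≡⟨ card≡q ⟩
    q                                                    ∎
    where
    open ℕ.≤-Reasoning
    term : ∀ y → 𝟙 (y ≟ 0#) ℕ.+ 𝟙 (y ≟ 1#) ≤ 1
    term y with y ≟ 0# | y ≟ 1#
    ... | yes e | yes f = contradiction (trans (sym f) e) 1≢0
    ... | yes _ | no _  = ℕ.≤-refl
    ... | no _  | yes _ = ℕ.≤-refl
    ... | no _  | no _  = z≤n

  -- If 1 + 1 = 0, translation by 1 is an involution without fixed points;
  -- it exchanges the elements whose index it raises with those whose index
  -- it lowers.
  odd⇒2≢0 : ¬ (2 ∣ q) → 1# + 1# ≢ 0#
  odd⇒2≢0 2∤q 1+1≡0 = 2∤q (divides up q≡up*2)
    where
    open Inverse enumeration using (to; inverseʳ)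
    s : Carrier → Carrier
    s = _+ 1#
    s-involutive : ∀ x → s (s x) ≡ x
    s-involutive x = trans (+-assoc x 1# 1#) (trans (cong (x +_) 1+1≡0) (+-identityʳ x))
    up? = λ x → to x Fin.<? to (s x)
    down? = λ x → to (s x) Fin.<? to x
    up : ℕ
    up = count up?
    up+down : ∀ x → 𝟙 (up? x) ℕ.+ 𝟙 (down? x) ≡ 1
    up+down x with Fin.<-cmp (to x) (to (s x))
    ... | tri< a _ c = cong₂ ℕ._+_ (𝟙-yes (up? x) a) (𝟙-no (down? x) c)
    ... | tri> a _ c = cong₂ ℕ._+_ (𝟙-no (up? x) a) (𝟙-yes (down? x) c)
    ... | tri≈ _ b _ = contradiction
      (trans (solve 2 (λ x o → o := x :+ o :- x) refl x 1#)
        (trans (cong (_- x) (trans (sym (inverseʳ refl)) (trans (cong (Inverse.from enumeration) (sym b)) (inverseʳ refl))))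
               (-‿inverseʳ x))) 1≢0
    down≡up : count down? ≡ up
    down≡up = begin
      ∑[ x ∈ elems ] 𝟙 (down? x)    ≡⟨ ∑-cong elems (λ x → 𝟙-cong (down? x) (up? (s x))
                                         (subst (to (s x) Fin.<_) (cong to (sym (s-involutive x))))
                                         (subst (to (s x) Fin.<_) (cong to (s-involutive x)))) ⟩
      ∑[ x ∈ elems ] 𝟙 (up? (s x))  ≡⟨ ∑-pushforward elems s {λ x → 𝟙 (up? x)} (λ { refl → refl }) ⟩
      ∑[ y ∈ elems ] (𝟙 (up? y) ℕ.* ∑[ x ∈ elems ] 𝟙 (y ≟ s x))
        ≡⟨ ∑-cong elems (λ y → trans (cong (𝟙 (up? y) ℕ.*_) (fibre y)) (ℕ.*-identityʳ _)) ⟩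
      up                            ∎
      where
      open ≡-Reasoning
      fibre : ∀ y → ∑[ x ∈ elems ] 𝟙 (y ≟ s x) ≡ 1
      fibre y = count-one (λ x → y ≟ s x) (s y)
        (λ x e → trans (sym (s-involutive x)) (cong s (sym e)))
        (λ x e → trans (sym (s-involutive y)) (cong s (sym e)))
    q≡up*2 : q ≡ up ℕ.* 2
    q≡up*2 = begin
      q                                                ≡⟨ card≡q ⟨
      ∑[ _ ∈ elems ] 1                                 ≡⟨ ∑-cong elems up+down ⟨
      ∑[ x ∈ elems ] (𝟙 (up? x) ℕ.+ 𝟙 (down? x))       ≡⟨ ∑-+ elems _ _ ⟩
      up ℕ.+ count down?                               ≡⟨ cong (up ℕ.+_) down≡up ⟩
      up ℕ.+ up                                        ≡⟨ cong (up ℕ.+_) (ℕ.+-identityʳ up) ⟨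
      2 ℕ.* up                                         ≡⟨ ℕ.*-comm 2 up ⟩
      up ℕ.* 2                                         ∎
      where open ≡-Reasoning

  fibre : (Carrier → Carrier) → Carrier → ℕ
  fibre f c = ∑[ s ∈ elems ] 𝟙 (c ≟ f s)

  ∑-fibre : ∀ f → ∑ elems (fibre f) ≡ q
  ∑-fibre f = trans (∑-cong elems (λ c → sym (ℕ.*-identityˡ _)))
    (trans (sym (∑-pushforward elems f (λ _ → refl))) card≡q)

  fibre-empty : ∀ f c → (∀ s → c ≢ f s) → fibre f c ≡ 0
  fibre-empty f c ne = count-none (λ s → c ≟ f s) ne

  -- Injective up to sign, as nonzero multiples of the square are, shifted or not: each value is
  -- taken at most twice, and the value at 0 only once.
  EvenlyInjective : (Carrier → Carrier) → Set
  EvenlyInjective f = ∀ s t → f s ≡ f t → s ≡ t ⊎ s ≡ - t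

  fibre≤2 : ∀ {f} → EvenlyInjective f → ∀ c → fibre f c ≤ 2
  fibre≤2 {f} inj c with find (λ s → c ≟ f s) (λ { refl e → e })
  ... | no ¬∃ = subst (_≤ 2) (sym (fibre-empty f c (λ s e → ¬∃ (s , e)))) z≤n
  ... | yes (t , e) = begin
    fibre f c                                              ≤⟨ ∑-mono elems term ⟩
    ∑[ s ∈ elems ] (𝟙 (s ≟ t) ℕ.+ 𝟙 (s ≟ (- t)))           ≡⟨ ∑-+ elems _ _ ⟩
    ∑ elems (λ s → 𝟙 (s ≟ t)) ℕ.+ ∑ elems (λ s → 𝟙 (s ≟ (- t))) ≡⟨ cong₂ ℕ._+_ (once t) (once (- t)) ⟩
    2                                                      ∎
    where
    open ℕ.≤-Reasoning
    term : ∀ s → 𝟙 (c ≟ f s) ≤ 𝟙 (s ≟ t) ℕ.+ 𝟙 (s ≟ (- t))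
    term s with c ≟ f s
    ... | no _ = z≤n
    ... | yes e′ with inj s t (trans (sym e′) e)
    ...   | inj₁ s≡t  = ℕ.≤-trans (ℕ.≤-reflexive (sym (𝟙-yes (s ≟ t) s≡t))) (ℕ.m≤m+n _ _)
    ...   | inj₂ s≡-t = ℕ.≤-trans (ℕ.≤-reflexive (sym (𝟙-yes (s ≟ (- t)) s≡-t))) (ℕ.m≤n+m _ _)

  fibre-at-0 : ∀ {f} → EvenlyInjective f → ∀ c → c ≡ f 0# → fibre f c ≡ 1
  fibre-at-0 {f} inj c c≡f0 = count-one (λ s → c ≟ f s) 0#
    (λ s e → case inj s 0# (trans (sym e) c≡f0) of λ where
      (inj₁ s≡0)  → s≡0
      (inj₂ s≡-0) → trans s≡-0 -0#≈0#)
    (λ { s refl → c≡f0 })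

  -- Each map contributes `q` preimages, so the `q` values receive `2 * q` in all; an upper bound of
  -- 2 at every value leaves no slack. A value with the wrong number of preimages then yields a
  -- contradiction.
  fibres-saturated : ∀ f g → (∀ c → fibre f c ℕ.+ fibre g c ≤ 2) →
                     ∀ c → fibre f c ℕ.+ fibre g c ≡ 2
  fibres-saturated f g ≤2 = ∑-bound-tight (λ { refl → refl }) ≤2 (ℕ.≤-reflexive (begin
    ∑[ _ ∈ elems ] 2                      ≡⟨ ∑-*ˡ elems 2 (λ _ → 1) ⟩
    2 ℕ.* Finite.card finite              ≡⟨ cong (2 ℕ.*_) card≡q ⟩
    2 ℕ.* q                               ≡⟨ cong (q ℕ.+_) (ℕ.+-identityʳ q) ⟩
    q ℕ.+ q                               ≡⟨ cong₂ ℕ._+_ (∑-fibre f) (∑-fibre g) ⟨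
    ∑ elems (fibre f) ℕ.+ ∑ elems (fibre g) ≡⟨ ∑-+ elems (fibre f) (fibre g) ⟨
    ∑[ c ∈ elems ] (fibre f c ℕ.+ fibre g c) ∎))
    where open ≡-Reasoning

  scaled-square-injective : ∀ {a} → a ≢ 0# → EvenlyInjective (λ s → a * (s * s))
  scaled-square-injective a≢0 s t e = squares-equal (*-cancelˡ a≢0 e)

  -- a s² and -(c + b t²) each take at least (q + 1) / 2 values.
  ternary-isotropic : ∀ {a b} c → a ≢ 0# → b ≢ 0# →
                      ∃₂ λ s t → a * (s * s) + (b * (t * t) + c) ≡ 0#
  ternary-isotropic {a} {b} c a≢0 b≢0 with find (λ s → search s) (λ { refl e → e })
    where
    search : ∀ s → Dec (∃ λ t → a * (s * s) + (b * (t * t) + c) ≡ 0#)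
    search s = find (λ t → (a * (s * s) + (b * (t * t) + c)) ≟ 0#) (λ { refl e → e })
  ... | yes (s , t , e) = s , t , e
  ... | no ¬∃ = contradiction (fibres-saturated f g ≤2 0#) ≢2
    where
    f g : Carrier → Carrier
    f s = a * (s * s)
    g t = - (b * (t * t) + c)
    disjoint : ∀ s t → f s ≢ g t
    disjoint s t e = ¬∃ (s , t , trans (cong (_+ (b * (t * t) + c)) e) (-‿inverseˡ _))
    f-inj : EvenlyInjective f
    f-inj = scaled-square-injective a≢0
    g-inj : EvenlyInjective g
    g-inj s t e = scaled-square-injective b≢0 s t (begin
      b * (s * s)       ≡⟨ solve 3 (λ b s c → b :* (s :* s) := :- (:- (b :* (s :* s) :+ c)) :- c) refl b s c ⟩
      - (g s) - c       ≡⟨ cong (λ u → - u - c) e ⟩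
      - (g t) - c       ≡⟨ solve 3 (λ b s c → b :* (s :* s) := :- (:- (b :* (s :* s) :+ c)) :- c) refl b t c ⟨
      b * (t * t)       ∎)
      where open ≡-Reasoning
    ≤2 : ∀ y → fibre f y ℕ.+ fibre g y ≤ 2
    ≤2 y with find (λ s → y ≟ f s) (λ { refl e → e })
    ... | yes (s , e) = subst (_≤ 2)
      (trans (sym (ℕ.+-identityʳ _)) (cong (fibre f y ℕ.+_) (sym (fibre-empty g y (λ t e′ → disjoint s t (trans (sym e) e′))))))
      (fibre≤2 f-inj y)
    ... | no ¬s = subst (λ u → u ℕ.+ fibre g y ≤ 2) (sym (fibre-empty f y (λ s e → ¬s (s , e)))) (fibre≤2 g-inj y)
    0≡f0 : 0# ≡ f 0#
    0≡f0 = solve 1 (λ a → :0 := a :* (:0 :* :0)) refl a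
    -- If there is no solution, the value 0 has the single preimage 0 under `f` and none under `g`,
    -- so it receives 1 instead of 2.
    ≢2 : fibre f 0# ℕ.+ fibre g 0# ≢ 2
    ≢2 e with trans (sym (cong₂ ℕ._+_ (fibre-at-0 f-inj 0# 0≡f0)
                (fibre-empty g 0# (λ t e′ → disjoint 0# t (trans (sym 0≡f0) e′))))) e
    ... | ()

  -- The squares and the multiples of squares by `d` share only 0, which each family takes once. So
  -- every value has at most 2 preimages in total, hence exactly 2, and no element escapes both
  -- families.
  square-classes : ∀ {d} → (∀ s → s * s ≢ d) → ∀ e → ∃ λ s → e ≡ s * s ⊎ e ≡ d * (s * s)
  square-classes {d} nonsquare e
    with find (λ s → e ≟ s * s) (λ { refl e → e }) | find (λ s → e ≟ d * (s * s)) (λ { refl e → e })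
  ... | yes (s , p) | _ = s , inj₁ p
  ... | no _ | yes (s , p) = s , inj₂ p
  ... | no ¬s | no ¬t = contradiction
    (trans (sym (cong₂ ℕ._+_ (fibre-empty f e (λ s p → ¬s (s , p))) (fibre-empty g e (λ s p → ¬t (s , p)))))
           (fibres-saturated f g ≤2 e)) λ ()
    where
    f g : Carrier → Carrier
    f s = s * s
    g t = d * (t * t)
    d≢0 : d ≢ 0#
    d≢0 refl = nonsquare 0# (zeroʳ 0#)
    disjoint : ∀ s t → s * s ≡ d * (t * t) → s ≡ 0#
    disjoint s t p with t ≟ 0#
    ... | yes refl = square≡0 (trans p (solve 1 (λ d → d :* (:0 :* :0) := :0) refl d))
    ... | no t≢0 with inverse t t≢0
    ...   | u , ut≡1 = contradiction (begin
      (u * s) * (u * s)       ≡⟨ solve 2 (λ u s → (u :* s) :* (u :* s) := u :* u :* (s :* s)) refl u s ⟩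
      u * u * (s * s)         ≡⟨ cong (u * u *_) p ⟩
      u * u * (d * (t * t))   ≡⟨ solve 3 (λ u d t → u :* u :* (d :* (t :* t)) := u :* t :* (u :* t) :* d) refl u d t ⟩
      u * t * (u * t) * d     ≡⟨ cong (λ v → v * v * d) ut≡1 ⟩
      1# * 1# * d             ≡⟨ solve 1 (λ d → :1 :* :1 :* d := d) refl d ⟩
      d                       ∎) (nonsquare (u * s))
      where open ≡-Reasoning
    f-inj : EvenlyInjective f
    f-inj s t = squares-equal
    g-inj : EvenlyInjective g
    g-inj = scaled-square-injective d≢0
    f0≡0 : f 0# ≡ 0#
    f0≡0 = zeroʳ 0#
    g0≡0 : g 0# ≡ 0#
    g0≡0 = solve 1 (λ d → d :* (:0 :* :0) := :0) refl d
    ≤2 : ∀ y → fibre f y ℕ.+ fibre g y ≤ 2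
    ≤2 y with y ≟ 0#
    ... | yes refl = ℕ.≤-reflexive (cong₂ ℕ._+_ (fibre-at-0 f-inj 0# (sym f0≡0)) (fibre-at-0 g-inj 0# (sym g0≡0)))
    ... | no y≢0 with find (λ s → y ≟ f s) (λ { refl e → e })
    ...   | yes (s , p) = subst (_≤ 2)
      (trans (sym (ℕ.+-identityʳ _)) (cong (fibre f y ℕ.+_) (sym (fibre-empty g y
        (λ t p′ → y≢0 (trans p (trans (cong f (disjoint s t (trans (sym p) p′))) f0≡0)))))))
      (fibre≤2 f-inj y)
    ...   | no ¬s′ = subst (λ u → u ℕ.+ fibre g y ≤ 2) (sym (fibre-empty f y (λ s p → ¬s′ (s , p)))) (fibre≤2 g-inj y)

-- Vectors, points and lines over a finite field.

module VectorIdentities {q : ℕ} (F : FiniteField q) where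
  open FieldTheory F

  private
    variable k : ℕ
    V : ℕ → Set
    V = Vec Carrier
    infixl 6 _⊕_
    infixr 7 _•_
    _⊕_ : V k → V k → V k
    _⊕_ = zipWith _+_
    _•_ : Carrier → V k → V k
    c • x = map (c *_) x
    0ᵛ : V k
    0ᵛ = replicate _ 0#

  •-assoc : ∀ c d (x : V k) → c • d • x ≡ (c * d) • x
  •-assoc c d []      = refl
  •-assoc c d (a ∷ x) = cong₂ _∷_ (sym (*-assoc c d a)) (•-assoc c d x)

  •-distribʳ : ∀ c d (x : V k) → (c + d) • x ≡ c • x ⊕ d • x
  •-distribʳ c d []      = refl
  •-distribʳ c d (a ∷ x) = cong₂ _∷_ (distribʳ a c d) (•-distribʳ c d x)

  1• : (x : V k) → 1# • x ≡ x
  1• []      = refl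
  1• (a ∷ x) = cong₂ _∷_ (*-identityˡ a) (1• x)

  0• : (x : V k) → 0# • x ≡ 0ᵛ
  0• []      = refl
  0• (a ∷ x) = cong₂ _∷_ (zeroˡ a) (0• x)

  •0ᵛ : ∀ k c → c • 0ᵛ {k} ≡ 0ᵛ
  •0ᵛ zero    c = refl
  •0ᵛ (suc k) c = cong₂ _∷_ (zeroʳ c) (•0ᵛ k c)

  ⊕-identityʳ : (x : V k) → x ⊕ 0ᵛ ≡ x
  ⊕-identityʳ []      = refl
  ⊕-identityʳ (a ∷ x) = cong₂ _∷_ (+-identityʳ a) (⊕-identityʳ x)

  ⊕-identityˡ : (x : V k) → 0ᵛ ⊕ x ≡ x
  ⊕-identityˡ []      = refl
  ⊕-identityˡ (a ∷ x) = cong₂ _∷_ (+-identityˡ a) (⊕-identityˡ x)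

  ⊕-shift : ∀ t (x z : V k) → (z ⊕ t • x) ⊕ (- t) • x ≡ z
  ⊕-shift t []      []      = refl
  ⊕-shift t (a ∷ x) (b ∷ z) =
    cong₂ _∷_ (solve 3 (λ t a b → b :+ t :* a :+ (:- t) :* a := b) refl t a b) (⊕-shift t x z)

  ⊕-shift′ : ∀ t (x z : V k) → (z ⊕ (- t) • x) ⊕ t • x ≡ z
  ⊕-shift′ t []      []      = refl
  ⊕-shift′ t (a ∷ x) (b ∷ z) =
    cong₂ _∷_ (solve 3 (λ t a b → b :+ (:- t) :* a :+ t :* a := b) refl t a b) (⊕-shift′ t x z)

  •-combination : ∀ c a b (x y : V k) → c • (a • x ⊕ b • y) ≡ (c * a) • x ⊕ (c * b) • y
  •-combination c a b []      []      = refl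
  •-combination c a b (s ∷ x) (t ∷ y) = cong₂ _∷_
    (solve 5 (λ c a b s t → c :* (a :* s :+ b :* t) := c :* a :* s :+ c :* b :* t) refl c a b s t)
    (•-combination c a b x y)

  combination₂ : ∀ a b c d e f (x y : V k) →
    a • (b • x ⊕ c • y) ⊕ d • (e • x ⊕ f • y) ≡ (a * b + d * e) • x ⊕ (a * c + d * f) • y
  combination₂ a b c d e f []      []      = refl
  combination₂ a b c d e f (s ∷ x) (t ∷ y) = cong₂ _∷_
    (solve 8 (λ a b c d e f s t → a :* (b :* s :+ c :* t) :+ d :* (e :* s :+ f :* t)
                := (a :* b :+ d :* e) :* s :+ (a :* c :+ d :* f) :* t) refl a b c d e f s t)
    (combination₂ a b c d e f x y)

  combination-10 : (x y : V k) → 1# • x ⊕ 0# • y ≡ x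
  combination-10 x y = trans (cong₂ _⊕_ (1• x) (0• y)) (⊕-identityʳ x)

  combination-01 : (x y : V k) → 0# • x ⊕ 1# • y ≡ y
  combination-01 x y = trans (cong₂ _⊕_ (0• x) (1• y)) (⊕-identityˡ y)

  combination-00 : (x y : V k) → 0# • x ⊕ 0# • y ≡ 0ᵛ
  combination-00 x y = trans (cong₂ _⊕_ (0• x) (0• y)) (⊕-identityʳ _)

  solve-combination : ∀ d a b (x y : V k) →
    (d * a) • x ≡ d • (a • x ⊕ b • y) ⊕ (- (d * b)) • y
  solve-combination d a b []      []      = refl
  solve-combination d a b (s ∷ x) (t ∷ y) = cong₂ _∷_
    (solve 5 (λ d a b s t → d :* a :* s := d :* (a :* s :+ b :* t) :+ (:- (d :* b)) :* t) refl d a b s t)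
    (solve-combination d a b x y)

module Geometry {q : ℕ} (F : FiniteField q) (n : ℕ) where
  open FieldTheory F
  open VectorIdentities F
  open Projective F n

  vectors : Finite (setoid Vector)
  vectors = vec-finite finite n

  card-vectors : Finite.card vectors ≡ q ℕ.^ n
  card-vectors = trans (vec-card finite n) (cong (ℕ._^ n) card≡q)

  open Finite vectors public using () renaming (_≈?_ to _≟ᵛ_; elems to allVectors)

  •-zero : ∀ {c x} → c • x ≡ 0ᵛ → c ≢ 0# → x ≡ 0ᵛ
  •-zero {c} {x} e c≢0 with inverse c c≢0
  ... | d , dc≡1 = begin
    x             ≡⟨ 1• x ⟨
    1# • x        ≡⟨ cong (_• x) dc≡1 ⟨
    (d * c) • x   ≡⟨ •-assoc d c x ⟨
    d • c • x     ≡⟨ cong (d •_) e ⟩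
    d • 0ᵛ        ≡⟨ •0ᵛ n d ⟩
    0ᵛ            ∎
    where open ≡-Reasoning

  Independent : Vector → Vector → Set
  Independent x y = ∀ a b → a • x ⊕ b • y ≡ 0ᵛ → a ≡ 0# × b ≡ 0#

  Span : Vector → Vector → Vector → Set
  Span x y z = ∃₂ λ a b → z ≡ a • x ⊕ b • y

  proportional : ∀ {x y a b} → a • x ⊕ b • y ≡ 0ᵛ → a ≢ 0# → ∃ λ c → x ≡ c • y
  proportional {x} {y} {a} {b} e a≢0 with inverse a a≢0
  ... | d , da≡1 = - (d * b) , (begin
    x                                       ≡⟨ 1• x ⟨
    1# • x                                  ≡⟨ cong (_• x) da≡1 ⟨
    (d * a) • x                             ≡⟨ solve-combination d a b x y ⟩
    d • (a • x ⊕ b • y) ⊕ (- (d * b)) • y   ≡⟨ cong (λ z → d • z ⊕ (- (d * b)) • y) e ⟩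
    d • 0ᵛ ⊕ (- (d * b)) • y                ≡⟨ cong (_⊕ (- (d * b)) • y) (•0ᵛ n d) ⟩
    0ᵛ ⊕ (- (d * b)) • y                    ≡⟨ ⊕-identityˡ _ ⟩
    (- (d * b)) • y                         ∎)
    where open ≡-Reasoning

  -- The asymmetric hypotheses are exactly what a `Line` provides: a nonzero second vector of which
  -- the first is not a multiple.
  not-proportional⇒independent : ∀ {x y} → y ≢ 0ᵛ → ¬ (∃ λ c → x ≡ c • y) → Independent x y
  not-proportional⇒independent {x} {y} y≢0 ¬prop a b e with a ≟ 0#
  ... | no a≢0   = contradiction (proportional e a≢0) ¬prop
  ... | yes refl with b ≟ 0#
  ...   | yes b≡0 = refl , b≡0
  ...   | no b≢0  = contradiction
    (•-zero (trans (sym (⊕-identityˡ _)) (trans (cong (_⊕ b • y) (sym (0• x))) e)) b≢0) y≢0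

  line-independent : (ℓ : Line) → Independent (rep (fst ℓ)) (rep (snd ℓ))
  line-independent ℓ = not-proportional⇒independent (nonzero (snd ℓ)) (distinct ℓ)

  independent⇒fst≢0 : ∀ {x y} → Independent x y → x ≢ 0ᵛ
  independent⇒fst≢0 {x} {y} ind refl =
    1≢0 (proj₁ (ind 1# 0# (combination-10 0ᵛ y)))

  independent⇒snd≢0 : ∀ {x y} → Independent x y → y ≢ 0ᵛ
  independent⇒snd≢0 {x} {y} ind refl =
    1≢0 (proj₂ (ind 0# 1# (combination-01 x 0ᵛ)))

  independent⇒distinct : ∀ {x y} → Independent x y → ¬ (∃ λ c → x ≡ c • y)
  independent⇒distinct {x} {y} ind (c , refl) = 1≢0 (proj₁ (ind 1# (- c) (begin
    1# • c • y ⊕ (- c) • y   ≡⟨ cong (_⊕ (- c) • y) (1• _) ⟩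
    c • y ⊕ (- c) • y        ≡⟨ cong (_⊕ (- c) • y) (⊕-identityˡ _) ⟨
    (0ᵛ ⊕ c • y) ⊕ (- c) • y ≡⟨ ⊕-shift c y 0ᵛ ⟩
    0ᵛ                       ∎)))
    where open ≡-Reasoning

  lineThrough : ∀ {x y} → Independent x y → Line
  lineThrough {x} {y} ind =
    line (point x (independent⇒fst≢0 ind)) (point y (independent⇒snd≢0 ind)) (independent⇒distinct ind)

  -- Cramer's rule: with `e` the inverse of the determinant `a * d - b * c`, the vector `x` is
  -- `e (d u - b v)` and `y` is `e (a v - c u)`.
  span-exchange : ∀ {x y u v} → Independent u v → Span x y u → Span x y v →
                  Span u v x × Span u v y
  span-exchange {x} {y} {u} {v} ind (a , b , refl) (c , d , refl) with (a * d - b * c) ≟ 0#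
  ... | yes D≡0 = contradiction
    (trans (cong₂ (λ s t → s • x ⊕ t • y) a≡0 b≡0) (combination-00 x y)) (independent⇒fst≢0 ind)
    where
    -- With determinant 0 both `a v - c u` and `d u - b v` vanish; independence of `u` and `v` then
    -- kills `a` and `b`, so `u` would be zero.
    ca : - c ≡ 0# × a ≡ 0#
    ca = ind (- c) a (trans (combination₂ (- c) a b a c d x y)
      (trans (cong₂ (λ s t → s • x ⊕ t • y)
        (solve 2 (λ a c → (:- c) :* a :+ a :* c := :0) refl a c)
        (trans (solve 4 (λ a b c d → (:- c) :* b :+ a :* d := a :* d :- b :* c) refl a b c d) D≡0))
        (combination-00 x y)))
    db : d ≡ 0# × - b ≡ 0#
    db = ind d (- b) (trans (combination₂ d a b (- b) c d x y)
      (trans (cong₂ (λ s t → s • x ⊕ t • y)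
        (trans (solve 4 (λ a b c d → d :* a :+ (:- b) :* c := a :* d :- b :* c) refl a b c d) D≡0)
        (solve 2 (λ b d → d :* b :+ (:- b) :* d := :0) refl b d))
        (combination-00 x y)))
    a≡0 : a ≡ 0#
    a≡0 = proj₂ ca
    b≡0 : b ≡ 0#
    b≡0 = trans (sym (-‿involutive b)) (trans (cong -_ (proj₂ db)) -0#≈0#)
  ... | no D≢0 with inverse _ D≢0
  ...   | e , eD≡1 =
      (e * d , - (e * b) , sym (trans (combination₂ (e * d) a b (- (e * b)) c d x y)
        (trans (cong₂ (λ s t → s • x ⊕ t • y)
          (trans (solve 5 (λ a b c d e → e :* d :* a :+ (:- (e :* b)) :* c := e :* (a :* d :- b :* c)) refl a b c d e) eD≡1)
          (solve 3 (λ b d e → e :* d :* b :+ (:- (e :* b)) :* d := :0) refl b d e))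
          (combination-10 x y))))
    , (- (e * c) , e * a , sym (trans (combination₂ (- (e * c)) a b (e * a) c d x y)
        (trans (cong₂ (λ s t → s • x ⊕ t • y)
          (solve 3 (λ a c e → (:- (e :* c)) :* a :+ e :* a :* c := :0) refl a c e)
          (trans (solve 5 (λ a b c d e → (:- (e :* c)) :* b :+ e :* a :* d := e :* (a :* d :- b :* c)) refl a b c d e) eD≡1))
          (combination-01 x y))))

  span-trans : ∀ {x y u v z} → Span x y u → Span x y v → Span u v z → Span x y z
  span-trans {x} {y} (a , b , refl) (c , d , refl) (s , t , refl) = _ , _ , combination₂ s a b t c d x y

  span-fst : ∀ x y → Span x y x
  span-fst x y = 1# , 0# , sym (combination-10 x y)

  span-snd : ∀ x y → Span x y y
  span-snd x y = 0# , 1# , sym (combination-01 x y)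

  span-• : ∀ {x y z} c → Span x y z → Span x y (c • z)
  span-• {x} {y} c (a , b , refl) = _ , _ , •-combination c a b x y

  ≈ᵖ-sym : ∀ P R → P ≈ᵖ R → R ≈ᵖ P
  ≈ᵖ-sym P R = IsEquivalence.sym ≈ᵖ-isEquivalence {P} {R}

  ≈ᵖ-trans : ∀ P R T → P ≈ᵖ R → R ≈ᵖ T → P ≈ᵖ T
  ≈ᵖ-trans P R T = IsEquivalence.trans ≈ᵖ-isEquivalence {P} {R} {T}

  ∈ˡ-resp : ∀ ℓ → (_∈ˡ ℓ) Respects _≈ᵖ_
  ∈ˡ-resp ℓ {P} {R} P≈R P∈ℓ = let c , e = ≈ᵖ-sym P R P≈R in subst (Span _ _) (sym e) (span-• c P∈ℓ)

  -- Equality of lines quantifies over all points; this reduces it to two membership tests and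
  -- thereby makes it decidable.
  two-points⇒≈ˡ : ∀ ℓ ℓ′ → fst ℓ′ ∈ˡ ℓ → snd ℓ′ ∈ˡ ℓ → ℓ ≈ˡ ℓ′
  two-points⇒≈ˡ ℓ ℓ′ f s P with span-exchange (line-independent ℓ′) f s
  ... | x∈ , y∈ = mk⇔ (span-trans x∈ y∈) (span-trans f s)

  fst∈ˡ : ∀ ℓ → fst ℓ ∈ˡ ℓ
  fst∈ˡ ℓ = span-fst _ _

  snd∈ˡ : ∀ ℓ → snd ℓ ∈ˡ ℓ
  snd∈ˡ ℓ = span-snd _ _

  _≈ᵖ?_ : B.Decidable _≈ᵖ_
  P ≈ᵖ? R = find (λ c → rep P ≟ᵛ c • rep R) (λ { refl e → e })

  span? : ∀ x y → Decidable (Span x y)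
  span? x y z = find (λ a → find (λ b → z ≟ᵛ a • x ⊕ b • y) (λ { refl e → e })) (λ { refl e → e })

  _∈ˡ?_ : B.Decidable _∈ˡ_
  P ∈ˡ? ℓ = span? _ _ (rep P)

  _≈ˡ?_ : B.Decidable _≈ˡ_
  ℓ ≈ˡ? ℓ′ = map′ (λ (f , s) → two-points⇒≈ˡ ℓ ℓ′ f s)
    (λ e → Equivalence.from (e (fst ℓ′)) (fst∈ˡ ℓ′) , Equivalence.from (e (snd ℓ′)) (snd∈ˡ ℓ′))
    ((fst ℓ′ ∈ˡ? ℓ) ×-dec (snd ℓ′ ∈ˡ? ℓ))

  private
    pointOf : Vector → List Point
    pointOf x with x ≟ᵛ 0ᵛ
    ... | yes _  = []
    ... | no x≢0 = point x x≢0 ∷ []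

    lineOf : Vector → Vector → List Line
    lineOf x y with x ≟ᵛ 0ᵛ | y ≟ᵛ 0ᵛ
    ... | yes _  | _      = []
    ... | no _   | yes _  = []
    ... | no x≢0 | no y≢0 with point x x≢0 ≈ᵖ? point y y≢0
    ...   | yes _ = []
    ...   | no d  = line (point x x≢0) (point y y≢0) d ∷ []

  abstract
    points : Finite Points
    points = finite-of-covering _≈ᵖ?_ (concatMap pointOf allVectors) λ P →
      ℕ.<-≤-trans (occurs P) (ℕ.≤-trans
        (FiniteProperties.term≤∑ vectors (rep P) {λ x → ∑ (pointOf x) (λ R → 𝟙 (R ≈ᵖ? P))} (λ { refl → refl }))
        (ℕ.≤-reflexive (sym (∑-concatMap pointOf allVectors _))))
      where
      occurs : ∀ P → 0 < ∑ (pointOf (rep P)) (λ R → 𝟙 (R ≈ᵖ? P))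
      occurs P with rep P ≟ᵛ 0ᵛ
      ... | yes z = contradiction z (nonzero P)
      ... | no nz rewrite 𝟙-yes (point (rep P) nz ≈ᵖ? P) (1# , sym (1• _)) = s≤s z≤n

    lines : Finite Lines
    lines = finite-of-covering _≈ˡ?_ (concatMap (λ x → concatMap (lineOf x) allVectors) allVectors) λ ℓ →
      ℕ.<-≤-trans (occurs ℓ) (ℕ.≤-trans
        (FiniteProperties.term≤∑ vectors (rep (snd ℓ)) {λ y → ∑ (lineOf (rep (fst ℓ)) y) (λ m → 𝟙 (m ≈ˡ? ℓ))} (λ { refl → refl }))
        (ℕ.≤-trans (ℕ.≤-reflexive (sym (∑-concatMap (lineOf (rep (fst ℓ))) allVectors _)))
        (ℕ.≤-trans
          (FiniteProperties.term≤∑ vectors (rep (fst ℓ)) {λ x → ∑ (concatMap (lineOf x) allVectors) (λ m → 𝟙 (m ≈ˡ? ℓ))} (λ { refl → refl }))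
          (ℕ.≤-reflexive (sym (∑-concatMap (λ x → concatMap (lineOf x) allVectors) allVectors _))))))
      where
      occurs : ∀ ℓ → 0 < ∑ (lineOf (rep (fst ℓ)) (rep (snd ℓ))) (λ m → 𝟙 (m ≈ˡ? ℓ))
      occurs ℓ with rep (fst ℓ) ≟ᵛ 0ᵛ | rep (snd ℓ) ≟ᵛ 0ᵛ
      ... | yes z | _     = contradiction z (nonzero (fst ℓ))
      ... | no _  | yes z = contradiction z (nonzero (snd ℓ))
      ... | no x≢0 | no y≢0 with point (rep (fst ℓ)) x≢0 ≈ᵖ? point (rep (snd ℓ)) y≢0
      ...   | yes p = contradiction p (distinct ℓ)
      ...   | no d rewrite 𝟙-yes (line (point (rep (fst ℓ)) x≢0) (point (rep (snd ℓ)) y≢0) d ≈ˡ? ℓ)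
                     (λ P → mk⇔ (λ e → e) (λ e → e)) = s≤s z≤n

-- Points on lines and hyperplanes, and points against vectors.

module Counting {q : ℕ} (F : FiniteField q) (n : ℕ) where
  open FieldTheory F
  open VectorIdentities F
  open Projective F n
  open Geometry F n

  open Finite points public using () renaming (elems to allPoints; _≈?_ to _≟ᵖ_; count to countPoints)
  open Finite lines public using () renaming (elems to allLines; _≈?_ to _≟ˡ_; count to countLines)

  countVectors : {U : Pred Vector 0ℓ} → Decidable U → ℕ
  countVectors = Finite.count vectors

  coordinates-unique : ∀ {x y a b c d} → Independent x y →
                       a • x ⊕ b • y ≡ c • x ⊕ d • y → a ≡ c × b ≡ d
  coordinates-unique {x} {y} {a} {b} {c} {d} ind e with ind (1# * a + (- 1#) * c) (1# * b + (- 1#) * d) (begin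
    (1# * a + (- 1#) * c) • x ⊕ (1# * b + (- 1#) * d) • y   ≡⟨ combination₂ 1# a b (- 1#) c d x y ⟨
    1# • (a • x ⊕ b • y) ⊕ (- 1#) • (c • x ⊕ d • y)         ≡⟨ cong (λ u → 1# • u ⊕ (- 1#) • (c • x ⊕ d • y)) e ⟩
    1# • (c • x ⊕ d • y) ⊕ (- 1#) • (c • x ⊕ d • y)         ≡⟨ combination₂ 1# c d (- 1#) c d x y ⟩
    (1# * c + (- 1#) * c) • x ⊕ (1# * d + (- 1#) * d) • y   ≡⟨ cong₂ (λ s t → s • x ⊕ t • y) (zero-coefficient c) (zero-coefficient d) ⟩
    0# • x ⊕ 0# • y                                         ≡⟨ combination-00 x y ⟩
    0ᵛ                                                      ∎)
    where
    open ≡-Reasoning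
    zero-coefficient : ∀ c → 1# * c + (- 1#) * c ≡ 0#
    zero-coefficient = solve 1 (λ c → :1 :* c :+ (:- :1) :* c := :0) refl
  ... | e₁ , e₂ = x-y≡0⇒x≡y (trans (difference a c) e₁) , x-y≡0⇒x≡y (trans (difference b d) e₂)
    where
    difference : ∀ a c → a - c ≡ 1# * a + (- 1#) * c
    difference = solve 2 (λ a c → a :- c := :1 :* a :+ (:- :1) :* c) refl

  •-injectiveˡ : ∀ {c d x} → x ≢ 0ᵛ → c • x ≡ d • x → c ≡ d
  •-injectiveˡ {c} {d} {x} x≢0 e with (c - d) ≟ 0#
  ... | yes z = x-y≡0⇒x≡y z
  ... | no nz = contradiction (•-zero (begin
    (c - d) • x                 ≡⟨ •-distribʳ c (- d) x ⟩
    c • x ⊕ (- d) • x           ≡⟨ cong (_⊕ (- d) • x) (trans e (sym (⊕-identityˡ _))) ⟩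
    (0ᵛ ⊕ d • x) ⊕ (- d) • x    ≡⟨ ⊕-shift d x 0ᵛ ⟩
    0ᵛ                          ∎) nz) x≢0
    where open ≡-Reasoning

  -- The points of a line through x and y are y and x + t y, for t in the field.
  count-line : ∀ ℓ → countPoints (_∈ˡ? ℓ) ≡ suc q
  count-line ℓ = begin
    ∑[ R ∈ allPoints ] 𝟙 (R ∈ˡ? ℓ)
      ≡⟨ ∑-cong allPoints term ⟩
    ∑[ R ∈ allPoints ] (𝟙 (R ≟ᵖ snd ℓ) ℕ.+ ∑[ t ∈ elems ] 𝟙 (R ≟ᵖ affine t))
      ≡⟨ ∑-+ allPoints _ _ ⟩
    ∑[ R ∈ allPoints ] 𝟙 (R ≟ᵖ snd ℓ) ℕ.+ ∑[ R ∈ allPoints ] ∑[ t ∈ elems ] 𝟙 (R ≟ᵖ affine t)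
      ≡⟨ cong₂ ℕ._+_ (Finite.once points (snd ℓ)) (∑-swap allPoints elems _) ⟩
    1 ℕ.+ ∑[ t ∈ elems ] ∑[ R ∈ allPoints ] 𝟙 (R ≟ᵖ affine t)
      ≡⟨ cong suc (∑-cong elems (λ t → Finite.once points (affine t))) ⟩
    1 ℕ.+ ∑[ t ∈ elems ] 1
      ≡⟨ cong suc card≡q ⟩
    suc q ∎
    where
    open ≡-Reasoning
    x = rep (fst ℓ)
    y = rep (snd ℓ)
    ind : Independent x y
    ind = line-independent ℓ
    affine : Carrier → Point
    affine t = point (1# • x ⊕ t • y) (λ e → 1≢0 (proj₁ (ind 1# t e)))
    term : ∀ R → 𝟙 (R ∈ˡ? ℓ) ≡ 𝟙 (R ≟ᵖ snd ℓ) ℕ.+ ∑[ t ∈ elems ] 𝟙 (R ≟ᵖ affine t)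
    term R with R ∈ˡ? ℓ
    ... | no R∉ℓ = sym (cong₂ ℕ._+_
      (𝟙-no (R ≟ᵖ snd ℓ) (λ (c , e) → R∉ℓ (subst (Span x y) (sym e) (span-• c (snd∈ˡ ℓ)))))
      (trans (∑-cong elems (λ t → 𝟙-no (R ≟ᵖ affine t)
        (λ (c , e) → R∉ℓ (subst (Span x y) (sym e) (span-• c (1# , t , refl))))))
        (∑-zero elems)))
    ... | yes (a , b , e) with a ≟ 0#
    ...   | yes refl = sym (cong₂ ℕ._+_
      (𝟙-yes (R ≟ᵖ snd ℓ) (b , trans e (trans (cong (_⊕ b • y) (0• x)) (⊕-identityˡ _))))
      (trans (∑-cong elems (λ t → 𝟙-no (R ≟ᵖ affine t) (λ (c , e′) → nonzero R (begin
        rep R                    ≡⟨ e′ ⟩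
        c • (1# • x ⊕ t • y)     ≡⟨ cong (_• (1# • x ⊕ t • y)) (trans (sym (*-identityʳ c)) (sym (proj₁
                                      (coordinates-unique ind (trans (sym e) (trans e′ (•-combination c 1# t x y))))))) ⟩
        0# • (1# • x ⊕ t • y)    ≡⟨ 0• _ ⟩
        0ᵛ                       ∎))))
        (∑-zero elems)))
    ...   | no a≢0 with inverse a a≢0
    ...     | d , da≡1 = sym (cong₂ ℕ._+_
      (𝟙-no (R ≟ᵖ snd ℓ) (λ (c , e′) → a≢0 (proj₁ (coordinates-unique ind
        (trans (sym e) (trans e′ (trans (sym (⊕-identityˡ _)) (cong (_⊕ c • y) (sym (0• x))))))))))
      (FiniteProperties.count-one finite (λ t → R ≟ᵖ affine t) (d * b)
        (λ t (c , e′) → case coordinates-unique ind (trans (sym e) (trans e′ (•-combination c 1# t x y))) of λ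
          (a≡c1 , b≡ct) → begin
            t              ≡⟨ *-identityˡ t ⟨
            1# * t         ≡⟨ cong (_* t) da≡1 ⟨
            d * a * t      ≡⟨ cong (λ u → d * u * t) (trans a≡c1 (*-identityʳ c)) ⟩
            d * c * t      ≡⟨ *-assoc d c t ⟩
            d * (c * t)    ≡⟨ cong (d *_) b≡ct ⟨
            d * b          ∎)
        (λ { _ refl → a , trans e (sym (trans (•-combination a 1# (d * b) x y)
          (cong₂ (λ s t → s • x ⊕ t • y) (*-identityʳ a) (begin
            a * (d * b)    ≡⟨ solve 3 (λ a d b → a :* (d :* b) := d :* a :* b) refl a d b ⟩
            d * a * b      ≡⟨ cong (_* b) da≡1 ⟩
            1# * b         ≡⟨ *-identityˡ b ⟩
            b              ∎)))) })))

  Linear : (Vector → Carrier) → Set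
  Linear φ = ∀ a b x y → φ (a • x ⊕ b • y) ≡ a * φ x + b * φ y

  linear-• : ∀ {φ} → Linear φ → ∀ c x → φ (c • x) ≡ c * φ x
  linear-• {φ} lin c x = begin
    φ (c • x)               ≡⟨ cong φ (trans (cong (c • x ⊕_) (0• x)) (⊕-identityʳ _)) ⟨
    φ (c • x ⊕ 0# • x)      ≡⟨ lin c 0# x x ⟩
    c * φ x + 0# * φ x      ≡⟨ solve 2 (λ c s → c :* s :+ :0 :* s := c :* s) refl c (φ x) ⟩
    c * φ x                 ∎
    where open ≡-Reasoning

  linear-zero : ∀ {φ} → Linear φ → ∀ c {x} → φ x ≡ 0# → φ (c • x) ≡ 0#
  linear-zero {φ} lin c {x} e = trans (linear-• lin c x) (trans (cong (c *_) e) (zeroʳ c))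

  linear-resp : ∀ {φ} → Linear φ → ∀ P R → P ≈ᵖ R → φ (rep P) ≡ 0# → φ (rep R) ≡ 0#
  linear-resp {φ} lin P R P≈R e = let c , f = ≈ᵖ-sym P R P≈R in trans (cong φ f) (linear-zero lin c e)

  linear-span : ∀ {φ} → Linear φ → ∀ {x y z} → Span x y z → φ x ≡ 0# → φ y ≡ 0# → φ z ≡ 0#
  linear-span {φ} lin (a , b , refl) e f = trans (lin a b _ _) (trans (cong₂ (λ s t → a * s + b * t) e f)
    (solve 2 (λ a b → a :* :0 :+ b :* :0 := :0) refl a b))

  -- A linear functional vanishes on a whole line or at exactly one of its points. Merging both
  -- cases into `1 + q * 𝟙` makes the incidence sums linear in the number of lines inside the
  -- hyperplane.
  count-line∩kernel : ∀ {φ} → Linear φ → ∀ ℓ →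
    countPoints (λ R → (R ∈ˡ? ℓ) ×-dec (φ (rep R) ≟ 0#)) ≡
    1 ℕ.+ q ℕ.* 𝟙 ((φ (rep (fst ℓ)) ≟ 0#) ×-dec (φ (rep (snd ℓ)) ≟ 0#))
  count-line∩kernel {φ} lin ℓ with (φ (rep (fst ℓ)) ≟ 0#) ×-dec (φ (rep (snd ℓ)) ≟ 0#)
  ... | yes (s≡0 , t≡0) = trans
    (FiniteProperties.count-cong points (λ R → (R ∈ˡ? ℓ) ×-dec (φ (rep R) ≟ 0#)) (_∈ˡ? ℓ)
      (λ R → proj₁) (λ R R∈ℓ → R∈ℓ , linear-span lin R∈ℓ s≡0 t≡0))
    (trans (count-line ℓ) (cong suc (sym (ℕ.*-identityʳ q))))
  ... | no ¬both = trans
    (FiniteProperties.count-one points (λ R → (R ∈ˡ? ℓ) ×-dec (φ (rep R) ≟ 0#)) meet only-meet is-meet)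
    (cong suc (sym (ℕ.*-zeroʳ q)))
    where
    x = rep (fst ℓ)
    y = rep (snd ℓ)
    s = φ x
    t = φ y
    neg-zero : ∀ {s} → - s ≡ 0# → s ≡ 0#
    neg-zero {s} e = trans (sym (-‿involutive s)) (trans (cong -_ e) -0#≈0#)
    -- With `s` and `t` the values of the functional at `x` and `y`, it cancels on `t x - s y`.
    meet : Point
    meet = point (t • x ⊕ (- s) • y) (λ e → case line-independent ℓ t (- s) e of λ
      (t≡0 , -s≡0) → ¬both (neg-zero -s≡0 , t≡0))
    is-meet : ∀ R → R ≈ᵖ meet → R ∈ˡ ℓ × φ (rep R) ≡ 0#
    is-meet R (c , e) = subst (Span x y) (sym e) (span-• c (t , - s , refl)) ,
      trans (cong φ e) (linear-zero lin c (trans (lin t (- s) x y)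
        (solve 2 (λ s t → t :* s :+ (:- s) :* t := :0) refl s t)))
    only-meet : ∀ R → R ∈ˡ ℓ × φ (rep R) ≡ 0# → R ≈ᵖ meet
    only-meet R ((a , b , e) , φR≡0) with s ≟ 0#
    ... | no s≢0 with inverse s s≢0
    -- From `a s + b t = 0` and `s ≠ 0` the point `a x + b y` is `- b / s` times `meet`; the case
    -- `s = 0` divides by `t` instead.
    ...   | d , ds≡1 = - (d * b) , trans e (sym (trans (•-combination (- (d * b)) t (- s) x y)
      (cong₂ (λ u v → u • x ⊕ v • y) (begin
        - (d * b) * t                   ≡⟨ solve 5 (λ a b s t d → (:- (d :* b)) :* t := d :* s :* a :- d :* (a :* s :+ b :* t)) refl a b s t d ⟩
        d * s * a - d * (a * s + b * t) ≡⟨ cong₂ (λ u v → u * a - d * v) ds≡1 as+bt≡0 ⟩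
        1# * a - d * 0#                 ≡⟨ solve 2 (λ a d → :1 :* a :- d :* :0 := a) refl a d ⟩
        a                               ∎) (begin
        - (d * b) * - s                 ≡⟨ solve 3 (λ b s d → (:- (d :* b)) :* (:- s) := d :* s :* b) refl b s d ⟩
        d * s * b                       ≡⟨ cong (_* b) ds≡1 ⟩
        1# * b                          ≡⟨ *-identityˡ b ⟩
        b                               ∎))))
      where
      open ≡-Reasoning
      as+bt≡0 : a * s + b * t ≡ 0#
      as+bt≡0 = trans (sym (lin a b x y)) (trans (cong φ (sym e)) φR≡0)
    only-meet R ((a , b , e) , φR≡0) | yes s≡0 with inverse t (λ t≡0 → ¬both (s≡0 , t≡0))
    ...   | d , dt≡1 = d * a , trans e (sym (trans (•-combination (d * a) t (- s) x y)
      (cong₂ (λ u v → u • x ⊕ v • y) (begin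
        d * a * t                       ≡⟨ solve 3 (λ d a t → d :* a :* t := d :* t :* a) refl d a t ⟩
        d * t * a                       ≡⟨ cong (_* a) dt≡1 ⟩
        1# * a                          ≡⟨ *-identityˡ a ⟩
        a                               ∎) (begin
        d * a * - s                     ≡⟨ cong (λ u → d * a * - u) s≡0 ⟩
        d * a * - 0#                    ≡⟨ solve 2 (λ a d → d :* a :* (:- :0) := d :* :0) refl a d ⟩
        d * 0#                          ≡⟨ cong (d *_) as+bt≡0 ⟨
        d * (a * s + b * t)             ≡⟨ cong (λ u → d * (a * u + b * t)) s≡0 ⟩
        d * (a * 0# + b * t)            ≡⟨ solve 4 (λ a b t d → d :* (a :* :0 :+ b :* t) := d :* t :* b) refl a b t d ⟩
        d * t * b                       ≡⟨ cong (_* b) dt≡1 ⟩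
        1# * b                          ≡⟨ *-identityˡ b ⟩
        b                               ∎))))
      where
      open ≡-Reasoning
      as+bt≡0 : a * s + b * t ≡ 0#
      as+bt≡0 = trans (sym (lin a b x y)) (trans (cong φ (sym e)) φR≡0)

  count-nonzero : count (λ c → ¬? (c ≟ 0#)) ≡ q ℕ.∸ 1
  count-nonzero = begin
    count (λ c → ¬? (c ≟ 0#))                                ≡⟨⟩
    (1 ℕ.+ count (λ c → ¬? (c ≟ 0#))) ℕ.∸ 1                  ≡⟨ cong (λ u → (u ℕ.+ count (λ c → ¬? (c ≟ 0#))) ℕ.∸ 1) (once 0#) ⟨
    (∑[ c ∈ elems ] 𝟙 (c ≟ 0#) ℕ.+ count (λ c → ¬? (c ≟ 0#))) ℕ.∸ 1 ≡⟨ cong (ℕ._∸ 1) (∑-+ elems _ _) ⟨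
    (∑[ c ∈ elems ] (𝟙 (c ≟ 0#) ℕ.+ 𝟙 (¬? (c ≟ 0#)))) ℕ.∸ 1  ≡⟨ cong (ℕ._∸ 1) (trans (∑-cong elems (λ c → 𝟙-∁ (c ≟ 0#))) card≡q) ⟩
    q ℕ.∸ 1                                                  ∎
    where open ≡-Reasoning

  module _ {U : Pred Vector 0ℓ} (U? : Decidable U) (U-• : ∀ c x → c ≢ 0# → U x → U (c • x)) where

    private
      U-•⁻¹ : ∀ c x → c ≢ 0# → U (c • x) → U x
      U-•⁻¹ c x c≢0 u with inverse c c≢0
      ... | d , dc≡1 = subst U (trans (•-assoc d c x) (trans (cong (_• x) dc≡1) (1• x)))
        (U-• d (c • x) (λ { refl → 1≢0 (trans (sym dc≡1) (zeroˡ c)) }) u)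

      multiple : Vector → Point → Carrier → ℕ
      multiple x P c = 𝟙 (x ≟ᵛ c • rep P) ℕ.* 𝟙 (¬? (c ≟ 0#))

      multiples : ∀ x P → (x≢0 : x ≢ 0ᵛ) → ∑ elems (multiple x P) ≡ 𝟙 (P ≟ᵖ point x x≢0)
      multiples x P x≢0 with P ≟ᵖ point x x≢0
      ... | yes (e , p) = trans (∑-cong elems (λ c → trans (sym (𝟙-× (x ≟ᵛ c • rep P) (¬? (c ≟ 0#))))
              (𝟙-cong ((x ≟ᵛ c • rep P) ×-dec ¬? (c ≟ 0#)) (c ≟ d)
                (λ (f , _) → •-injectiveˡ (nonzero P) (trans (sym f) x≡dP))
                (λ { refl → x≡dP , λ d≡0 → x≢0 (trans x≡dP (trans (cong (_• rep P) d≡0) (0• _))) }))))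
            (once d)
        where
        flip : point x x≢0 ≈ᵖ P
        flip = ≈ᵖ-sym P (point x x≢0) (e , p)
        d = proj₁ flip
        x≡dP : x ≡ d • rep P
        x≡dP = proj₂ flip
      ... | no ¬p = trans (∑-cong elems (λ c → trans (sym (𝟙-× (x ≟ᵛ c • rep P) (¬? (c ≟ 0#))))
              (𝟙-no ((x ≟ᵛ c • rep P) ×-dec ¬? (c ≟ 0#)) (λ (f , _) → ¬p (≈ᵖ-sym (point x x≢0) P (c , f))))))
            (∑-zero elems)

      all-multiples : ∀ x → ∑[ P ∈ allPoints ] ∑ elems (multiple x P) ≡ 𝟙 (¬? (x ≟ᵛ 0ᵛ))
      all-multiples x with x ≟ᵛ 0ᵛ
      ... | no x≢0 = trans (∑-cong allPoints (λ P → multiples x P x≢0)) (Finite.once points (point x x≢0))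
      ... | yes refl = trans (∑-cong allPoints (λ P → trans
              (∑-cong elems (λ c → trans (sym (𝟙-× (0ᵛ ≟ᵛ c • rep P) (¬? (c ≟ 0#))))
                 (𝟙-no ((0ᵛ ≟ᵛ c • rep P) ×-dec ¬? (c ≟ 0#)) (λ (f , c≢0) → nonzero P (•-zero (sym f) c≢0)))))
              (∑-zero elems))) (∑-zero allPoints)

      -- Every nonzero vector is `c • rep P` for exactly one listed point `P` and one nonzero scalar
      -- `c`, and `U` is invariant under such scalars. Reordering the sum over points, scalars and
      -- vectors gives the factor `q ∸ 1`.
      nonzero-vectors : (q ℕ.∸ 1) ℕ.* countPoints (λ P → U? (rep P)) ≡
                        ∑[ x ∈ allVectors ] (𝟙 (¬? (x ≟ᵛ 0ᵛ)) ℕ.* 𝟙 (U? x))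
      nonzero-vectors = begin
        (q ℕ.∸ 1) ℕ.* countPoints (λ P → U? (rep P))
          ≡⟨ ∑-*ˡ allPoints (q ℕ.∸ 1) (λ P → 𝟙 (U? (rep P))) ⟨
        ∑[ P ∈ allPoints ] ((q ℕ.∸ 1) ℕ.* 𝟙 (U? (rep P)))
          ≡⟨ ∑-cong allPoints (λ P → trans (cong (ℕ._* 𝟙 (U? (rep P))) (sym count-nonzero))
               (sym (∑-*ʳ elems (𝟙 (U? (rep P))) _))) ⟩
        ∑[ P ∈ allPoints ] ∑[ c ∈ elems ] (𝟙 (¬? (c ≟ 0#)) ℕ.* 𝟙 (U? (rep P)))
          ≡⟨ ∑-cong allPoints (λ P → ∑-cong elems (λ c → 𝟙*-cong (¬? (c ≟ 0#)) (λ c≢0 →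
               𝟙-cong (U? (rep P)) (U? (c • rep P)) (U-• c _ c≢0) (U-•⁻¹ c _ c≢0)))) ⟩
        ∑[ P ∈ allPoints ] ∑[ c ∈ elems ] (𝟙 (¬? (c ≟ 0#)) ℕ.* 𝟙 (U? (c • rep P)))
          ≡⟨ ∑-cong allPoints (λ P → ∑-cong elems (λ c → FiniteProperties.∑-pick vectors (c • rep P)
               {λ x → 𝟙 (¬? (c ≟ 0#)) ℕ.* 𝟙 (U? x)} (λ { refl → refl }))) ⟨
        ∑[ P ∈ allPoints ] ∑[ c ∈ elems ] ∑[ x ∈ allVectors ]
          (𝟙 (x ≟ᵛ c • rep P) ℕ.* (𝟙 (¬? (c ≟ 0#)) ℕ.* 𝟙 (U? x)))
          ≡⟨ ∑-cong allPoints (λ P → ∑-cong elems (λ c → ∑-cong allVectors (λ x →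
               sym (ℕ.*-assoc (𝟙 (x ≟ᵛ c • rep P)) _ _)))) ⟩
        ∑[ P ∈ allPoints ] ∑[ c ∈ elems ] ∑[ x ∈ allVectors ] (multiple x P c ℕ.* 𝟙 (U? x))
          ≡⟨ ∑-cong allPoints (λ P → ∑-swap elems allVectors _) ⟩
        ∑[ P ∈ allPoints ] ∑[ x ∈ allVectors ] ∑[ c ∈ elems ] (multiple x P c ℕ.* 𝟙 (U? x))
          ≡⟨ ∑-swap allPoints allVectors _ ⟩
        ∑[ x ∈ allVectors ] ∑[ P ∈ allPoints ] ∑[ c ∈ elems ] (multiple x P c ℕ.* 𝟙 (U? x))
          ≡⟨ ∑-cong allVectors (λ x → trans (∑-cong allPoints (λ P → ∑-*ʳ elems (𝟙 (U? x)) (multiple x P)))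
               (trans (∑-*ʳ allPoints (𝟙 (U? x)) _) (cong (ℕ._* 𝟙 (U? x)) (all-multiples x)))) ⟩
        ∑[ x ∈ allVectors ] (𝟙 (¬? (x ≟ᵛ 0ᵛ)) ℕ.* 𝟙 (U? x))
          ∎
        where open ≡-Reasoning

    vectors-points : countVectors U? ≡ 𝟙 (U? 0ᵛ) ℕ.+ (q ℕ.∸ 1) ℕ.* countPoints (λ P → U? (rep P))
    vectors-points = begin
      ∑[ x ∈ allVectors ] 𝟙 (U? x)
        ≡⟨ ∑-cong allVectors (λ x → trans (sym (ℕ.*-identityˡ _)) (trans
             (cong (ℕ._* 𝟙 (U? x)) (sym (𝟙-∁ (x ≟ᵛ 0ᵛ)))) (ℕ.*-distribʳ-+ (𝟙 (U? x)) (𝟙 (x ≟ᵛ 0ᵛ)) _))) ⟩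
      ∑[ x ∈ allVectors ] (𝟙 (x ≟ᵛ 0ᵛ) ℕ.* 𝟙 (U? x) ℕ.+ 𝟙 (¬? (x ≟ᵛ 0ᵛ)) ℕ.* 𝟙 (U? x))
        ≡⟨ ∑-+ allVectors _ _ ⟩
      ∑[ x ∈ allVectors ] (𝟙 (x ≟ᵛ 0ᵛ) ℕ.* 𝟙 (U? x)) ℕ.+ ∑[ x ∈ allVectors ] (𝟙 (¬? (x ≟ᵛ 0ᵛ)) ℕ.* 𝟙 (U? x))
        ≡⟨ cong₂ ℕ._+_ (FiniteProperties.∑-pick vectors 0ᵛ {λ x → 𝟙 (U? x)} (λ { refl → refl })) (sym nonzero-vectors) ⟩
      𝟙 (U? 0ᵛ) ℕ.+ (q ℕ.∸ 1) ℕ.* countPoints (λ P → U? (rep P)) ∎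
      where open ≡-Reasoning

-- Putting `q = suc p` states `(q - 1) θ = q ^ k - 1` without truncated subtraction.
θ<-geometric : ∀ k p → 1 ℕ.+ p ℕ.* θ< k (suc p) ≡ suc p ℕ.^ k
θ<-geometric zero    p = cong suc (ℕ.*-zeroʳ p)
θ<-geometric (suc k) p = trans (rearrange p (suc p ℕ.^ k) (θ< k (suc p)))
  (cong (ℕ._+ p ℕ.* suc p ℕ.^ k) (θ<-geometric k p))
  where
  rearrange : ∀ p a b → 1 ℕ.+ p ℕ.* (a ℕ.+ b) ≡ 1 ℕ.+ p ℕ.* b ℕ.+ p ℕ.* a
  rearrange = solve-∀

-- Converts a number of vectors, which is a power of `q`, into the corresponding number `h` of
-- points.
θ<-unique : ∀ {q h} k → 2 ≤ q → q ℕ.^ k ≡ 1 ℕ.+ (q ℕ.∸ 1) ℕ.* h → h ≡ θ< k q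
θ<-unique {suc (suc p)} {h} k (s≤s (s≤s z≤n)) e =
  ℕ.*-cancelˡ-≡ h (θ< k (suc (suc p))) (suc p) (ℕ.suc-injective (trans (sym e) (sym (θ<-geometric k (suc p)))))

-- Quadratic forms and their polar forms.

module DotProduct {q : ℕ} (F : FiniteField q) where
  open FieldTheory F

  dotᵛ : ∀ {k} → Vec Carrier k → Vec Carrier k → Carrier
  dotᵛ x y = foldr′ _+_ 0# (zipWith _*_ x y)

  comb : ∀ {k} → Carrier → Carrier → Vec Carrier k → Vec Carrier k → Vec Carrier k
  comb a b x y = zipWith _+_ (map (a *_) x) (map (b *_) y)

  dot-combˡ : ∀ {k} a b (x y z : Vec Carrier k) → dotᵛ (comb a b x y) z ≡ a * dotᵛ x z + b * dotᵛ y z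
  dot-combˡ a b []      []      []      = solve 2 (λ a b → :0 := a :* :0 :+ b :* :0) refl a b
  dot-combˡ a b (s ∷ x) (t ∷ y) (u ∷ z) = trans (cong ((a * s + b * t) * u +_) (dot-combˡ a b x y z))
    (solve 7 (λ a b s t u X Y → (a :* s :+ b :* t) :* u :+ (a :* X :+ b :* Y)
      := a :* (s :* u :+ X) :+ b :* (t :* u :+ Y)) refl a b s t u (dotᵛ x z) (dotᵛ y z))

  dot-combʳ : ∀ {k} a b (z x y : Vec Carrier k) → dotᵛ z (comb a b x y) ≡ a * dotᵛ z x + b * dotᵛ z y
  dot-combʳ a b []      []      []      = solve 2 (λ a b → :0 := a :* :0 :+ b :* :0) refl a b
  dot-combʳ a b (u ∷ z) (s ∷ x) (t ∷ y) = trans (cong (u * (a * s + b * t) +_) (dot-combʳ a b z x y))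
    (solve 7 (λ a b s t u X Y → u :* (a :* s :+ b :* t) :+ (a :* X :+ b :* Y)
      := a :* (u :* s :+ X) :+ b :* (u :* t :+ Y)) refl a b s t u (dotᵛ z x) (dotᵛ z y))

  rows-comb : ∀ {k l} a b (A : Vec (Vec Carrier k) l) (x y : Vec Carrier k) →
    map (λ row → dotᵛ row (comb a b x y)) A ≡ comb a b (map (λ row → dotᵛ row x) A) (map (λ row → dotᵛ row y) A)
  rows-comb a b []        x y = refl
  rows-comb a b (row ∷ A) x y = cong₂ _∷_ (dot-combʳ a b row x y) (rows-comb a b A x y)

-- Later counting refers to the form only through these laws, so the matrix behind it can be
-- forgotten and both fields are treated alike.
record QuadraticSpace {q : ℕ} (F : FiniteField q) (n : ℕ) : Set where
  open FieldTheory F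
  open VectorIdentities F
  open Projective F n
  open Counting F n using (Linear)
  open Geometry F n using (≈ᵖ-sym)
  field
    Q             : Vector → Carrier
    polar         : Vector → Vector → Carrier
    Q-combination : ∀ a b x y → Q (a • x ⊕ b • y) ≡ a * a * Q x + b * b * Q y + a * b * polar x y
    polar-linear  : ∀ x → Linear (polar x)
    polar-sym     : ∀ x y → polar x y ≡ polar y x
    polar-self    : ∀ x → polar x x ≡ (1# + 1#) * Q x

  polar-linearˡ : ∀ a b x y z → polar (a • x ⊕ b • y) z ≡ a * polar x z + b * polar y z
  polar-linearˡ a b x y z = trans (polar-sym _ z) (trans (polar-linear z a b x y)
    (cong₂ (λ s t → a * s + b * t) (polar-sym z x) (polar-sym z y)))

  Q-• : ∀ c x → Q (c • x) ≡ c * c * Q x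
  Q-• c x = begin
    Q (c • x)                                                 ≡⟨ cong Q (trans (cong (c • x ⊕_) (0• x)) (⊕-identityʳ _)) ⟨
    Q (c • x ⊕ 0# • x)                                        ≡⟨ Q-combination c 0# x x ⟩
    c * c * Q x + 0# * 0# * Q x + c * 0# * polar x x          ≡⟨ solve 3 (λ c s t → c :* c :* s :+ :0 :* :0 :* s :+ c :* :0 :* t := c :* c :* s) refl c (Q x) (polar x x) ⟩
    c * c * Q x                                               ∎
    where open ≡-Reasoning

  Q-zero : ∀ c x → Q x ≡ 0# → Q (c • x) ≡ 0#
  Q-zero c x e = trans (Q-• c x) (trans (cong (c * c *_) e) (zeroʳ _))

  Q-resp : ∀ P R → P ≈ᵖ R → Q (rep P) ≡ 0# → Q (rep R) ≡ 0#
  Q-resp P R P≈R e = let c , f = ≈ᵖ-sym P R P≈R in trans (cong Q f) (Q-zero c _ e)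

  Nondegenerate : Set
  Nondegenerate = ∀ x → (∀ y → polar x y ≡ 0#) → x ≡ 0ᵛ

  Q-0ᵛ : Q 0ᵛ ≡ 0#
  Q-0ᵛ = trans (cong Q (sym (0• 0ᵛ))) (trans (Q-• 0# 0ᵛ) (solve 1 (λ s → :0 :* :0 :* s := :0) refl (Q 0ᵛ)))

module QuadricProperties {q : ℕ} (F : FiniteField q) (n : ℕ) (A : Projective.QuadraticForm F n) where
  open FieldTheory F
  open VectorIdentities F
  open DotProduct F
  open Projective F n
  open Quadric A
  open Counting F n using (Linear)

  bilinear : Vector → Vector → Carrier
  bilinear x y = dot x (map (λ row → dot row y) A)

  bilinear-combˡ : ∀ a b x y z → bilinear (a • x ⊕ b • y) z ≡ a * bilinear x z + b * bilinear y z
  bilinear-combˡ a b x y z = dot-combˡ a b x y _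

  bilinear-combʳ : ∀ a b z x y → bilinear z (a • x ⊕ b • y) ≡ a * bilinear z x + b * bilinear z y
  bilinear-combʳ a b z x y = trans (cong (dot z) (rows-comb a b A x y)) (dot-combʳ a b z _ _)

  Q-bilinear : ∀ a b x y → Q (a • x ⊕ b • y) ≡
    a * a * Q x + b * b * Q y + a * b * (bilinear x y + bilinear y x)
  Q-bilinear a b x y = begin
    bilinear (a • x ⊕ b • y) (a • x ⊕ b • y)
      ≡⟨ bilinear-combˡ a b x y _ ⟩
    a * bilinear x (a • x ⊕ b • y) + b * bilinear y (a • x ⊕ b • y)
      ≡⟨ cong₂ (λ s t → a * s + b * t) (bilinear-combʳ a b x x y) (bilinear-combʳ a b y x y) ⟩
    a * (a * Q x + b * bilinear x y) + b * (a * bilinear y x + b * Q y)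
      ≡⟨ solve 6 (λ a b X Y S T → a :* (a :* X :+ b :* S) :+ b :* (a :* T :+ b :* Y)
           := a :* a :* X :+ b :* b :* Y :+ a :* b :* (S :+ T)) refl a b (Q x) (Q y) (bilinear x y) (bilinear y x) ⟩
    a * a * Q x + b * b * Q y + a * b * (bilinear x y + bilinear y x) ∎
    where open ≡-Reasoning

  -- For a matrix that need not be symmetric both cross terms of the expansion survive; their sum is
  -- visibly bilinear and symmetric.
  polar-bilinear : ∀ x y → polar x y ≡ bilinear x y + bilinear y x
  polar-bilinear x y = begin
    Q (x ⊕ y) - Q x - Q y
      ≡⟨ cong (λ z → Q z - Q x - Q y) (cong₂ _⊕_ (1• x) (1• y)) ⟨
    Q (1# • x ⊕ 1# • y) - Q x - Q y
      ≡⟨ cong (λ z → z - Q x - Q y) (Q-bilinear 1# 1# x y) ⟩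
    1# * 1# * Q x + 1# * 1# * Q y + 1# * 1# * (bilinear x y + bilinear y x) - Q x - Q y
      ≡⟨ solve 3 (λ X Y S → :1 :* :1 :* X :+ :1 :* :1 :* Y :+ :1 :* :1 :* S :- X :- Y := S)
           refl (Q x) (Q y) _ ⟩
    bilinear x y + bilinear y x ∎
    where open ≡-Reasoning

  Q-combination : ∀ a b x y → Q (a • x ⊕ b • y) ≡ a * a * Q x + b * b * Q y + a * b * polar x y
  Q-combination a b x y = trans (Q-bilinear a b x y)
    (cong (λ u → a * a * Q x + b * b * Q y + a * b * u) (sym (polar-bilinear x y)))

  polar-linear : ∀ x → Linear (polar x)
  polar-linear x a b y z = begin
    polar x (a • y ⊕ b • z)
      ≡⟨ polar-bilinear x _ ⟩
    bilinear x (a • y ⊕ b • z) + bilinear (a • y ⊕ b • z) x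
      ≡⟨ cong₂ _+_ (bilinear-combʳ a b x y z) (bilinear-combˡ a b y z x) ⟩
    a * bilinear x y + b * bilinear x z + (a * bilinear y x + b * bilinear z x)
      ≡⟨ solve 6 (λ a b s t u v → a :* s :+ b :* t :+ (a :* u :+ b :* v) := a :* (s :+ u) :+ b :* (t :+ v))
           refl a b (bilinear x y) (bilinear x z) (bilinear y x) (bilinear z x) ⟩
    a * (bilinear x y + bilinear y x) + b * (bilinear x z + bilinear z x)
      ≡⟨ cong₂ (λ s t → a * s + b * t) (polar-bilinear x y) (polar-bilinear x z) ⟨
    a * polar x y + b * polar x z ∎
    where open ≡-Reasoning

  polar-sym : ∀ x y → polar x y ≡ polar y x
  polar-sym x y = trans (polar-bilinear x y) (trans (+-comm _ _) (sym (polar-bilinear y x)))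

  polar-self : ∀ x → polar x x ≡ (1# + 1#) * Q x
  polar-self x = trans (polar-bilinear x x)
    (solve 1 (λ s → s :+ s := (:1 :+ :1) :* s) refl (Q x))

quadraticSpace : ∀ {q} (F : FiniteField q) n → Projective.QuadraticForm F n → QuadraticSpace F n
quadraticSpace F n A = record
  { Q = Q ; polar = polar ; Q-combination = Q-combination
  ; polar-linear = polar-linear ; polar-sym = polar-sym ; polar-self = polar-self }
  where
  open Projective.Quadric F n A
  open QuadricProperties F n A

-- Zeros of quadratic forms on subspaces.

module QuadricCounting {q : ℕ} (F : FiniteField q) (n : ℕ) (S : QuadraticSpace F n)
                       (2≢0 : FieldTheory._+_ F (FieldTheory.1# F) (FieldTheory.1# F) ≢ FieldTheory.0# F) where
  open FieldTheory F
  open VectorIdentities F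
  open Projective F n
  open Geometry F n
  open Counting F n
  open QuadraticSpace S
  private module V = FiniteProperties vectors

  translate : ∀ x t (h : Vector → ℕ) → ∑[ z ∈ allVectors ] h (z ⊕ t • x) ≡ ∑ allVectors h
  translate x t h = begin
    ∑[ z ∈ allVectors ] h (z ⊕ t • x)
      ≡⟨ V.∑-pushforward allVectors (λ z → z ⊕ t • x) {h} (λ { refl → refl }) ⟩
    ∑[ y ∈ allVectors ] (h y ℕ.* ∑[ z ∈ allVectors ] 𝟙 (y ≟ᵛ z ⊕ t • x))
      ≡⟨ ∑-cong allVectors (λ y → trans (cong (h y ℕ.*_) (V.count-one (λ z → y ≟ᵛ z ⊕ t • x) (y ⊕ (- t) • x)
           (λ { z refl → sym (⊕-shift t x z) }) (λ { z refl → sym (⊕-shift′ t x y) })))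
           (ℕ.*-identityʳ (h y))) ⟩
    ∑ allVectors h ∎
    where open ≡-Reasoning

  -- Translation by `t • x` carries the level `φ = 0` of `U` onto the level `φ = t`, so the `q`
  -- levels are equally large. It serves hyperplane sections, pencils of lines through a point, and
  -- cones.
  slice : {U : Pred Vector 0ℓ} (U? : Decidable U) (φ : Vector → Carrier) (x : Vector) →
          (∀ z t → U z → U (z ⊕ t • x)) → (∀ z t → U z → φ (z ⊕ t • x) ≡ φ z + t) →
          countVectors U? ≡ q ℕ.* countVectors (λ z → U? z ×-dec (φ z ≟ 0#))
  slice {U} U? φ x stable shift = begin
    ∑[ z ∈ allVectors ] 𝟙 (U? z)
      ≡⟨ ∑-cong allVectors (λ z → trans (sym (ℕ.*-identityʳ _)) (trans (cong (𝟙 (U? z) ℕ.*_) (sym (once (φ z))))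
           (sym (∑-*ˡ elems (𝟙 (U? z)) (λ t → 𝟙 (t ≟ φ z)))))) ⟩
    ∑[ z ∈ allVectors ] ∑[ t ∈ elems ] (𝟙 (U? z) ℕ.* 𝟙 (t ≟ φ z))
      ≡⟨ ∑-swap allVectors elems _ ⟩
    ∑[ t ∈ elems ] ∑[ z ∈ allVectors ] (𝟙 (U? z) ℕ.* 𝟙 (t ≟ φ z))
      ≡⟨ ∑-cong elems (λ t → sym (translate x t (λ z → 𝟙 (U? z) ℕ.* 𝟙 (t ≟ φ z)))) ⟩
    ∑[ t ∈ elems ] ∑[ z ∈ allVectors ] (𝟙 (U? (z ⊕ t • x)) ℕ.* 𝟙 (t ≟ φ (z ⊕ t • x)))
      ≡⟨ ∑-cong elems (λ t → ∑-cong allVectors (λ z → trans (sym (𝟙-× (U? (z ⊕ t • x)) (t ≟ φ (z ⊕ t • x))))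
           (𝟙-cong (U? (z ⊕ t • x) ×-dec (t ≟ φ (z ⊕ t • x))) (U? z ×-dec (φ z ≟ 0#)) (to z t) (from z t)))) ⟩
    ∑[ t ∈ elems ] countVectors (λ z → U? z ×-dec (φ z ≟ 0#))
      ≡⟨ ∑-cong elems (λ t → sym (ℕ.*-identityˡ _)) ⟩
    ∑[ t ∈ elems ] (1 ℕ.* countVectors (λ z → U? z ×-dec (φ z ≟ 0#)))
      ≡⟨ trans (∑-*ʳ elems (countVectors (λ z → U? z ×-dec (φ z ≟ 0#))) (λ _ → 1))
           (cong (ℕ._* countVectors (λ z → U? z ×-dec (φ z ≟ 0#))) card≡q) ⟩
    q ℕ.* countVectors (λ z → U? z ×-dec (φ z ≟ 0#)) ∎
    where
    open ≡-Reasoning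
    to : ∀ z t → U (z ⊕ t • x) × t ≡ φ (z ⊕ t • x) → U z × φ z ≡ 0#
    to z t (u , e) = Uz , (begin
      φ z              ≡⟨ solve 2 (λ s t → s := s :+ t :- t) refl (φ z) t ⟩
      φ z + t - t      ≡⟨ cong (_- t) (trans (sym (shift z t Uz)) (sym e)) ⟩
      t - t            ≡⟨ -‿inverseʳ t ⟩
      0#               ∎)
      where
      Uz : U z
      Uz = subst U (⊕-shift t x z) (stable _ (- t) u)
    from : ∀ z t → U z × φ z ≡ 0# → U (z ⊕ t • x) × t ≡ φ (z ⊕ t • x)
    from z t (u , e) = stable z t u , sym (trans (shift z t u) (trans (cong (_+ t) e) (+-identityˡ t)))

  -- No dimension is attached; the cardinality, a power of `q` wherever it is computed, takes its
  -- place.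
  record Subspace : Set₁ where
    field
      mem    : Pred Vector 0ℓ
      mem?   : Decidable mem
      0∈     : mem 0ᵛ
      closed : ∀ a b {x y} → mem x → mem y → mem (a • x ⊕ b • y)

    shifted : ∀ t {z x} → mem z → mem x → mem (z ⊕ t • x)
    shifted t {z} {x} z∈ x∈ = subst (λ u → mem (u ⊕ t • x)) (1• z) (closed 1# t z∈ x∈)

    scaled : ∀ c {x} → mem x → mem (c • x)
    scaled c {x} x∈ = subst mem (trans (cong (c • x ⊕_) (0• x)) (⊕-identityʳ _)) (closed c 0# x∈ x∈)

    zero? : Decidable (λ z → mem z × Q z ≡ 0#)
    zero? z = mem? z ×-dec (Q z ≟ 0#)

    Nondegenerateˢ : Set
    Nondegenerateˢ = ∀ x → mem x → (∀ y → mem y → polar x y ≡ 0#) → x ≡ 0ᵛ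

  open Subspace

  whole : Subspace
  whole = record { mem = λ _ → ⊤ ; mem? = λ _ → yes tt ; 0∈ = tt ; closed = λ _ _ _ _ → tt }

  polar-0 : ∀ x → polar x 0ᵛ ≡ 0#
  polar-0 x = trans (cong (polar x) (sym (0• x))) (trans (linear-• (polar-linear x) 0# x) (zeroˡ _))

  infixl 5 _∩_⊥
  _∩_⊥ : Subspace → Vector → Subspace
  W ∩ x ⊥ = record
    { mem    = λ z → mem W z × polar x z ≡ 0#
    ; mem?   = λ z → mem? W z ×-dec (polar x z ≟ 0#)
    ; 0∈     = 0∈ W , polar-0 x
    ; closed = λ a b (y∈ , e) (z∈ , f) → closed W a b y∈ z∈ , linear-span (polar-linear x) (a , b , refl) e f
    }

  polar-shift : ∀ x z t y → polar x (z ⊕ t • y) ≡ polar x z + t * polar x y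
  polar-shift x z t y = trans (cong (λ u → polar x (u ⊕ t • y)) (sym (1• z)))
    (trans (polar-linear x 1# t z y) (cong (_+ t * polar x y) (*-identityˡ _)))

  Q-shift : ∀ z t x → Q (z ⊕ t • x) ≡ Q z + t * t * Q x + t * polar x z
  Q-shift z t x = trans (cong (λ u → Q (u ⊕ t • x)) (sym (1• z))) (trans (Q-combination 1# t z x)
    (trans (cong (λ u → 1# * 1# * Q z + t * t * Q x + 1# * t * u) (polar-sym z x))
      (solve 4 (λ s u t p → :1 :* :1 :* s :+ t :* t :* u :+ :1 :* t :* p := s :+ t :* t :* u :+ t :* p)
        refl (Q z) (Q x) t (polar x z))))

  singular⇒self-orthogonal : ∀ {x} → Q x ≡ 0# → polar x x ≡ 0#
  singular⇒self-orthogonal {x} e = trans (polar-self x) (trans (cong ((1# + 1#) *_) e) (zeroʳ _))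

  nonsingular⇒polar≢0 : ∀ {x} → Q x ≢ 0# → polar x x ≢ 0#
  nonsingular⇒polar≢0 {x} ne e = *-nonzero 2≢0 ne (trans (sym (polar-self x)) e)

  -- One Gram-Schmidt step: the multiple of `x` to add is `- polar x y / polar x x`, and
  -- `polar x x = 2 Q x` is invertible in odd characteristic.
  orthogonalize : ∀ {x} → Q x ≢ 0# → ∀ y → ∃ λ c → polar x (c • x ⊕ 1# • y) ≡ 0#
  orthogonalize {x} Qx≢0 y = let d , e = inverse _ (nonsingular⇒polar≢0 Qx≢0) in - (polar x y * d) , (begin
    polar x ((- (polar x y * d)) • x ⊕ 1# • y)        ≡⟨ polar-linear x _ 1# x y ⟩
    - (polar x y * d) * polar x x + 1# * polar x y    ≡⟨ solve 3 (λ p d s → (:- (p :* d)) :* s :+ :1 :* p := p :- p :* (d :* s)) refl (polar x y) d (polar x x) ⟩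
    polar x y - polar x y * (d * polar x x)           ≡⟨ cong (λ u → polar x y - polar x y * u) e ⟩
    polar x y - polar x y * 1#                        ≡⟨ solve 1 (λ p → p :- p :* :1 := :0) refl (polar x y) ⟩
    0#                                                ∎)
    where open ≡-Reasoning

  normalize : ∀ W {x y} → mem W y → polar x y ≢ 0# → ∃ λ y′ → mem W y′ × polar x y′ ≡ 1#
  normalize W {x} {y} y∈ ne with inverse _ ne
  ... | d , e = d • y , scaled W d y∈ , trans (linear-• (polar-linear x) d y) e

  abstract
    size zeros : Subspace → ℕ
    size W  = countVectors (mem? W)
    zeros W = countVectors (zero? W)

    size-def : ∀ W → size W ≡ countVectors (mem? W)
    size-def W = refl

    zeros-def : ∀ W → zeros W ≡ countVectors (zero? W)
    zeros-def W = refl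

    -- Along `y` the functional `polar x` grows at unit rate, so its levels are translates of its
    -- kernel. This stands in for the dimension formula of a hyperplane.
    size-⊥ : ∀ W {x y} → mem W y → polar x y ≡ 1# → size W ≡ q ℕ.* size (W ∩ x ⊥)
    size-⊥ W {x} {y} y∈ e = slice (mem? W) (polar x) y (λ z t z∈ → shifted W t z∈ y∈)
      (λ z t _ → trans (polar-shift x z t y) (cong (polar x z +_) (trans (cong (t *_) e) (*-identityʳ t))))

    -- Every line through the singular point x that is not tangent contains
    -- exactly one further singular point.
    pencil : ∀ W {x} → mem W x → Q x ≡ 0# →
             size W ℕ.+ q ℕ.* zeros (W ∩ x ⊥) ≡ size (W ∩ x ⊥) ℕ.+ q ℕ.* zeros W
    pencil W {x} x∈ Qx≡0 = begin
      size W ℕ.+ q ℕ.* zeros (W ∩ x ⊥)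
        ≡⟨ cong (ℕ._+ q ℕ.* zeros (W ∩ x ⊥)) (V.count-split (mem? W) (λ z → polar x z ≟ 0#)) ⟩
      size (W ∩ x ⊥) ℕ.+ countVectors off? ℕ.+ q ℕ.* zeros (W ∩ x ⊥)
        ≡⟨ cong (λ u → size (W ∩ x ⊥) ℕ.+ u ℕ.+ q ℕ.* zeros (W ∩ x ⊥)) (slice off? φ x off-stable φ-shift) ⟩
      size (W ∩ x ⊥) ℕ.+ q ℕ.* countVectors (λ z → off? z ×-dec (φ z ≟ 0#)) ℕ.+ q ℕ.* zeros (W ∩ x ⊥)
        ≡⟨ rearrange q (size (W ∩ x ⊥)) _ (zeros (W ∩ x ⊥)) ⟩
      size (W ∩ x ⊥) ℕ.+ q ℕ.* (zeros (W ∩ x ⊥) ℕ.+ countVectors (λ z → off? z ×-dec (φ z ≟ 0#)))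
        ≡⟨ cong (λ u → size (W ∩ x ⊥) ℕ.+ q ℕ.* u) (sym (trans
             (V.count-split (zero? W) (λ z → polar x z ≟ 0#))
             (cong₂ ℕ._+_
               (V.count-cong _ (zero? (W ∩ x ⊥)) (λ { z ((w , e) , f) → (w , f) , e }) (λ { z ((w , f) , e) → (w , e) , f }))
               (V.count-cong _ (λ z → off? z ×-dec (φ z ≟ 0#))
                 (λ { z ((w , e) , ne) → (w , ne) , trans (cong (inv (polar x z) *_) e) (zeroʳ _) })
                 (λ { z ((w , ne) , e) → (w , integral e (inv≢0 ne)) , ne }))))) ⟩
      size (W ∩ x ⊥) ℕ.+ q ℕ.* zeros W ∎
      where
      open ≡-Reasoning
      off? : Decidable (λ z → mem W z × polar x z ≢ 0#)
      off? z = mem? W z ×-dec ¬? (polar x z ≟ 0#)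
      -- A total inverse with default 0; only its values at nonzero arguments matter.
      inv : Carrier → Carrier
      inv c with c ≟ 0#
      ... | yes _  = 0#
      ... | no c≢0 = proj₁ (inverse c c≢0)
      inv-* : ∀ {c} → c ≢ 0# → inv c * c ≡ 1#
      inv-* {c} c≢0 with c ≟ 0#
      ... | yes z = contradiction z c≢0
      ... | no nz = proj₂ (inverse c nz)
      inv≢0 : ∀ {c} → c ≢ 0# → inv c ≢ 0#
      inv≢0 {c} c≢0 e = 1≢0 (trans (sym (inv-* c≢0)) (trans (cong (_* c) e) (zeroˡ c)))
      -- Since `Q (z + t x) = Q z + t polar x z` for singular `x`, this quotient grows by `t` along
      -- `x`; where `polar x z ≠ 0` it vanishes exactly at the singular vectors.
      φ : Vector → Carrier
      φ z = inv (polar x z) * Q z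
      polar-stable : ∀ z t → polar x (z ⊕ t • x) ≡ polar x z
      polar-stable z t = trans (polar-shift x z t x) (trans (cong (λ u → polar x z + t * u) (singular⇒self-orthogonal Qx≡0))
        (solve 2 (λ s t → s :+ t :* :0 := s) refl (polar x z) t))
      off-stable : ∀ z t → mem W z × polar x z ≢ 0# → mem W (z ⊕ t • x) × polar x (z ⊕ t • x) ≢ 0#
      off-stable z t (w , ne) = shifted W t w x∈ , λ e → ne (trans (sym (polar-stable z t)) e)
      φ-shift : ∀ z t → mem W z × polar x z ≢ 0# → φ (z ⊕ t • x) ≡ φ z + t
      φ-shift z t (_ , ne) = begin
        inv (polar x (z ⊕ t • x)) * Q (z ⊕ t • x)
          ≡⟨ cong₂ (λ s u → inv s * u) (polar-stable z t) (trans (Q-shift z t x) (cong (λ u → Q z + t * t * u + t * polar x z) Qx≡0)) ⟩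
        inv (polar x z) * (Q z + t * t * 0# + t * polar x z)
          ≡⟨ solve 4 (λ i s t p → i :* (s :+ t :* t :* :0 :+ t :* p) := i :* s :+ t :* (i :* p))
               refl (inv (polar x z)) (Q z) t (polar x z) ⟩
        φ z + t * (inv (polar x z) * polar x z)
          ≡⟨ cong (λ u → φ z + t * u) (inv-* ne) ⟩
        φ z + t * 1#
          ≡⟨ cong (φ z +_) (*-identityʳ t) ⟩
        φ z + t ∎
      rearrange : ∀ q a b c → a ℕ.+ q ℕ.* b ℕ.+ q ℕ.* c ≡ a ℕ.+ q ℕ.* (c ℕ.+ b)
      rearrange = solve-∀

    -- Singular vectors of `x ⊥` stay singular under translation by multiples of `x`; `polar y`
    -- grows at unit rate along `x` and selects one vector from each such coset.
    cone : ∀ W {x y} → mem W x → Q x ≡ 0# → polar x y ≡ 1# →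
           zeros (W ∩ x ⊥) ≡ q ℕ.* zeros (W ∩ x ⊥ ∩ y ⊥)
    cone W {x} {y} x∈ Qx≡0 e = trans
      (slice (zero? (W ∩ x ⊥)) (polar y) x stable shift)
      (cong (q ℕ.*_) (V.count-cong _ (zero? (W ∩ x ⊥ ∩ y ⊥))
        (λ { z ((w , f) , g) → (w , g) , f }) (λ { z ((w , g) , f) → (w , f) , g })))
      where
      stable : ∀ z t → mem (W ∩ x ⊥) z × Q z ≡ 0# → mem (W ∩ x ⊥) (z ⊕ t • x) × Q (z ⊕ t • x) ≡ 0#
      stable z t (w , f) = shifted (W ∩ x ⊥) t w (x∈ , singular⇒self-orthogonal Qx≡0) , (begin
        Q (z ⊕ t • x)                          ≡⟨ Q-shift z t x ⟩
        Q z + t * t * Q x + t * polar x z      ≡⟨ cong₂ _+_ (cong₂ (λ s u → s + t * t * u) f Qx≡0) (cong (t *_) (proj₂ w)) ⟩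
        0# + t * t * 0# + t * 0#               ≡⟨ solve 1 (λ t → :0 :+ t :* t :* :0 :+ t :* :0 := :0) refl t ⟩
        0#                                     ∎)
        where open ≡-Reasoning
      shift : ∀ z t → mem (W ∩ x ⊥) z × Q z ≡ 0# → polar y (z ⊕ t • x) ≡ polar y z + t
      shift z t _ = trans (polar-shift y z t x)
        (cong (polar y z +_) (trans (cong (t *_) (trans (polar-sym y x) e)) (*-identityʳ t)))

    nonzero-vector : ∀ W → 1 < size W → ∃ λ x → mem W x × x ≢ 0ᵛ
    nonzero-vector W 1< with V.find (λ x → mem? W x ×-dec ¬? (x ≟ᵛ 0ᵛ)) (λ { refl e → e })
    ... | yes p = p
    ... | no ¬∃ = contradiction (V.count-one (mem? W) 0ᵛ only (λ { _ refl → 0∈ W })) (ℕ.>⇒≢ 1<)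
      where
      only : ∀ x → mem W x → x ≡ 0ᵛ
      only x x∈ with x ≟ᵛ 0ᵛ
      ... | yes e = e
      ... | no ne = contradiction (x , x∈ , ne) ¬∃

    zeros-one : ∀ W → (∀ x → mem W x × Q x ≡ 0# → x ≡ 0ᵛ) → zeros W ≡ 1
    zeros-one W only = V.count-one (zero? W) 0ᵛ only (λ { _ refl → 0∈ W , Q-0ᵛ })

    2≤size : ∀ W {x} → mem W x → x ≢ 0ᵛ → 2 ≤ size W
    2≤size W {x} x∈ x≢0 = begin
      2
        ≡⟨ cong₂ ℕ._+_ (Finite.once vectors x) (Finite.once vectors 0ᵛ) ⟨
      ∑[ z ∈ allVectors ] 𝟙 (z ≟ᵛ x) ℕ.+ ∑[ z ∈ allVectors ] 𝟙 (z ≟ᵛ 0ᵛ)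
        ≡⟨ ∑-+ allVectors _ _ ⟨
      ∑[ z ∈ allVectors ] (𝟙 (z ≟ᵛ x) ℕ.+ 𝟙 (z ≟ᵛ 0ᵛ))
        ≤⟨ ∑-mono allVectors term ⟩
      size W ∎
      where
      open ℕ.≤-Reasoning
      term : ∀ z → 𝟙 (z ≟ᵛ x) ℕ.+ 𝟙 (z ≟ᵛ 0ᵛ) ≤ 𝟙 (mem? W z)
      term z with z ≟ᵛ x | z ≟ᵛ 0ᵛ
      ... | yes f    | yes g    = contradiction (trans (sym f) g) x≢0
      ... | yes refl | no _     = ℕ.≤-reflexive (sym (𝟙-yes (mem? W x) x∈))
      ... | no _     | yes refl = ℕ.≤-reflexive (sym (𝟙-yes (mem? W 0ᵛ) (0∈ W)))
      ... | no _     | no _     = z≤n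

  dual-vector : ∀ W → Nondegenerateˢ W → ∀ {x} → mem W x → x ≢ 0ᵛ → ∃ λ y → mem W y × polar x y ≡ 1#
  dual-vector W nondeg {x} x∈ x≢0 with V.find (λ y → mem? W y ×-dec ¬? (polar x y ≟ 0#)) (λ { refl e → e })
  ... | yes (y , y∈ , ne) = normalize W y∈ ne
  ... | no ¬∃ = contradiction (nondeg x x∈ orthogonal) x≢0
    where
    orthogonal : ∀ y → mem W y → polar x y ≡ 0#
    orthogonal y y∈ with polar x y ≟ 0#
    ... | yes e = e
    ... | no ne = contradiction (y , y∈ , ne) ¬∃

  -- Should both vectors of a pair with `polar z y = 1` be singular, `Q` takes the value 1 at their
  -- sum.
  nonsingular-vector : ∀ W → Nondegenerateˢ W → 1 < size W → ∃ λ x → mem W x × Q x ≢ 0#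
  nonsingular-vector W nondeg 1< with nonzero-vector W 1<
  ... | z , z∈ , z≢0 with dual-vector W nondeg z∈ z≢0
  ...   | y , y∈ , e with Q z ≟ 0# | Q y ≟ 0#
  ...     | no ne | _     = z , z∈ , ne
  ...     | yes _ | no ne = y , y∈ , ne
  ...     | yes f | yes g = z ⊕ 1# • y , shifted W 1# z∈ y∈ , λ h → 1≢0 (begin
    1#                                      ≡⟨ solve 0 (:1 := :0 :+ :1 :* :1 :* :0 :+ :1 :* :1) refl ⟩
    0# + 1# * 1# * 0# + 1# * 1#             ≡⟨ cong₂ _+_ (cong₂ (λ s t → s + 1# * 1# * t) f g) (cong (1# *_) (trans (polar-sym y z) e)) ⟨
    Q z + 1# * 1# * Q y + 1# * polar y z    ≡⟨ Q-shift z 1# y ⟨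
    Q (z ⊕ 1# • y)                          ≡⟨ h ⟩
    0#                                      ∎)
    where open ≡-Reasoning

  -- Every `w` in `W` becomes orthogonal to `x` after adding a multiple of `x`, and this does not
  -- change `polar z w` because `z` is itself orthogonal to `x`.
  nondegenerate-⊥ : ∀ W → Nondegenerateˢ W → ∀ {x} → mem W x → Q x ≢ 0# → Nondegenerateˢ (W ∩ x ⊥)
  nondegenerate-⊥ W nondeg {x} x∈ Qx≢0 z (z∈ , xz≡0) orthogonal = nondeg z z∈ λ w w∈ →
    let c , e = orthogonalize Qx≢0 w in begin
    polar z w                       ≡⟨ solve 2 (λ c s → s := c :* :0 :+ :1 :* s) refl c (polar z w) ⟩
    c * 0# + 1# * polar z w         ≡⟨ cong (λ u → c * u + 1# * polar z w) (trans (polar-sym z x) xz≡0) ⟨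
    c * polar z x + 1# * polar z w  ≡⟨ polar-linear z c 1# x w ⟨
    polar z (c • x ⊕ 1# • w)        ≡⟨ orthogonal _ (closed W c 1# x∈ w∈ , e) ⟩
    0#                              ∎
    where open ≡-Reasoning

  -- Any `w` is moved into the complement by adding multiples of `y` and `x`, to which `z` is
  -- orthogonal. Adding `β w • y` achieves orthogonality to `x`; the later multiple of `x` preserves
  -- it because `x` is self-orthogonal.
  nondegenerate-hyperbolic : ∀ W → Nondegenerateˢ W → ∀ {x y} → mem W x → mem W y →
    Q x ≡ 0# → polar x y ≡ 1# → Nondegenerateˢ (W ∩ x ⊥ ∩ y ⊥)
  nondegenerate-hyperbolic W nondeg {x} {y} x∈ y∈ Qx≡0 xy≡1 z ((z∈ , xz≡0) , yz≡0) orthogonal =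
    nondeg z z∈ λ w w∈ → trans (sym (trans (fixes xz≡0 (w₁ w) (α w)) (fixes yz≡0 w (β w))))
      (orthogonal (w₂ w) ((shifted W (α w) (shifted W (β w) w∈ y∈) x∈ , x⊥w₂ w) , y⊥w₂ w))
    where
    open ≡-Reasoning
    fixes : ∀ {v} → polar v z ≡ 0# → ∀ w t → polar z (w ⊕ t • v) ≡ polar z w
    fixes {v} vz≡0 w t = trans (polar-shift z w t v) (trans
      (cong (λ u → polar z w + t * u) (trans (polar-sym z v) vz≡0))
      (solve 2 (λ s t → s :+ t :* :0 := s) refl (polar z w) t))
    β α : Vector → Carrier
    w₁ w₂ : Vector → Vector
    β w  = - polar x w
    w₁ w = w ⊕ β w • y
    α w  = - polar y (w₁ w)
    w₂ w = w₁ w ⊕ α w • x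
    x⊥w₂ : ∀ w → polar x (w₂ w) ≡ 0#
    x⊥w₂ w = begin
      polar x (w₂ w)                                    ≡⟨ polar-shift x (w₁ w) (α w) x ⟩
      polar x (w₁ w) + α w * polar x x                  ≡⟨ cong₂ (λ s t → s + α w * t) (polar-shift x w (β w) y) (singular⇒self-orthogonal Qx≡0) ⟩
      polar x w + β w * polar x y + α w * 0#            ≡⟨ cong (λ s → polar x w + β w * s + α w * 0#) xy≡1 ⟩
      polar x w + β w * 1# + α w * 0#                   ≡⟨ solve 2 (λ p a → p :+ (:- p) :* :1 :+ a :* :0 := :0) refl (polar x w) (α w) ⟩
      0#                                                ∎
    y⊥w₂ : ∀ w → polar y (w₂ w) ≡ 0#
    y⊥w₂ w = begin
      polar y (w₂ w)                                    ≡⟨ polar-shift y (w₁ w) (α w) x ⟩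
      polar y (w₁ w) + α w * polar y x                  ≡⟨ cong (λ s → polar y (w₁ w) + α w * s) (trans (polar-sym y x) xy≡1) ⟩
      polar y (w₁ w) + α w * 1#                         ≡⟨ solve 1 (λ p → p :+ (:- p) :* :1 := :0) refl (polar y (w₁ w)) ⟩
      0#                                                ∎

  instance
    q-nonZero : ℕ.NonZero q
    q-nonZero = ℕ.>-nonZero (ℕ.<-trans (s≤s z≤n) 2≤q)

  cancel-q : ∀ {a b} → q ℕ.* a ≡ q ℕ.* b → a ≡ b
  cancel-q {a} {b} = ℕ.*-cancelˡ-≡ a b q

  size-⊥-power : ∀ W {x y} k → mem W y → polar x y ≡ 1# → size W ≡ q ℕ.^ suc k → size (W ∩ x ⊥) ≡ q ℕ.^ k
  size-⊥-power W {x} {y} k y∈ xy≡1 e = cancel-q {size (W ∩ x ⊥)} {q ℕ.^ k} (trans (sym (size-⊥ W {x} {y} y∈ xy≡1)) e)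

  1<q^suc : ∀ k → 1 < q ℕ.^ suc k
  1<q^suc k = ℕ.<-≤-trans 2≤q (subst (_≤ q ℕ.^ suc k) (ℕ.*-identityʳ q)
    (ℕ.*-monoʳ-≤ q (ℕ.m^n>0 q k)))

  -- A multiple of `x` itself serves as the vector with pairing 1, as `polar x x` is nonzero.
  size-nonsingular-⊥ : ∀ W {x k} → mem W x → Q x ≢ 0# → size W ≡ q ℕ.^ suc k → size (W ∩ x ⊥) ≡ q ℕ.^ k
  size-nonsingular-⊥ W {x} {k} x∈ Qx≢0 = from-dual (normalize W x∈ (nonsingular⇒polar≢0 Qx≢0))
    where
    from-dual : (∃ λ y → mem W y × polar x y ≡ 1#) → size W ≡ q ℕ.^ suc k → size (W ∩ x ⊥) ≡ q ℕ.^ k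
    from-dual (y , y∈ , xy≡1) = size-⊥-power W k y∈ xy≡1

  -- On mutually orthogonal vectors the form is diagonal, so a zero `(s, t, 1)` of the ternary form
  -- gives `s x₁ + t x₂ + x₃`. This vector is nonzero because its pairing with `x₃` is
  -- `polar x₃ x₃`.
  isotropic-vector : ∀ W {x₁ x₂ x₃} → mem W x₁ → mem (W ∩ x₁ ⊥) x₂ → mem (W ∩ x₁ ⊥ ∩ x₂ ⊥) x₃ → Q x₃ ≢ 0# →
    (∃₂ λ s t → Q x₁ * (s * s) + (Q x₂ * (t * t) + Q x₃) ≡ 0#) → ∃ λ x → mem W x × x ≢ 0ᵛ × Q x ≡ 0#
  isotropic-vector W {x₁} {x₂} {x₃} x₁∈ x₂∈ x₃∈ Q₃ (s , t , isotropic) = v , v∈ , v≢0 , (begin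
    Q v
      ≡⟨ Q-shift x₃ 1# u ⟩
    Q x₃ + 1# * 1# * Q u + 1# * polar u x₃
      ≡⟨ cong₂ (λ p r → Q x₃ + 1# * 1# * p + 1# * r)
           (trans (Q-combination s t x₁ x₂) (cong (λ p → s * s * Q x₁ + t * t * Q x₂ + s * t * p) (proj₂ x₂∈))) u⊥x₃ ⟩
    Q x₃ + 1# * 1# * (s * s * Q x₁ + t * t * Q x₂ + s * t * 0#) + 1# * 0#
      ≡⟨ solve 5 (λ a b c s t → c :+ :1 :* :1 :* (s :* s :* a :+ t :* t :* b :+ s :* t :* :0) :+ :1 :* :0
           := a :* (s :* s) :+ (b :* (t :* t) :+ c)) refl (Q x₁) (Q x₂) (Q x₃) s t ⟩
    Q x₁ * (s * s) + (Q x₂ * (t * t) + Q x₃)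
      ≡⟨ isotropic ⟩
    0# ∎)
    where
    open ≡-Reasoning
    u v : Vector
    u = s • x₁ ⊕ t • x₂
    v = x₃ ⊕ 1# • u
    u⊥x₃ : polar u x₃ ≡ 0#
    u⊥x₃ = trans (polar-linearˡ s t x₁ x₂ x₃) (trans (cong₂ (λ p r → s * p + t * r) (proj₂ (proj₁ x₃∈)) (proj₂ x₃∈))
      (solve 2 (λ s t → s :* :0 :+ t :* :0 := :0) refl s t))
    v∈ : mem W v
    v∈ = shifted W 1# (proj₁ (proj₁ x₃∈)) (closed W s t x₁∈ (proj₁ x₂∈))
    v≢0 : v ≢ 0ᵛ
    v≢0 v≡0 = nonsingular⇒polar≢0 Q₃ (begin
      polar x₃ x₃                     ≡⟨ solve 2 (λ p t → p := p :+ :1 :* :0) refl (polar x₃ x₃) t ⟩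
      polar x₃ x₃ + 1# * 0#           ≡⟨ cong (λ p → polar x₃ x₃ + 1# * p) (trans (polar-sym x₃ u) u⊥x₃) ⟨
      polar x₃ x₃ + 1# * polar x₃ u   ≡⟨ polar-shift x₃ x₃ 1# u ⟨
      polar x₃ v                      ≡⟨ cong (polar x₃) v≡0 ⟩
      polar x₃ 0ᵛ                     ≡⟨ polar-0 x₃ ⟩
      0#                              ∎)

  -- Cardinality at least `q ^ 3` leaves room for three mutually orthogonal nonsingular vectors, on
  -- which the diagonal ternary form has a nontrivial zero.
  singular-vector : ∀ W k → Nondegenerateˢ W → size W ≡ q ℕ.^ (3 ℕ.+ k) → ∃ λ x → mem W x × x ≢ 0ᵛ × Q x ≡ 0#
  singular-vector W k nondeg e =
    let x₁ , x₁∈ , Q₁ = nonsingular-vector W nondeg (subst (1 <_) (sym e) (1<q^suc (2 ℕ.+ k)))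
        W₁            = W ∩ x₁ ⊥
        e₁            = size-nonsingular-⊥ W {k = 2 ℕ.+ k} x₁∈ Q₁ e
        nondeg₁       = nondegenerate-⊥ W nondeg x₁∈ Q₁
        x₂ , x₂∈ , Q₂ = nonsingular-vector W₁ nondeg₁ (subst (1 <_) (sym e₁) (1<q^suc (1 ℕ.+ k)))
        W₂            = W₁ ∩ x₂ ⊥
        e₂            = size-nonsingular-⊥ W₁ {k = 1 ℕ.+ k} x₂∈ Q₂ e₁
        nondeg₂       = nondegenerate-⊥ W₁ nondeg₁ x₂∈ Q₂
        x₃ , x₃∈ , Q₃ = nonsingular-vector W₂ nondeg₂ (subst (1 <_) (sym e₂) (1<q^suc k))
    in isotropic-vector W x₁∈ x₂∈ x₃∈ Q₃ (ternary-isotropic (Q x₃) Q₁ Q₂)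

  -- The pencil identity ties `zeros W` to `zeros (W ∩ x ⊥)`, and the cone identity ties the latter
  -- to the complement of the hyperbolic plane; the powers `q ^ (2 + k)` on both sides then cancel.
  hyperbolic-step : ∀ k W {x y} → mem W x → mem W y → Q x ≡ 0# → polar x y ≡ 1# →
    size W ≡ q ℕ.^ (3 ℕ.+ k) →
    (size (W ∩ x ⊥ ∩ y ⊥) ≡ q ℕ.^ suc k → zeros (W ∩ x ⊥ ∩ y ⊥) ≡ q ℕ.^ k) →
    zeros W ≡ q ℕ.^ (2 ℕ.+ k)
  hyperbolic-step k W {x} {y} x∈ y∈ Qx≡0 xy≡1 e smaller =
    cancel-q (ℕ.+-cancelˡ-≡ (q ℕ.^ (2 ℕ.+ k)) (q ℕ.* zeros W) (q ℕ.* q ℕ.^ (2 ℕ.+ k)) (begin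
    q ℕ.^ (2 ℕ.+ k) ℕ.+ q ℕ.* zeros W
      ≡⟨ cong (ℕ._+ q ℕ.* zeros W) size₁ ⟨
    size (W ∩ x ⊥) ℕ.+ q ℕ.* zeros W
      ≡⟨ pencil W x∈ Qx≡0 ⟨
    size W ℕ.+ q ℕ.* zeros (W ∩ x ⊥)
      ≡⟨ cong₂ (λ s t → s ℕ.+ q ℕ.* t) e (trans (cone W x∈ Qx≡0 xy≡1) (cong (q ℕ.*_) (smaller size₂))) ⟩
    q ℕ.^ (3 ℕ.+ k) ℕ.+ q ℕ.* (q ℕ.* q ℕ.^ k)
      ≡⟨ ℕ.+-comm (q ℕ.^ (3 ℕ.+ k)) _ ⟩
    q ℕ.^ (2 ℕ.+ k) ℕ.+ q ℕ.* q ℕ.^ (2 ℕ.+ k) ∎))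
    where
    open ≡-Reasoning
    size₁ : size (W ∩ x ⊥) ≡ q ℕ.^ (2 ℕ.+ k)
    size₁ = size-⊥-power W (2 ℕ.+ k) y∈ xy≡1 e
    size₂ : size (W ∩ x ⊥ ∩ y ⊥) ≡ q ℕ.^ suc k
    size₂ = size-⊥-power (W ∩ x ⊥) (suc k) (x∈ , singular⇒self-orthogonal Qx≡0) (trans (polar-sym y x) xy≡1) size₁

  -- The dimension k * 2 + 1 enters through the cardinality only; hyperbolic
  -- planes are split off one at a time.
  zeros-odd : ∀ k W → Nondegenerateˢ W → size W ≡ q ℕ.^ suc (k ℕ.* 2) → zeros W ≡ q ℕ.^ (k ℕ.* 2)
  zeros-odd zero W nondeg e = zeros-one W only
    where
    only : ∀ x → mem W x × Q x ≡ 0# → x ≡ 0ᵛ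
    only x (x∈ , Qx≡0) with x ≟ᵛ 0ᵛ
    ... | yes x≡0 = x≡0
    -- A nonzero singular `x` lies in its own `x ⊥`, which has only `q ^ 0 = 1` element when `W` has
    -- `q`.
    ... | no x≢0 =
      let y , y∈ , xy≡1 = dual-vector W nondeg x∈ x≢0
      in contradiction (2≤size (W ∩ x ⊥) (x∈ , singular⇒self-orthogonal Qx≡0) x≢0)
           (ℕ.<⇒≱ (ℕ.≤-reflexive (cong suc (size-⊥-power W 0 y∈ xy≡1 e))))
  zeros-odd (suc k) W nondeg e =
    let x , x∈ , x≢0 , Qx≡0 = singular-vector W (k ℕ.* 2) nondeg e
        y , y∈ , xy≡1       = dual-vector W nondeg x∈ x≢0
    in hyperbolic-step (k ℕ.* 2) W x∈ y∈ Qx≡0 xy≡1 e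
         (zeros-odd k (W ∩ x ⊥ ∩ y ⊥) (nondegenerate-hyperbolic W nondeg x∈ y∈ Qx≡0 xy≡1))

  -- The pencil identity read the other way: the zeros of `W` are known and those of the tangent
  -- section are solved for. All it asks of `x` is a dual vector in `W`, so it can be iterated on
  -- the degenerate space `x ⊥`.
  zeros-⊥ : ∀ k W {x y} → mem W x → mem W y → Q x ≡ 0# → polar x y ≡ 1# →
            size W ≡ q ℕ.^ (2 ℕ.+ k) → zeros W ≡ q ℕ.^ (1 ℕ.+ k) → zeros (W ∩ x ⊥) ≡ q ℕ.^ k
  zeros-⊥ k W {x} {y} x∈ y∈ Qx≡0 xy≡1 e z =
    cancel-q (ℕ.+-cancelˡ-≡ (q ℕ.^ (2 ℕ.+ k)) (q ℕ.* zeros (W ∩ x ⊥)) (q ℕ.* q ℕ.^ k) (begin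
    q ℕ.^ (2 ℕ.+ k) ℕ.+ q ℕ.* zeros (W ∩ x ⊥)      ≡⟨ cong (ℕ._+ q ℕ.* zeros (W ∩ x ⊥)) e ⟨
    size W ℕ.+ q ℕ.* zeros (W ∩ x ⊥)               ≡⟨ pencil W x∈ Qx≡0 ⟩
    size (W ∩ x ⊥) ℕ.+ q ℕ.* zeros W               ≡⟨ cong₂ (λ s t → s ℕ.+ q ℕ.* t) (size-⊥-power W (1 ℕ.+ k) y∈ xy≡1 e) z ⟩
    q ℕ.^ (1 ℕ.+ k) ℕ.+ q ℕ.* q ℕ.^ (1 ℕ.+ k)      ≡⟨ ℕ.+-comm (q ℕ.^ (1 ℕ.+ k)) _ ⟩
    q ℕ.^ (2 ℕ.+ k) ℕ.+ q ℕ.* q ℕ.^ k              ∎))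
    where open ≡-Reasoning

  zeros⇒points : ∀ W e → zeros W ≡ q ℕ.^ e → countPoints (λ P → zero? W (rep P)) ≡ θ< e q
  zeros⇒points W e z = θ<-unique e 2≤q (begin
    q ℕ.^ e                                                      ≡⟨ trans (sym z) (zeros-def W) ⟩
    countVectors (zero? W)                                       ≡⟨ vectors-points (zero? W) (λ c x _ (x∈ , f) → scaled W c x∈ , Q-zero c x f) ⟩
    𝟙 (zero? W 0ᵛ) ℕ.+ (q ℕ.∸ 1) ℕ.* countPoints (λ P → zero? W (rep P))
      ≡⟨ cong (ℕ._+ (q ℕ.∸ 1) ℕ.* countPoints (λ P → zero? W (rep P))) (𝟙-yes (zero? W 0ᵛ) (0∈ W , Q-0ᵛ)) ⟩
    1 ℕ.+ (q ℕ.∸ 1) ℕ.* countPoints (λ P → zero? W (rep P))      ∎)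
    where open ≡-Reasoning

  module Parabolic (nondeg : Nondegenerate) (k : ℕ) (n≡ : n ≡ suc ((2 ℕ.+ k) ℕ.* 2)) where

    whole-nondegenerate : Nondegenerateˢ whole
    whole-nondegenerate x _ f = nondeg x (λ y → f y tt)

    size-whole : size whole ≡ q ℕ.^ suc ((2 ℕ.+ k) ℕ.* 2)
    size-whole = trans (size-def whole) (trans (∑-cong allVectors (λ _ → refl)) (trans card-vectors (cong (q ℕ.^_) n≡)))

    zeros-whole : zeros whole ≡ q ℕ.^ ((2 ℕ.+ k) ℕ.* 2)
    zeros-whole = zeros-odd (2 ℕ.+ k) whole whole-nondegenerate size-whole

    whole-dual : ∀ {x} → x ≢ 0ᵛ → ∃ λ y → polar x y ≡ 1#
    whole-dual x≢0 = let y , _ , e = dual-vector whole whole-nondegenerate tt x≢0 in y , e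

    -- Otherwise `polar y` vanishes on the kernel of `polar x` and is a multiple of it, so a
    -- nontrivial combination of `x` and `y` lies in the radical.
    independent-dual : ∀ {x y} → Independent x y → ∃ λ z → polar x z ≡ 0# × polar y z ≡ 1#
    independent-dual {x} {y} ind with V.find (λ z → (polar x z ≟ 0#) ×-dec ¬? (polar y z ≟ 0#)) (λ { refl e → e })
    ... | yes (z , e , ne) =
      let z′ , (_ , e′) , f = normalize (whole ∩ x ⊥) {y} (tt , e) ne in z′ , e′ , f
    ... | no ¬∃ = contradiction (proj₂ (ind (- polar y w) 1# dependent)) 1≢0
      where
      open ≡-Reasoning
      w = proj₁ (whole-dual (independent⇒fst≢0 ind))
      xw≡1 : polar x w ≡ 1#
      xw≡1 = proj₂ (whole-dual (independent⇒fst≢0 ind))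
      vanishes : ∀ z → polar x z ≡ 0# → polar y z ≡ 0#
      vanishes z e with polar y z ≟ 0#
      ... | yes f = f
      ... | no ne = contradiction (z , e , ne) ¬∃
      -- Paired with `z`, the combination gives `polar y` at `z - (polar x z) w`, a vector
      -- orthogonal to `x`.
      dependent : (- polar y w) • x ⊕ 1# • y ≡ 0ᵛ
      dependent = nondeg _ λ z → begin
        polar ((- polar y w) • x ⊕ 1# • y) z
          ≡⟨ polar-linearˡ (- polar y w) 1# x y z ⟩
        - polar y w * polar x z + 1# * polar y z
          ≡⟨ solve 3 (λ a b c → (:- a) :* b :+ :1 :* c := c :+ (:- b) :* a) refl (polar y w) (polar x z) (polar y z) ⟩
        polar y z + - polar x z * polar y w
          ≡⟨ polar-shift y z (- polar x z) w ⟨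
        polar y (z ⊕ (- polar x z) • w)
          ≡⟨ vanishes _ (trans (polar-shift x z (- polar x z) w) (trans (cong (λ u → polar x z + - polar x z * u) xw≡1)
               (solve 1 (λ p → p :+ (:- p) :* :1 := :0) refl (polar x z)))) ⟩
        0# ∎

    points-whole : countPoints (λ P → zero? whole (rep P)) ≡ θ< ((2 ℕ.+ k) ℕ.* 2) q
    points-whole = zeros⇒points whole ((2 ℕ.+ k) ℕ.* 2) zeros-whole

    zeros-tangent : ∀ {x} → x ≢ 0ᵛ → Q x ≡ 0# → zeros (whole ∩ x ⊥) ≡ q ℕ.^ (1 ℕ.+ (1 ℕ.+ k) ℕ.* 2)
    zeros-tangent {x} x≢0 Qx≡0 = let y , e = whole-dual x≢0 in
      zeros-⊥ (1 ℕ.+ (1 ℕ.+ k) ℕ.* 2) whole tt tt Qx≡0 e size-whole zeros-whole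

    size-tangent : ∀ {x} → x ≢ 0ᵛ → size (whole ∩ x ⊥) ≡ q ℕ.^ ((2 ℕ.+ k) ℕ.* 2)
    size-tangent x≢0 = let y , e = whole-dual x≢0 in size-⊥-power whole ((2 ℕ.+ k) ℕ.* 2) tt e size-whole

    points-tangent : ∀ {x} → x ≢ 0ᵛ → Q x ≡ 0# →
      countPoints (λ P → zero? (whole ∩ x ⊥) (rep P)) ≡ θ< (1 ℕ.+ (1 ℕ.+ k) ℕ.* 2) q
    points-tangent {x} x≢0 Qx≡0 = zeros⇒points (whole ∩ x ⊥) (1 ℕ.+ (1 ℕ.+ k) ℕ.* 2) (zeros-tangent x≢0 Qx≡0)

    -- The quadric is cut with the tangent hyperplane of `x` and then with that of `y`; the vector
    -- `z`, being orthogonal to `x`, is a dual vector of `y` inside `x ⊥`.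
    points-singular-line : ∀ {x y} → Independent x y → Q x ≡ 0# → Q y ≡ 0# → polar x y ≡ 0# →
      countPoints (λ P → zero? (whole ∩ x ⊥ ∩ y ⊥) (rep P)) ≡ θ< ((1 ℕ.+ k) ℕ.* 2) q
    points-singular-line {x} {y} ind Qx≡0 Qy≡0 xy≡0 =
      let z , xz≡0 , yz≡1 = independent-dual ind
          x≢0 = independent⇒fst≢0 ind
      in zeros⇒points (whole ∩ x ⊥ ∩ y ⊥) ((1 ℕ.+ k) ℕ.* 2)
           (zeros-⊥ ((1 ℕ.+ k) ℕ.* 2) (whole ∩ x ⊥) (tt , xy≡0) (tt , xz≡0) Qy≡0 yz≡1
             (size-tangent x≢0) (zeros-tangent x≢0 Qx≡0))

    -- After `y` is replaced by a vector `y′` of the line orthogonal to `x`, two nonsingular vectors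
    -- split off orthogonally. Their complement is nondegenerate of odd dimension `r - 1`, so
    -- `zeros-odd` applies.
    points-anisotropic-line : ∀ {x y} → Independent x y → (∀ a b → Q (a • x ⊕ b • y) ≡ 0# → a • x ⊕ b • y ≡ 0ᵛ) →
      countPoints (λ P → zero? (whole ∩ x ⊥ ∩ y ⊥) (rep P)) ≡ θ< ((1 ℕ.+ k) ℕ.* 2) q
    points-anisotropic-line {x} {y} ind anisotropic = trans
      (FiniteProperties.count-cong points (λ P → zero? (whole ∩ x ⊥ ∩ y ⊥) (rep P)) (λ P → zero? (whole ∩ x ⊥ ∩ y′ ⊥) (rep P))
        (λ P → to (rep P)) (λ P → from (rep P)))
      (zeros⇒points (whole ∩ x ⊥ ∩ y′ ⊥) ((1 ℕ.+ k) ℕ.* 2)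
        (zeros-odd (1 ℕ.+ k) (whole ∩ x ⊥ ∩ y′ ⊥)
          (nondegenerate-⊥ (whole ∩ x ⊥) (nondegenerate-⊥ whole whole-nondegenerate tt Qx≢0) y′∈ Qy′≢0)
          (size-nonsingular-⊥ (whole ∩ x ⊥) {k = suc ((1 ℕ.+ k) ℕ.* 2)} y′∈ Qy′≢0
            (size-nonsingular-⊥ whole {k = (2 ℕ.+ k) ℕ.* 2} tt Qx≢0 size-whole))))
      where
      open ≡-Reasoning
      Qx≢0 : Q x ≢ 0#
      Qx≢0 e = independent⇒fst≢0 ind (trans (sym (combination-10 x y))
        (anisotropic 1# 0# (trans (cong Q (combination-10 x y)) e)))
      c = proj₁ (orthogonalize Qx≢0 y)
      y′ : Vector
      y′ = c • x ⊕ 1# • y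
      y′∈ : mem (whole ∩ x ⊥) y′
      y′∈ = tt , proj₂ (orthogonalize Qx≢0 y)
      Qy′≢0 : Q y′ ≢ 0#
      Qy′≢0 e = 1≢0 (proj₂ (ind c 1# (anisotropic c 1# e)))
      polar-y′ : ∀ z → polar y′ z ≡ c * polar x z + 1# * polar y z
      polar-y′ = polar-linearˡ c 1# x y
      same : ∀ z → polar x z ≡ 0# → polar y′ z ≡ polar y z
      same z e = trans (polar-y′ z) (trans (cong (λ u → c * u + 1# * polar y z) e)
        (solve 2 (λ c s → c :* :0 :+ :1 :* s := s) refl c (polar y z)))
      to : ∀ z → mem (whole ∩ x ⊥ ∩ y ⊥) z × Q z ≡ 0# → mem (whole ∩ x ⊥ ∩ y′ ⊥) z × Q z ≡ 0#
      to z (((_ , e) , f) , g) = ((tt , e) , trans (same z e) f) , g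
      from : ∀ z → mem (whole ∩ x ⊥ ∩ y′ ⊥) z × Q z ≡ 0# → mem (whole ∩ x ⊥ ∩ y ⊥) z × Q z ≡ 0#
      from z (((_ , e) , f) , g) = ((tt , e) , trans (sym (same z e)) f) , g

-- The quadratic extension field and its basis 1, κ.

module QuadraticExtension {q : ℕ} {F : FiniteField q} {K : FiniteField (q ℕ.^ 2)} (E : Embedding F K) where
  private
    module F = FieldTheory F
    module K = FieldTheory K
  open K using (_+_; _*_; _-_; -_; 0#; 1#; solve; _:=_; _:+_; _:*_; _:-_; :-_; :0; :1)
  open Embedding E public
  open RingMorphisms.IsRingMonomorphism isRingMonomorphism public
    using (injective; +-homo; *-homo; -‿homo; 0#-homo; 1#-homo)

  embed≡0 : ∀ {a} → embed a ≡ 0# → a ≡ F.0#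
  embed≡0 e = injective (trans e (sym 0#-homo))

  embed-difference : ∀ a b → embed (a F.- b) ≡ embed a - embed b
  embed-difference a b = trans (+-homo a (F.- b)) (cong (embed a +_) (-‿homo b))

  abstract
    -- Otherwise all fibres of embed would be inhabited and q² ≤ q.
    irrational : ∃ λ κ → ∀ a → κ ≢ embed a
    irrational with K.find (λ z → ¬? (rational? z)) (λ { refl e → e })
      where
      rational? : ∀ z → Dec (∃ λ a → z ≡ embed a)
      rational? z = F.find (λ a → z K.≟ embed a) (λ { refl e → e })
    ... | yes (κ , ¬∃) = κ , λ a e → ¬∃ (a , e)
    ... | no all = contradiction q²≤q (ℕ.<⇒≱ (subst₂ _<_ (ℕ.*-identityʳ q) refl (ℕ.*-monoʳ-< q q*1>1)))
      where
      instance
        q-nonZero : ℕ.NonZero q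
        q-nonZero = ℕ.>-nonZero (ℕ.<-trans (s≤s z≤n) F.2≤q)
      q*1>1 : 1 < q ℕ.* 1
      q*1>1 = subst (1 <_) (sym (ℕ.*-identityʳ q)) F.2≤q
      inhabited : ∀ z → 1 ≤ ∑[ a ∈ F.elems ] 𝟙 (z K.≟ embed a)
      inhabited z with F.find (λ a → z K.≟ embed a) (λ { refl e → e })
      ... | yes (a , e) = ℕ.≤-trans (ℕ.≤-reflexive (sym (𝟙-yes (z K.≟ embed a) e)))
        (FiniteProperties.term≤∑ F.finite a {λ a → 𝟙 (z K.≟ embed a)} (λ { refl → refl }))
      ... | no ¬∃ = contradiction (z , ¬∃) all
      q²≤q : q ℕ.^ 2 ≤ q
      q²≤q = begin
        q ℕ.^ 2                                                     ≡⟨ K.card≡q ⟨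
        ∑[ _ ∈ K.elems ] 1                                          ≤⟨ ∑-mono K.elems inhabited ⟩
        ∑[ z ∈ K.elems ] ∑[ a ∈ F.elems ] 𝟙 (z K.≟ embed a)         ≡⟨ ∑-cong K.elems (λ z → ℕ.*-identityˡ _) ⟨
        ∑[ z ∈ K.elems ] (1 ℕ.* ∑[ a ∈ F.elems ] 𝟙 (z K.≟ embed a)) ≡⟨ FiniteProperties.∑-pushforward K.finite F.elems embed {λ _ → 1} (λ _ → refl) ⟨
        ∑[ _ ∈ F.elems ] 1                                          ≡⟨ F.card≡q ⟩
        q                                                           ∎
        where open ℕ.≤-Reasoning

    κ : K.Carrier
    κ = proj₁ irrational

    κ-irrational : ∀ a → κ ≢ embed a
    κ-irrational = proj₂ irrational

  basis : F.Carrier → F.Carrier → K.Carrier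
  basis a b = embed a + κ * embed b

  -- Two expressions with `b ≠ d` would solve for `κ` as the rational element `(c - a) / (b - d)`.
  basis-unique : ∀ {a b c d} → basis a b ≡ basis c d → a ≡ c × b ≡ d
  basis-unique {a} {b} {c} {d} e with (b F.- d) F.≟ F.0#
  ... | yes b-d≡0 = injective (begin
      embed a                               ≡⟨ solve 2 (λ s t → s := s :+ t :- t) refl (embed a) (κ * embed d) ⟩
      embed a + κ * embed d - κ * embed d   ≡⟨ cong (λ u → embed a + κ * embed u - κ * embed d) b≡d ⟨
      basis a b - κ * embed d               ≡⟨ cong (_- κ * embed d) e ⟩
      basis c d - κ * embed d               ≡⟨ solve 2 (λ s t → s := s :+ t :- t) refl (embed c) (κ * embed d) ⟨
      embed c                               ∎) , b≡d
    where
    open ≡-Reasoning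
    b≡d : b ≡ d
    b≡d = F.x-y≡0⇒x≡y b-d≡0
  ... | no b-d≢0 with F.inverse _ b-d≢0
  ...   | i , i*≡1 = contradiction (begin
      κ                                                ≡⟨ solve 1 (λ κ → κ := :1 :* κ) refl κ ⟩
      1# * κ                                           ≡⟨ cong (_* κ) (trans (sym 1#-homo) (trans (cong embed (sym i*≡1)) (*-homo i _))) ⟩
      embed i * embed (b F.- d) * κ                    ≡⟨ cong (λ u → embed i * u * κ) (embed-difference b d) ⟩
      embed i * (embed b - embed d) * κ                ≡⟨ solve 6 (λ i a b c d κ → i :* (b :- d) :* κ := i :* (a :+ κ :* b :- (c :+ κ :* d)) :+ i :* (c :- a))
                                                            refl (embed i) (embed a) (embed b) (embed c) (embed d) κ ⟩
      embed i * (basis a b - basis c d) + embed i * (embed c - embed a)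
        ≡⟨ cong (λ u → embed i * (u - basis c d) + embed i * (embed c - embed a)) e ⟩
      embed i * (basis c d - basis c d) + embed i * (embed c - embed a)
        ≡⟨ solve 3 (λ i s t → i :* (s :- s) :+ i :* t := i :* t) refl (embed i) (basis c d) (embed c - embed a) ⟩
      embed i * (embed c - embed a)                    ≡⟨ cong (embed i *_) (embed-difference c a) ⟨
      embed i * embed (c F.- a)                        ≡⟨ *-homo i _ ⟨
      embed (i F.* (c F.- a))                          ∎) (κ-irrational (i F.* (c F.- a)))
    where open ≡-Reasoning

  private
    representations : K.Carrier → ℕ
    representations z = ∑[ a ∈ F.elems ] ∑[ b ∈ F.elems ] 𝟙 (z K.≟ basis a b)

    representation? : ∀ z → Dec (∃₂ λ a b → z ≡ basis a b)
    representation? z = F.find (λ a → F.find (λ b → z K.≟ basis a b) (λ { refl e → e })) (λ { refl e → e })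

    representations-none : ∀ z → ¬ (∃₂ λ a b → z ≡ basis a b) → representations z ≡ 0
    representations-none z ¬∃ = trans (∑-cong F.elems (λ a → trans (∑-cong F.elems (λ b →
      𝟙-no (z K.≟ basis a b) (λ e → ¬∃ (a , b , e)))) (∑-zero F.elems))) (∑-zero F.elems)

    representations≤1 : ∀ z → representations z ≤ 1
    representations≤1 z with representation? z
    ... | no ¬∃ = subst (_≤ 1) (sym (representations-none z ¬∃)) z≤n
    ... | yes (a₀ , b₀ , e) = ℕ.≤-reflexive (begin
      representations z
        ≡⟨ ∑-cong F.elems (λ a → ∑-cong F.elems (λ b → trans
             (𝟙-cong (z K.≟ basis a b) ((a F.≟ a₀) ×-dec (b F.≟ b₀)) (λ f → basis-unique (trans (sym f) e)) (λ { (refl , refl) → e }))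
             (𝟙-× (a F.≟ a₀) (b F.≟ b₀)))) ⟩
      ∑[ a ∈ F.elems ] ∑[ b ∈ F.elems ] (𝟙 (a F.≟ a₀) ℕ.* 𝟙 (b F.≟ b₀))
        ≡⟨ ∑-cong F.elems (λ a → trans (∑-*ˡ F.elems (𝟙 (a F.≟ a₀)) (λ b → 𝟙 (b F.≟ b₀)))
             (trans (cong (𝟙 (a F.≟ a₀) ℕ.*_) (F.once b₀)) (ℕ.*-identityʳ _))) ⟩
      ∑[ a ∈ F.elems ] 𝟙 (a F.≟ a₀)
        ≡⟨ F.once a₀ ⟩
      1 ∎)
      where open ≡-Reasoning

    ∑-representations : ∑ K.elems representations ≡ q ℕ.^ 2
    ∑-representations = begin
      ∑[ z ∈ K.elems ] ∑[ a ∈ F.elems ] ∑[ b ∈ F.elems ] 𝟙 (z K.≟ basis a b)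
        ≡⟨ ∑-swap K.elems F.elems _ ⟩
      ∑[ a ∈ F.elems ] ∑[ z ∈ K.elems ] ∑[ b ∈ F.elems ] 𝟙 (z K.≟ basis a b)
        ≡⟨ ∑-cong F.elems (λ a → trans (∑-cong K.elems (λ z → sym (ℕ.*-identityˡ _)))
             (sym (FiniteProperties.∑-pushforward K.finite F.elems (basis a) {λ _ → 1} (λ _ → refl)))) ⟩
      ∑[ a ∈ F.elems ] ∑[ b ∈ F.elems ] 1
        ≡⟨ ∑-cong F.elems (λ a → trans F.card≡q (sym (ℕ.*-identityʳ q))) ⟩
      ∑[ a ∈ F.elems ] (q ℕ.* 1)
        ≡⟨ trans (∑-*ˡ F.elems q (λ _ → 1)) (cong (q ℕ.*_) (trans F.card≡q (sym (ℕ.*-identityʳ q)))) ⟩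
      q ℕ.^ 2 ∎
      where open ≡-Reasoning

    -- Surjectivity by counting: the `q²` pairs fall on the `q²` elements of the large field with at
    -- most one on each.
    decompose : ∀ z → ∃₂ λ a b → z ≡ basis a b
    decompose z with representation? z
    ... | yes r = r
    ... | no ¬∃ = contradiction
      (trans (sym (representations-none z ¬∃)) (FiniteProperties.∑-bound-tight K.finite {representations} {1} (λ { refl → refl })
        representations≤1 (ℕ.≤-reflexive (trans K.card≡q (sym ∑-representations))) z)) λ ()

  abstract
    π ρ : K.Carrier → F.Carrier
    π z = proj₁ (decompose z)
    ρ z = proj₁ (proj₂ (decompose z))

    π-ρ : ∀ z → z ≡ embed (π z) + κ * embed (ρ z)
    π-ρ z = proj₂ (proj₂ (decompose z))

  coordinates : ∀ {z a b} → z ≡ embed a + κ * embed b → π z ≡ a × ρ z ≡ b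
  coordinates {z} e = basis-unique (trans (sym (π-ρ z)) e)

  coordinates-embed : ∀ a → π (embed a) ≡ a × ρ (embed a) ≡ F.0#
  coordinates-embed a = coordinates (begin
    embed a                      ≡⟨ solve 2 (λ a κ → a := a :+ κ :* :0) refl (embed a) κ ⟩
    embed a + κ * 0#             ≡⟨ cong (λ u → embed a + κ * u) 0#-homo ⟨
    embed a + κ * embed F.0#     ∎)
    where open ≡-Reasoning

  -- `π` and `ρ` are linear over the small field; this linearity takes over the part usually played
  -- by conjugation.
  coordinates-combination : ∀ α β a b →
    π (α * embed a + β * embed b) ≡ π α F.* a F.+ π β F.* b ×
    ρ (α * embed a + β * embed b) ≡ ρ α F.* a F.+ ρ β F.* b
  coordinates-combination α β a b = coordinates (begin
    α * embed a + β * embed b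
      ≡⟨ cong₂ (λ s t → s * embed a + t * embed b) (π-ρ α) (π-ρ β) ⟩
    (embed (π α) + κ * embed (ρ α)) * embed a + (embed (π β) + κ * embed (ρ β)) * embed b
      ≡⟨ solve 7 (λ s t u v a b κ → (s :+ κ :* t) :* a :+ (u :+ κ :* v) :* b := s :* a :+ u :* b :+ κ :* (t :* a :+ v :* b))
           refl (embed (π α)) (embed (ρ α)) (embed (π β)) (embed (ρ β)) (embed a) (embed b) κ ⟩
    embed (π α) * embed a + embed (π β) * embed b + κ * (embed (ρ α) * embed a + embed (ρ β) * embed b)
      ≡⟨ cong₂ (λ s t → s + κ * t) (embed-combination (π α) (π β)) (embed-combination (ρ α) (ρ β)) ⟨
    embed (π α F.* a F.+ π β F.* b) + κ * embed (ρ α F.* a F.+ ρ β F.* b) ∎)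
    where
    open ≡-Reasoning
    embed-combination : ∀ s t → embed (s F.* a F.+ t F.* b) ≡ embed s * embed a + embed t * embed b
    embed-combination s t = trans (+-homo _ _) (cong₂ _+_ (*-homo s a) (*-homo t b))

  -- Completing the square in the equation of κ gives δ with δ² = d rational;
  -- every element of the small field is s² or d s², so it is a square above.
  square-root : F.1# F.+ F.1# ≢ F.0# → ∀ c → ∃ λ α → α * α ≡ embed c
  square-root 2≢0 c = root (F.square-classes nonsquare c)
    where
    open ≡-Reasoning
    -- `κ² = s + t κ` is the equation of `κ` over the small field, and `h` is 1/2, so that
    -- `δ = κ - t / 2`.
    s = π (κ * κ)
    t = ρ (κ * κ)
    h = proj₁ (F.inverse _ 2≢0)
    h*2≡1 : h F.* (F.1# F.+ F.1#) ≡ F.1#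
    h*2≡1 = proj₂ (F.inverse _ 2≢0)
    d = s F.+ h F.* t F.* (h F.* t)
    δ : K.Carrier
    δ = κ - embed (h F.* t)
    2h≡1 : embed h + embed h ≡ 1#
    2h≡1 = trans (sym (+-homo h h)) (trans (cong embed (trans
      (F.solve 1 (λ h → h F.:+ h F.:= h F.:* (F.:1 F.:+ F.:1)) refl h) h*2≡1)) 1#-homo)
    δ²≡d : δ * δ ≡ embed d
    δ²≡d = begin
      δ * δ
        ≡⟨ solve 2 (λ κ u → (κ :- u) :* (κ :- u) := κ :* κ :- κ :* (u :+ u) :+ u :* u) refl κ (embed (h F.* t)) ⟩
      κ * κ - κ * (embed (h F.* t) + embed (h F.* t)) + embed (h F.* t) * embed (h F.* t)
        ≡⟨ cong (λ u → κ * κ - κ * u + embed (h F.* t) * embed (h F.* t)) (begin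
             embed (h F.* t) + embed (h F.* t)   ≡⟨ cong₂ _+_ (*-homo h t) (*-homo h t) ⟩
             embed h * embed t + embed h * embed t ≡⟨ solve 2 (λ h t → h :* t :+ h :* t := (h :+ h) :* t) refl (embed h) (embed t) ⟩
             (embed h + embed h) * embed t       ≡⟨ cong (_* embed t) 2h≡1 ⟩
             1# * embed t                        ≡⟨ K.*-identityˡ _ ⟩
             embed t                             ∎) ⟩
      κ * κ - κ * embed t + embed (h F.* t) * embed (h F.* t)
        ≡⟨ cong (λ u → u - κ * embed t + embed (h F.* t) * embed (h F.* t)) (π-ρ (κ * κ)) ⟩
      embed s + κ * embed t - κ * embed t + embed (h F.* t) * embed (h F.* t)
        ≡⟨ solve 3 (λ s u v → s :+ u :- u :+ v := s :+ v) refl (embed s) (κ * embed t) _ ⟩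
      embed s + embed (h F.* t) * embed (h F.* t)
        ≡⟨ trans (+-homo s _) (cong (embed s +_) (*-homo _ _)) ⟨
      embed d ∎
    rational-κ : ∀ u → δ ≡ embed u → κ ≡ embed (u F.+ h F.* t)
    rational-κ u e = begin
      κ                                   ≡⟨ solve 2 (λ κ u → κ := κ :- u :+ u) refl κ (embed (h F.* t)) ⟩
      δ + embed (h F.* t)                 ≡⟨ cong (_+ embed (h F.* t)) e ⟩
      embed u + embed (h F.* t)           ≡⟨ +-homo u _ ⟨
      embed (u F.+ h F.* t)               ∎
    nonsquare : ∀ u → u F.* u ≢ d
    nonsquare u e with K.squares-equal {δ} {embed u} (trans δ²≡d (trans (cong embed (sym e)) (*-homo u u)))
    ... | inj₁ δ≡u  = κ-irrational _ (rational-κ u δ≡u)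
    ... | inj₂ δ≡-u = κ-irrational _ (rational-κ (F.- u) (trans δ≡-u (sym (-‿homo u))))
    root : (∃ λ u → c ≡ u F.* u ⊎ c ≡ d F.* (u F.* u)) → ∃ λ α → α * α ≡ embed c
    root (u , inj₁ e) = embed u , trans (sym (*-homo u u)) (cong embed (sym e))
    root (u , inj₂ e) = δ * embed u , (begin
      δ * embed u * (δ * embed u)             ≡⟨ solve 2 (λ d u → d :* u :* (d :* u) := d :* d :* (u :* u)) refl δ (embed u) ⟩
      δ * δ * (embed u * embed u)             ≡⟨ cong₂ _*_ δ²≡d (sym (*-homo u u)) ⟩
      embed d * embed (u F.* u)               ≡⟨ *-homo d _ ⟨
      embed (d F.* (u F.* u))                 ≡⟨ cong embed e ⟨
      embed c                                 ∎)

-- Extension of scalars for vectors, points and lines.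

module ExtendedVectors {q : ℕ} {F : FiniteField q} {K : FiniteField (q ℕ.^ 2)} (E : Embedding F K) where
  open QuadraticExtension E
  private
    module F = FieldTheory F
    module K = FieldTheory K
    module VF {k} = Projective F k
    module VK {k} = Projective K k

  ext : ∀ {k} → Vec F.Carrier k → Vec K.Carrier k
  ext = map embed

  ext-combination : ∀ {k} a b (x y : Vec F.Carrier k) →
    ext ((a VF.• x) VF.⊕ (b VF.• y)) ≡ (embed a VK.• ext x) VK.⊕ (embed b VK.• ext y)
  ext-combination a b []      []      = refl
  ext-combination a b (s ∷ x) (t ∷ y) = cong₂ _∷_
    (trans (+-homo _ _) (cong₂ K._+_ (*-homo a s) (*-homo b t))) (ext-combination a b x y)

  ext-• : ∀ {k} a (x : Vec F.Carrier k) → ext (a VF.• x) ≡ embed a VK.• ext x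
  ext-• a []      = refl
  ext-• a (s ∷ x) = cong₂ _∷_ (*-homo a s) (ext-• a x)

  ext-0ᵛ : ∀ k → ext (VF.0ᵛ {k}) ≡ VK.0ᵛ {k}
  ext-0ᵛ zero    = refl
  ext-0ᵛ (suc k) = cong₂ _∷_ 0#-homo (ext-0ᵛ k)

  π-combination : ∀ {k} α β (x y : Vec F.Carrier k) →
    map π ((α VK.• ext x) VK.⊕ (β VK.• ext y)) ≡ (π α VF.• x) VF.⊕ (π β VF.• y)
  π-combination α β []      []      = refl
  π-combination α β (s ∷ x) (t ∷ y) = cong₂ _∷_ (proj₁ (coordinates-combination α β s t)) (π-combination α β x y)

  ρ-combination : ∀ {k} α β (x y : Vec F.Carrier k) →
    map ρ ((α VK.• ext x) VK.⊕ (β VK.• ext y)) ≡ (ρ α VF.• x) VF.⊕ (ρ β VF.• y)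
  ρ-combination α β []      []      = refl
  ρ-combination α β (s ∷ x) (t ∷ y) = cong₂ _∷_ (proj₂ (coordinates-combination α β s t)) (ρ-combination α β x y)

  π-ext : ∀ {k} (x : Vec F.Carrier k) → map π (ext x) ≡ x
  π-ext []      = refl
  π-ext (s ∷ x) = cong₂ _∷_ (proj₁ (coordinates-embed s)) (π-ext x)

  π-0ᵛ : ∀ k → map π (VK.0ᵛ {k}) ≡ VF.0ᵛ {k}
  π-0ᵛ k = trans (cong (map π) (sym (ext-0ᵛ k))) (π-ext _)

  ρ-0ᵛ : ∀ k → map ρ (VK.0ᵛ {k}) ≡ VF.0ᵛ {k}
  ρ-0ᵛ zero    = refl
  ρ-0ᵛ (suc k) = cong₂ _∷_ (trans (cong ρ (sym 0#-homo)) (proj₂ (coordinates-embed F.0#))) (ρ-0ᵛ k)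

  split : ∀ {k} (z : Vec K.Carrier k) → z ≡ (K.1# VK.• ext (map π z)) VK.⊕ (κ VK.• ext (map ρ z))
  split []      = refl
  split (s ∷ z) = cong₂ _∷_ (trans (π-ρ s) (cong (K._+ κ K.* embed (ρ s)) (sym (K.*-identityˡ _)))) (split z)

  dot-ext : ∀ {k} (x y : Vec F.Carrier k) →
            foldr′ K._+_ K.0# (zipWith K._*_ (ext x) (ext y)) ≡ embed (foldr′ F._+_ F.0# (zipWith F._*_ x y))
  dot-ext []      []      = sym 0#-homo
  dot-ext (s ∷ x) (t ∷ y) = trans (cong₂ K._+_ (sym (*-homo s t)) (dot-ext x y)) (sym (+-homo _ _))

  rows-ext : ∀ {k l} (A : Vec (Vec F.Carrier k) l) (x : Vec F.Carrier k) →
    map (λ row → foldr′ K._+_ K.0# (zipWith K._*_ row (ext x))) (map ext A) ≡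
    ext (map (λ row → foldr′ F._+_ F.0# (zipWith F._*_ row x)) A)
  rows-ext []        x = refl
  rows-ext (row ∷ A) x = cong₂ _∷_ (dot-ext row x) (rows-ext A x)

module ExtendedGeometry {q : ℕ} {F : FiniteField q} {K : FiniteField (q ℕ.^ 2)} (E : Embedding F K) (n : ℕ) where
  open QuadraticExtension E public
  open ExtendedVectors E public
  open Extension E n public
  module F where
    open FieldTheory F public
    open VectorIdentities F public
    open Projective F n public
    open Geometry F n public
    open Counting F n public
  module K where
    open FieldTheory K public
    open VectorIdentities K public
    open Projective K n public
    open Geometry K n public
    open Counting K n public
  open K using (solve; _:=_; _:+_; _:*_; _:-_; :-_; :0; :1)

  -- Applying `π` and `ρ` to a relation with large coefficients gives two relations over the small
  -- field, so both coordinates of each coefficient vanish.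
  ext-independent : ∀ {x y} → F.Independent x y → K.Independent (ext x) (ext y)
  ext-independent {x} {y} ind α β e =
    vanish (proj₁ π≡0) (proj₁ ρ≡0) , vanish (proj₂ π≡0) (proj₂ ρ≡0)
    where
    π≡0 : π α ≡ F.0# × π β ≡ F.0#
    π≡0 = ind (π α) (π β) (trans (sym (π-combination α β x y)) (trans (cong (map π) e) (π-0ᵛ n)))
    ρ≡0 : ρ α ≡ F.0# × ρ β ≡ F.0#
    ρ≡0 = ind (ρ α) (ρ β) (trans (sym (ρ-combination α β x y)) (trans (cong (map ρ) e) (ρ-0ᵛ n)))
    vanish : ∀ {α} → π α ≡ F.0# → ρ α ≡ F.0# → α ≡ K.0#
    vanish {α} p r = trans (π-ρ α) (trans (cong₂ (λ s t → embed s K.+ κ K.* embed t) p r)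
      (trans (cong₂ (λ s t → s K.+ κ K.* t) 0#-homo 0#-homo)
        (solve 1 (λ κ → :0 :+ κ :* :0 := :0) refl κ)))

  extLine : F.Line → K.Line
  extLine ℓ = K.lineThrough (ext-independent (F.line-independent ℓ))

  ext-∈ : ∀ {x y z} → F.Span x y z → K.Span (ext x) (ext y) (ext z)
  ext-∈ {x} {y} (a , b , refl) = embed a , embed b , ext-combination a b x y

  -- `π` recovers a vector from its extension and turns coefficients of the large field into
  -- coefficients of the small one.
  ∈-ext : ∀ {x y z} → K.Span (ext x) (ext y) (ext z) → F.Span x y z
  ∈-ext {x} {y} {z} (α , β , e) = π α , π β , trans (sym (π-ext z)) (trans (cong (map π) e) (π-combination α β x y))

  extLine-isExtended : ∀ ℓ → IsExtendedLine ℓ (extLine ℓ)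
  extLine-isExtended ℓ P = ext-∈

  extLine-unique : ∀ ℓ ℓ′ → IsExtendedLine ℓ ℓ′ → ℓ′ K.≈ˡ extLine ℓ
  extLine-unique ℓ ℓ′ isExt = K.two-points⇒≈ˡ ℓ′ (extLine ℓ) (isExt (F.fst ℓ) (F.fst∈ˡ ℓ)) (isExt (F.snd ℓ) (F.snd∈ˡ ℓ))

  extLine-cong : ∀ ℓ ℓ′ → ℓ F.≈ˡ ℓ′ → extLine ℓ K.≈ˡ extLine ℓ′
  extLine-cong ℓ ℓ′ e = K.two-points⇒≈ˡ (extLine ℓ) (extLine ℓ′)
    (ext-∈ (Equivalence.from (e (F.fst ℓ′)) (F.fst∈ˡ ℓ′))) (ext-∈ (Equivalence.from (e (F.snd ℓ′)) (F.snd∈ˡ ℓ′)))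

  extendPoint-cong : ∀ {S T} → S F.≈ᵖ T → extendPoint S K.≈ᵖ extendPoint T
  extendPoint-cong {S} {T} (c , e) = embed c , trans (cong ext e) (ext-• c (F.rep T))

  π0≡0 : π K.0# ≡ F.0#
  π0≡0 = trans (cong π (sym 0#-homo)) (proj₁ (coordinates-embed F.0#))

  ρ0≡0 : ρ K.0# ≡ F.0#
  ρ0≡0 = trans (cong ρ (sym 0#-homo)) (proj₂ (coordinates-embed F.0#))

  •-as-combination : ∀ γ x → γ K.• x ≡ γ K.• x K.⊕ K.0# K.• x
  •-as-combination γ x = sym (trans (cong (γ K.• x K.⊕_) (K.0• x)) (K.⊕-identityʳ _))

  π-• : ∀ γ x → map π (γ K.• ext x) ≡ π γ F.• x
  π-• γ x = trans (cong (map π) (•-as-combination γ (ext x))) (trans (π-combination γ K.0# x x)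
    (trans (cong (λ u → π γ F.• x F.⊕ u F.• x) π0≡0) (trans (cong (π γ F.• x F.⊕_) (F.0• x)) (F.⊕-identityʳ _))))

  ρ-• : ∀ γ x → map ρ (γ K.• ext x) ≡ ρ γ F.• x
  ρ-• γ x = trans (cong (map ρ) (•-as-combination γ (ext x))) (trans (ρ-combination γ K.0# x x)
    (trans (cong (λ u → ρ γ F.• x F.⊕ u F.• x) ρ0≡0) (trans (cong (ρ γ F.• x F.⊕_) (F.0• x)) (F.⊕-identityʳ _))))

  extendPoint-injective : ∀ {S T} → extendPoint S K.≈ᵖ extendPoint T → S F.≈ᵖ T
  extendPoint-injective {S} {T} (γ , e) =
    π γ , trans (sym (π-ext (F.rep S))) (trans (cong (map π) e) (π-• γ (F.rep T)))

  Rational : Pred K.Point 0ℓ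
  Rational R = ∃ λ S → R K.≈ᵖ extendPoint S

  rational? : Decidable Rational
  rational? R = FiniteProperties.find F.points (λ S → R K.≈ᵖ? extendPoint S)
    (λ {S} {T} S≈T R≈S → K.≈ᵖ-trans R (extendPoint S) (extendPoint T) R≈S (extendPoint-cong {S} {T} S≈T))

  multiple⇒rational : ∀ R γ x → K.rep R ≡ γ K.• ext x → Rational R
  multiple⇒rational R γ x e = F.point x x≢0 , γ , e
    where
    x≢0 : x ≢ F.0ᵛ
    x≢0 refl = K.nonzero R (trans e (trans (cong (γ K.•_) (ext-0ᵛ n)) (K.•0ᵛ n γ)))

  rational-∈ : ∀ {R} ℓ {S} → R K.≈ᵖ extendPoint S → R K.∈ˡ extLine ℓ → S F.∈ˡ ℓ
  rational-∈ {R} ℓ {S} R≈S R∈ = ∈-ext (K.∈ˡ-resp (extLine ℓ) {R} {extendPoint S} R≈S R∈)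

  ∈-rational : ∀ {R} ℓ {S} → R K.≈ᵖ extendPoint S → S F.∈ˡ ℓ → R K.∈ˡ extLine ℓ
  ∈-rational {R} ℓ {S} R≈S S∈ = K.∈ˡ-resp (extLine ℓ) {extendPoint S} {R}
    (K.≈ᵖ-sym R (extendPoint S) R≈S) (ext-∈ S∈)

  -- Write `R = u + κ v`. If `v = 0` or `u = c v`, then `R` is a scalar multiple of a rational
  -- vector: of `u`, or of `v` with factor `c + κ`.
  irrational⇒independent : ∀ R → ¬ Rational R → F.Independent (map π (K.rep R)) (map ρ (K.rep R))
  irrational⇒independent R irr = F.not-proportional⇒independent ρ≢0 ¬proportional
    where
    open ≡-Reasoning
    u = map π (K.rep R)
    v = map ρ (K.rep R)
    ρ≢0 : v ≢ F.0ᵛ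
    ρ≢0 v≡0 = irr (multiple⇒rational R K.1# u (begin
      K.rep R                                  ≡⟨ split (K.rep R) ⟩
      K.1# K.• ext u K.⊕ κ K.• ext v           ≡⟨ cong (λ v → K.1# K.• ext u K.⊕ κ K.• v) (trans (cong ext v≡0) (ext-0ᵛ n)) ⟩
      K.1# K.• ext u K.⊕ κ K.• K.0ᵛ            ≡⟨ cong (K.1# K.• ext u K.⊕_) (K.•0ᵛ n κ) ⟩
      K.1# K.• ext u K.⊕ K.0ᵛ                  ≡⟨ K.⊕-identityʳ _ ⟩
      K.1# K.• ext u                           ∎))
    ¬proportional : ¬ (∃ λ c → u ≡ c F.• v)
    ¬proportional (c , u≡cv) = irr (multiple⇒rational R (embed c K.+ κ) v (begin
      K.rep R                                                  ≡⟨ split (K.rep R) ⟩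
      K.1# K.• ext u K.⊕ κ K.• ext v                           ≡⟨ cong₂ K._⊕_ (trans (K.1• _) (trans (cong ext u≡cv) (ext-• c v))) refl ⟩
      embed c K.• ext v K.⊕ κ K.• ext v                        ≡⟨ K.•-distribʳ (embed c) κ (ext v) ⟨
      (embed c K.+ κ) K.• ext v                                ∎))

  -- Classically the line joining `R` to its Frobenius conjugate; both are combinations of the two
  -- rational components of `R`.
  support : ∀ R → ¬ Rational R → F.Line
  support R irr = F.lineThrough (irrational⇒independent R irr)

  ∈-support : ∀ R (irr : ¬ Rational R) → R K.∈ˡ extLine (support R irr)
  ∈-support R irr = K.1# , κ , split (K.rep R)

  support-unique : ∀ R (irr : ¬ Rational R) ℓ → R K.∈ˡ extLine ℓ → ℓ F.≈ˡ support R irr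
  support-unique R irr ℓ (α , β , e) = F.two-points⇒≈ˡ ℓ (support R irr)
    (π α , π β , trans (cong (map π) e) (π-combination α β _ _))
    (ρ α , ρ β , trans (cong (map ρ) e) (ρ-combination α β _ _))

  -- A nontrivial rational relation between `α` and `β` would let one scalar be taken out of `R`,
  -- leaving a rational vector. Hence linear equations at `R` split into pairs of equations over the
  -- small field.
  irrational-coefficients : ∀ R → ¬ Rational R → ∀ {x y α β} → K.rep R ≡ α K.• ext x K.⊕ β K.• ext y →
    ∀ {a b} → α K.* embed a K.+ β K.* embed b ≡ K.0# → a ≡ F.0# × b ≡ F.0#
  irrational-coefficients R irr {x} {y} {α} {β} e {a} {b} vanish with a F.≟ F.0# | b F.≟ F.0#
  ... | yes a≡0 | yes b≡0 = a≡0 , b≡0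
  ... | yes refl | no b≢0 = contradiction (multiple⇒rational R α x (begin
      K.rep R                               ≡⟨ e ⟩
      α K.• ext x K.⊕ β K.• ext y           ≡⟨ cong (λ u → α K.• ext x K.⊕ u K.• ext y) β≡0 ⟩
      α K.• ext x K.⊕ K.0# K.• ext y        ≡⟨ cong (α K.• ext x K.⊕_) (K.0• _) ⟩
      α K.• ext x K.⊕ K.0ᵛ                  ≡⟨ K.⊕-identityʳ _ ⟩
      α K.• ext x                           ∎)) irr
    where
    open ≡-Reasoning
    β≡0 : β ≡ K.0#
    β≡0 = K.integral {embed b} {β} (begin
      embed b K.* β                            ≡⟨ solve 3 (λ α β b → b :* β := α :* :0 :+ β :* b) refl α β (embed b) ⟩
      α K.* K.0# K.+ β K.* embed b             ≡⟨ cong (λ u → α K.* u K.+ β K.* embed b) 0#-homo ⟨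
      α K.* embed F.0# K.+ β K.* embed b       ≡⟨ vanish ⟩
      K.0#                                     ∎) (λ eb → b≢0 (embed≡0 eb))
  -- Here `α = - (b / a) β`, hence `R = β (- (b / a) x + y)`.
  ... | no a≢0 | _ = contradiction (multiple⇒rational R β ((F.- (d F.* b)) F.• x F.⊕ F.1# F.• y) (begin
      K.rep R                                                            ≡⟨ e ⟩
      α K.• ext x K.⊕ β K.• ext y                                        ≡⟨ cong₂ (λ s t → s K.• ext x K.⊕ t K.• ext y) α≡ (sym (trans (cong (β K.*_) 1#-homo) (K.*-identityʳ β))) ⟩
      (β K.* embed (F.- (d F.* b))) K.• ext x K.⊕ (β K.* embed F.1#) K.• ext y ≡⟨ K.•-combination β _ _ _ _ ⟨
      β K.• (embed (F.- (d F.* b)) K.• ext x K.⊕ embed F.1# K.• ext y)   ≡⟨ cong (β K.•_) (ext-combination (F.- (d F.* b)) F.1# x y) ⟨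
      β K.• ext ((F.- (d F.* b)) F.• x F.⊕ F.1# F.• y)                   ∎)) irr
    where
    open ≡-Reasoning
    d = proj₁ (F.inverse a a≢0)
    da≡1 : embed d K.* embed a ≡ K.1#
    da≡1 = trans (sym (*-homo d a)) (trans (cong embed (proj₂ (F.inverse a a≢0))) 1#-homo)
    α≡ : α ≡ β K.* embed (F.- (d F.* b))
    α≡ = begin
      α                                              ≡⟨ solve 1 (λ α → α := :1 :* α) refl α ⟩
      K.1# K.* α                                     ≡⟨ cong (K._* α) da≡1 ⟨
      embed d K.* embed a K.* α                      ≡⟨ solve 5 (λ α β a b d → d :* a :* α := d :* (α :* a :+ β :* b) :+ β :* (:- (d :* b)))
                                                          refl α β (embed a) (embed b) (embed d) ⟩
      embed d K.* (α K.* embed a K.+ β K.* embed b) K.+ β K.* (K.- (embed d K.* embed b))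
                                                     ≡⟨ cong₂ (λ s t → embed d K.* s K.+ β K.* t) vanish (sym (trans (-‿homo _) (cong K.-_ (*-homo d b)))) ⟩
      embed d K.* K.0# K.+ β K.* embed (F.- (d F.* b)) ≡⟨ solve 2 (λ d u → d :* :0 :+ u := u) refl (embed d) _ ⟩
      β K.* embed (F.- (d F.* b))                    ∎

  -- Every line acquires an irrational point, because the coefficients 1 and `κ` have no rational
  -- ratio.
  generic-point : F.Line → K.Point
  generic-point ℓ = K.point (K.1# K.• ext (F.rep (F.fst ℓ)) K.⊕ κ K.• ext (F.rep (F.snd ℓ)))
    (λ e → K.1≢0 (proj₁ (ext-independent (F.line-independent ℓ) K.1# κ e)))

  generic-point-∈ : ∀ ℓ → generic-point ℓ K.∈ˡ extLine ℓ
  generic-point-∈ ℓ = K.1# , κ , refl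

  -- Comparing the `π` and `ρ` parts of `x + κ y = γ s` yields `x = π γ • s` and `y = ρ γ • s`,
  -- which would be proportional.
  generic-point-irrational : ∀ ℓ → ¬ Rational (generic-point ℓ)
  generic-point-irrational ℓ (S , γ , e) = F.independent⇒distinct (F.line-independent ℓ) (c , x≡cy)
    where
    open ≡-Reasoning
    x = F.rep (F.fst ℓ)
    y = F.rep (F.snd ℓ)
    s = F.rep S
    π1 : π K.1# ≡ F.1#
    π1 = trans (cong π (sym 1#-homo)) (proj₁ (coordinates-embed F.1#))
    ρ1 : ρ K.1# ≡ F.0#
    ρ1 = trans (cong ρ (sym 1#-homo)) (proj₂ (coordinates-embed F.1#))
    κ-coordinates : π κ ≡ F.0# × ρ κ ≡ F.1#
    κ-coordinates = coordinates (trans (solve 1 (λ κ → κ := :0 :+ κ :* :1) refl κ)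
      (cong₂ (λ s t → s K.+ κ K.* t) (sym 0#-homo) (sym 1#-homo)))
    x≡ : x ≡ π γ F.• s
    x≡ = begin
      x                                  ≡⟨ F.combination-10 x y ⟨
      F.1# F.• x F.⊕ F.0# F.• y          ≡⟨ cong₂ (λ s t → s F.• x F.⊕ t F.• y) π1 (proj₁ κ-coordinates) ⟨
      π K.1# F.• x F.⊕ π κ F.• y         ≡⟨ π-combination K.1# κ x y ⟨
      map π (K.1# K.• ext x K.⊕ κ K.• ext y) ≡⟨ cong (map π) e ⟩
      map π (γ K.• ext s)                ≡⟨ π-• γ s ⟩
      π γ F.• s                          ∎
    y≡ : y ≡ ρ γ F.• s
    y≡ = begin
      y                                  ≡⟨ F.combination-01 x y ⟨
      F.0# F.• x F.⊕ F.1# F.• y          ≡⟨ cong₂ (λ s t → s F.• x F.⊕ t F.• y) ρ1 (proj₂ κ-coordinates) ⟨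
      ρ K.1# F.• x F.⊕ ρ κ F.• y         ≡⟨ ρ-combination K.1# κ x y ⟨
      map ρ (K.1# K.• ext x K.⊕ κ K.• ext y) ≡⟨ cong (map ρ) e ⟩
      map ρ (γ K.• ext s)                ≡⟨ ρ-• γ s ⟩
      ρ γ F.• s                          ∎
    ργ≢0 : ρ γ ≢ F.0#
    ργ≢0 z = F.independent⇒snd≢0 (F.line-independent ℓ) (trans y≡ (trans (cong (F._• s) z) (F.0• s)))
    i = proj₁ (F.inverse (ρ γ) ργ≢0)
    c = π γ F.* i
    x≡cy : x ≡ c F.• y
    x≡cy = begin
      x                                  ≡⟨ x≡ ⟩
      π γ F.• s                          ≡⟨ cong (F._• s) (trans (F.solve 1 (λ p → p F.:= p F.:* F.:1) refl (π γ)) (cong (π γ F.*_) (sym (proj₂ (F.inverse (ρ γ) ργ≢0))))) ⟩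
      (π γ F.* (i F.* ρ γ)) F.• s        ≡⟨ cong (F._• s) (F.solve 3 (λ p i r → p F.:* (i F.:* r) F.:= p F.:* i F.:* r) refl (π γ) i (ρ γ)) ⟩
      (c F.* ρ γ) F.• s                  ≡⟨ F.•-assoc c (ρ γ) s ⟨
      c F.• ρ γ F.• s                    ≡⟨ cong (c F.•_) y≡ ⟨
      c F.• y                            ∎

-- The quadric over both fields.

record ExtendedSpace {q : ℕ} {F : FiniteField q} {K : FiniteField (q ℕ.^ 2)} (E : Embedding F K) (n : ℕ) : Set where
  open Embedding E
  field
    small : QuadraticSpace F n
    large : QuadraticSpace K n
  module SF = QuadraticSpace small
  module SK = QuadraticSpace large
  field
    Q-ext     : ∀ x → SK.Q (map embed x) ≡ embed (SF.Q x)
    polar-ext : ∀ x y → SK.polar (map embed x) (map embed y) ≡ embed (SF.polar x y)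

extendedSpace : ∀ {q} {F : FiniteField q} {K : FiniteField (q ℕ.^ 2)} (E : Embedding F K) (n : ℕ) →
                Projective.QuadraticForm F n → ExtendedSpace E n
extendedSpace {F = F} {K} E n A = record
  { small = quadraticSpace F n A
  ; large = quadraticSpace K n (Extension.extendForm E n A)
  ; Q-ext = λ x → bilinear-ext x x
  ; polar-ext = λ x y → trans (KQ.polar-bilinear (ext x) (ext y)) (trans
      (cong₂ (FiniteField._+_ K) (bilinear-ext x y) (bilinear-ext y x))
      (trans (sym (+-homo (FQ.bilinear x y) (FQ.bilinear y x))) (cong embed (sym (FQ.polar-bilinear x y)))))
  }
  where
  open QuadraticExtension E
  open ExtendedVectors E
  module FQ = QuadricProperties F n A
  module KQ = QuadricProperties K n (Extension.extendForm E n A)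
  bilinear-ext : ∀ x y → KQ.bilinear (ext x) (ext y) ≡ embed (FQ.bilinear x y)
  bilinear-ext x y = trans (cong (Projective.dot K n (ext x)) (rows-ext A y)) (dot-ext x _)

module ExtendedQuadric {q : ℕ} {F : FiniteField q} {K : FiniteField (q ℕ.^ 2)} (E : Embedding F K) (n : ℕ)
                       (S : ExtendedSpace E n)
                       (2≢0 : FieldTheory._+_ F (FieldTheory.1# F) (FieldTheory.1# F) ≢ FieldTheory.0# F) where
  open ExtendedGeometry E n public
  open ExtendedSpace S public
  open K using (solve; _:=_; _:+_; _:*_; _:-_; :-_; :0; :1)
  module FC = QuadricCounting F n small 2≢0
  open FC using (Subspace; whole; _∩_⊥)

  Singular Anisotropic : F.Line → Set
  Singular ℓ    = ∀ P → P F.∈ˡ ℓ → SF.Q (F.rep P) ≡ F.0#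
  Anisotropic ℓ = ∀ P → P F.∈ˡ ℓ → SF.Q (F.rep P) ≢ F.0#

  singular-span : ∀ {x y z} → SF.Q x ≡ F.0# → SF.Q y ≡ F.0# → SF.polar x y ≡ F.0# → F.Span x y z → SF.Q z ≡ F.0#
  singular-span {x} {y} Qx Qy xy (a , b , refl) = trans (SF.Q-combination a b x y)
    (trans (cong₂ F._+_ (cong₂ (λ s t → a F.* a F.* s F.+ b F.* b F.* t) Qx Qy) (cong (a F.* b F.*_) xy))
      (F.solve 2 (λ a b → a F.:* a F.:* F.:0 F.:+ b F.:* b F.:* F.:0 F.:+ a F.:* b F.:* F.:0 F.:= F.:0) refl a b))

  singular-polar : ∀ ℓ → Singular ℓ → SF.polar (F.rep (F.fst ℓ)) (F.rep (F.snd ℓ)) ≡ F.0#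
  singular-polar ℓ sing = begin
    SF.polar x y
      ≡⟨ F.solve 1 (λ p → p F.:= F.:1 F.:* F.:1 F.:* F.:0 F.:+ F.:1 F.:* F.:1 F.:* F.:0 F.:+ F.:1 F.:* F.:1 F.:* p)
           refl (SF.polar x y) ⟩
    F.1# F.* F.1# F.* F.0# F.+ F.1# F.* F.1# F.* F.0# F.+ F.1# F.* F.1# F.* SF.polar x y
      ≡⟨ cong₂ (λ s t → F.1# F.* F.1# F.* s F.+ F.1# F.* F.1# F.* t F.+ F.1# F.* F.1# F.* SF.polar x y)
           (sing (F.fst ℓ) (F.fst∈ˡ ℓ)) (sing (F.snd ℓ) (F.snd∈ˡ ℓ)) ⟨
    F.1# F.* F.1# F.* SF.Q x F.+ F.1# F.* F.1# F.* SF.Q y F.+ F.1# F.* F.1# F.* SF.polar x y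
      ≡⟨ SF.Q-combination F.1# F.1# x y ⟨
    SF.Q (F.1# F.• x F.⊕ F.1# F.• y)
      ≡⟨ sing (F.point _ (λ e → F.1≢0 (proj₁ (F.line-independent ℓ F.1# F.1# e)))) (F.1# , F.1# , refl) ⟩
    F.0# ∎
    where
    open ≡-Reasoning
    x = F.rep (F.fst ℓ)
    y = F.rep (F.snd ℓ)

  record LineCover (𝓛 : Pred F.Line 0ℓ) (m : ℕ) : Set where
    field
      respects : 𝓛 Respects F._≈ˡ_
      positive : 0 < m
      singular : ∀ ℓ → 𝓛 ℓ → Singular ℓ
      covers   : ∀ P → SF.Q (F.rep P) ≡ F.0# → HasSize F.Lines (λ ℓ → 𝓛 ℓ × P F.∈ˡ ℓ) m

  Q-rational : ∀ {R S} → R K.≈ᵖ extendPoint S → SF.Q (F.rep S) ≡ F.0# → SK.Q (K.rep R) ≡ K.0#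
  Q-rational {R} {S} (γ , e) QS = trans (cong SK.Q e) (SK.Q-zero γ _ (trans (Q-ext _) (trans (cong embed QS) 0#-homo)))

  rational-Q : ∀ {R S} → R K.≈ᵖ extendPoint S → SK.Q (K.rep R) ≡ K.0# → SF.Q (F.rep S) ≡ F.0#
  rational-Q {R} {S} R≈S QR = embed≡0 (trans (sym (Q-ext _)) (SK.Q-resp R (extendPoint S) R≈S QR))

  -- The form on the line, written in a basis whose second vector s is
  -- singular, is divisible by the coordinate τ of R; the other factor has
  -- rational coefficients.
  singular-of-point : ∀ R → ¬ Rational R → SK.Q (K.rep R) ≡ K.0# → ∀ ℓ → R K.∈ˡ extLine ℓ →
    ∀ S T → S F.∈ˡ ℓ → T F.∈ˡ ℓ → ¬ (T F.≈ᵖ S) → SF.Q (F.rep S) ≡ F.0# → Singular ℓ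
  singular-of-point R irr QR≡0 ℓ R∈ S T S∈ T∈ T≉S Qs≡0 P P∈ =
    singular-span (proj₁ coefficients) Qs≡0 (proj₂ coefficients) (F.span-trans x∈ y∈ P∈)
    where
    open ≡-Reasoning
    s = F.rep S
    t = F.rep T
    exchanged : F.Span t s (F.rep (F.fst ℓ)) × F.Span t s (F.rep (F.snd ℓ))
    exchanged = F.span-exchange (F.not-proportional⇒independent (F.nonzero S) T≉S) T∈ S∈
    x∈ = proj₁ exchanged
    y∈ = proj₂ exchanged
    R∈ts : K.Span (ext t) (ext s) (K.rep R)
    R∈ts = K.span-trans (ext-∈ x∈) (ext-∈ y∈) R∈
    τ = proj₁ R∈ts
    σ = proj₁ (proj₂ R∈ts)
    R≡ : K.rep R ≡ τ K.• ext t K.⊕ σ K.• ext s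
    R≡ = proj₂ (proj₂ R∈ts)
    τ≢0 : τ ≢ K.0#
    τ≢0 τ≡0 = irr (multiple⇒rational R σ s (begin
      K.rep R                            ≡⟨ R≡ ⟩
      τ K.• ext t K.⊕ σ K.• ext s        ≡⟨ cong (λ u → u K.• ext t K.⊕ σ K.• ext s) τ≡0 ⟩
      K.0# K.• ext t K.⊕ σ K.• ext s     ≡⟨ cong (K._⊕ σ K.• ext s) (K.0• _) ⟩
      K.0ᵛ K.⊕ σ K.• ext s               ≡⟨ K.⊕-identityˡ _ ⟩
      σ K.• ext s                        ∎))
    factor : τ K.* (τ K.* embed (SF.Q t) K.+ σ K.* embed (SF.polar t s)) ≡ K.0#
    factor = begin
      τ K.* (τ K.* embed (SF.Q t) K.+ σ K.* embed (SF.polar t s))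
        ≡⟨ solve 4 (λ τ σ u p → τ :* (τ :* u :+ σ :* p) := τ :* τ :* u :+ σ :* σ :* :0 :+ τ :* σ :* p)
             refl τ σ (embed (SF.Q t)) (embed (SF.polar t s)) ⟩
      τ K.* τ K.* embed (SF.Q t) K.+ σ K.* σ K.* K.0# K.+ τ K.* σ K.* embed (SF.polar t s)
        ≡⟨ cong (λ u → τ K.* τ K.* embed (SF.Q t) K.+ σ K.* σ K.* u K.+ τ K.* σ K.* embed (SF.polar t s))
             (trans (Q-ext s) (trans (cong embed Qs≡0) 0#-homo)) ⟨
      τ K.* τ K.* embed (SF.Q t) K.+ σ K.* σ K.* SK.Q (ext s) K.+ τ K.* σ K.* embed (SF.polar t s)
        ≡⟨ cong₂ (λ u p → τ K.* τ K.* u K.+ σ K.* σ K.* SK.Q (ext s) K.+ τ K.* σ K.* p) (Q-ext t) (polar-ext t s) ⟨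
      τ K.* τ K.* SK.Q (ext t) K.+ σ K.* σ K.* SK.Q (ext s) K.+ τ K.* σ K.* SK.polar (ext t) (ext s)
        ≡⟨ SK.Q-combination τ σ (ext t) (ext s) ⟨
      SK.Q (τ K.• ext t K.⊕ σ K.• ext s)
        ≡⟨ cong SK.Q R≡ ⟨
      SK.Q (K.rep R)
        ≡⟨ QR≡0 ⟩
      K.0# ∎
    coefficients : SF.Q t ≡ F.0# × SF.polar t s ≡ F.0#
    coefficients = irrational-coefficients R irr R≡ (K.integral factor τ≢0)

  -- If the line has a rational singular point `S`, one of its two base points differs from `S`, and
  -- together with `S` it gives the basis that `singular-of-point` asks for.
  dichotomy : ∀ R → ¬ Rational R → SK.Q (K.rep R) ≡ K.0# → ∀ ℓ → R K.∈ˡ extLine ℓ → Singular ℓ ⊎ Anisotropic ℓ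
  dichotomy R irr QR≡0 ℓ R∈ = decide singular-point? (F.fst ℓ F.≈ᵖ?_)
    where
    singular-point? : Dec (∃ λ S → S F.∈ˡ ℓ × SF.Q (F.rep S) ≡ F.0#)
    singular-point? = FiniteProperties.find F.points (λ S → (S F.∈ˡ? ℓ) ×-dec (SF.Q (F.rep S) F.≟ F.0#))
      (λ {P} {S} P≈S (P∈ , QP) → F.∈ˡ-resp ℓ {P} {S} P≈S P∈ , SF.Q-resp P S P≈S QP)
    decide : Dec (∃ λ S → S F.∈ˡ ℓ × SF.Q (F.rep S) ≡ F.0#) → (∀ S → Dec (F.fst ℓ F.≈ᵖ S)) → Singular ℓ ⊎ Anisotropic ℓ
    decide (no ¬∃) _ = inj₂ λ P P∈ QP → ¬∃ (P , P∈ , QP)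
    decide (yes (S , S∈ , QS)) fst≈? with fst≈? S
    ... | no fst≉S  = inj₁ (singular-of-point R irr QR≡0 ℓ R∈ S (F.fst ℓ) S∈ (F.fst∈ˡ ℓ) fst≉S QS)
    ... | yes fst≈S = inj₁ (singular-of-point R irr QR≡0 ℓ R∈ S (F.snd ℓ) S∈ (F.snd∈ˡ ℓ) snd≉S QS)
      where
      snd≉S : ¬ (F.snd ℓ F.≈ᵖ S)
      snd≉S snd≈S = F.distinct ℓ (F.≈ᵖ-trans (F.fst ℓ) S (F.snd ℓ) fst≈S
        (F.≈ᵖ-sym (F.snd ℓ) S snd≈S))

  polar-on-extLine : ∀ R ℓ α β → K.rep R ≡ α K.• ext (F.rep (F.fst ℓ)) K.⊕ β K.• ext (F.rep (F.snd ℓ)) → ∀ w →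
    SK.polar (K.rep R) (ext w) ≡ α K.* embed (SF.polar (F.rep (F.fst ℓ)) w) K.+ β K.* embed (SF.polar (F.rep (F.snd ℓ)) w)
  polar-on-extLine R ℓ α β e w = trans (cong (λ u → SK.polar u (ext w)) e) (trans (SK.polar-linearˡ α β _ _ (ext w))
    (cong₂ (λ s t → α K.* s K.+ β K.* t) (polar-ext _ w) (polar-ext _ w)))

  -- In `α polar x w + β polar y w = 0` the two pairings are rational while the coefficients have an
  -- irrational ratio, so both pairings vanish.
  irrational-⊥ : ∀ R → ¬ Rational R → ∀ ℓ → R K.∈ˡ extLine ℓ → ∀ w → SK.polar (K.rep R) (ext w) ≡ K.0# →
    SF.polar (F.rep (F.fst ℓ)) w ≡ F.0# × SF.polar (F.rep (F.snd ℓ)) w ≡ F.0#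
  irrational-⊥ R irr ℓ (α , β , e) w RW≡0 =
    irrational-coefficients R irr e (trans (sym (polar-on-extLine R ℓ α β e w)) RW≡0)

  ⊥-irrational : ∀ R ℓ → R K.∈ˡ extLine ℓ → ∀ w →
    SF.polar (F.rep (F.fst ℓ)) w ≡ F.0# × SF.polar (F.rep (F.snd ℓ)) w ≡ F.0# → SK.polar (K.rep R) (ext w) ≡ K.0#
  ⊥-irrational R ℓ (α , β , e) w (xw , yw) = trans (polar-on-extLine R ℓ α β e w)
    (trans (cong₂ (λ s t → α K.* embed s K.+ β K.* embed t) xw yw) (trans
      (cong (λ u → α K.* u K.+ β K.* u) 0#-homo)
      (solve 2 (λ α β → α :* :0 :+ β :* :0 := :0) refl α β)))

  rational-⊥ : ∀ R S → R K.≈ᵖ extendPoint S → ∀ w → SK.polar (K.rep R) (ext w) ≡ K.0# → SF.polar (F.rep S) w ≡ F.0#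
  rational-⊥ R S R≈S w RW≡0 = let γ , e = K.≈ᵖ-sym R (extendPoint S) R≈S in
    embed≡0 (trans (sym (polar-ext _ w)) (trans (cong (λ u → SK.polar u (ext w)) e)
      (trans (SK.polar-sym _ _) (K.linear-zero (SK.polar-linear (ext w)) γ (trans (SK.polar-sym _ _) RW≡0)))))

  ⊥-rational : ∀ R S → R K.≈ᵖ extendPoint S → ∀ w → SF.polar (F.rep S) w ≡ F.0# → SK.polar (K.rep R) (ext w) ≡ K.0#
  ⊥-rational R S (γ , e) w SW≡0 = trans (cong (λ u → SK.polar u (ext w)) e)
    (trans (SK.polar-sym _ _) (K.linear-zero (SK.polar-linear (ext w)) γ
      (trans (SK.polar-sym _ _) (trans (polar-ext _ w) (trans (cong embed SW≡0) 0#-homo)))))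

  -- In the orthogonal basis `x`, `y′` of the line the form at `α x + y′` is `α² Q x + Q y′`, so a
  -- square root of `- Q y′ / Q x` in the large field suffices. A rational zero would contradict
  -- anisotropy.
  singular-point : ∀ ℓ → Anisotropic ℓ → ∃ λ R → R K.∈ˡ extLine ℓ × SK.Q (K.rep R) ≡ K.0# × ¬ Rational R
  singular-point ℓ aniso = R , R∈ , QR≡0 , irr
    where
    open ≡-Reasoning
    x = F.rep (F.fst ℓ)
    y = F.rep (F.snd ℓ)
    Qx≢0 : SF.Q x ≢ F.0#
    Qx≢0 = aniso (F.fst ℓ) (F.fst∈ˡ ℓ)
    i = proj₁ (F.inverse _ Qx≢0)
    i*≡1 : i F.* SF.Q x ≡ F.1#
    i*≡1 = proj₂ (F.inverse _ Qx≢0)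
    c = proj₁ (FC.orthogonalize Qx≢0 y)
    y′ = c F.• x F.⊕ F.1# F.• y
    xy′≡0 : SF.polar x y′ ≡ F.0#
    xy′≡0 = proj₂ (FC.orthogonalize Qx≢0 y)
    root : ∃ λ α → α K.* α ≡ embed (F.- (i F.* SF.Q y′))
    root = square-root 2≢0 _
    α = proj₁ root
    rep′ = α K.• ext x K.⊕ K.1# K.• ext y′
    rep′∈ : K.Span (ext x) (ext y) rep′
    rep′∈ = K.span-trans (K.span-fst _ _) (ext-∈ (c , F.1# , refl)) (α , K.1# , refl)
    rep′≢0 : rep′ ≢ K.0ᵛ
    rep′≢0 e = K.1≢0 (proj₂ (ext-independent (F.line-independent ℓ) (α K.* K.1# K.+ K.1# K.* embed c) K.1# (trans (begin
      (α K.* K.1# K.+ K.1# K.* embed c) K.• ext x K.⊕ K.1# K.• ext y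
        ≡⟨ cong (λ u → (α K.* K.1# K.+ K.1# K.* embed c) K.• ext x K.⊕ u K.• ext y)
             (solve 1 (λ α → :1 := α :* :0 :+ :1 :* :1) refl α) ⟩
      (α K.* K.1# K.+ K.1# K.* embed c) K.• ext x K.⊕ (α K.* K.0# K.+ K.1# K.* K.1#) K.• ext y
        ≡⟨ K.combination₂ α K.1# K.0# K.1# (embed c) K.1# (ext x) (ext y) ⟨
      α K.• (K.1# K.• ext x K.⊕ K.0# K.• ext y) K.⊕ K.1# K.• (embed c K.• ext x K.⊕ K.1# K.• ext y)
        ≡⟨ cong₂ (λ u v → α K.• u K.⊕ K.1# K.• v) (K.combination-10 (ext x) (ext y))
             (trans (cong (λ u → embed c K.• ext x K.⊕ u K.• ext y) (sym 1#-homo)) (sym (ext-combination c F.1# x y))) ⟩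
      rep′ ∎) e)))
    R = K.point rep′ rep′≢0
    R∈ : R K.∈ˡ extLine ℓ
    R∈ = rep′∈
    QR≡0 : SK.Q rep′ ≡ K.0#
    QR≡0 = begin
      SK.Q rep′
        ≡⟨ SK.Q-combination α K.1# (ext x) (ext y′) ⟩
      α K.* α K.* SK.Q (ext x) K.+ K.1# K.* K.1# K.* SK.Q (ext y′) K.+ α K.* K.1# K.* SK.polar (ext x) (ext y′)
        ≡⟨ cong₂ (λ s t → α K.* α K.* s K.+ K.1# K.* K.1# K.* t K.+ α K.* K.1# K.* SK.polar (ext x) (ext y′)) (Q-ext x) (Q-ext y′) ⟩
      α K.* α K.* embed (SF.Q x) K.+ K.1# K.* K.1# K.* embed (SF.Q y′) K.+ α K.* K.1# K.* SK.polar (ext x) (ext y′)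
        ≡⟨ cong₂ (λ s t → s K.* embed (SF.Q x) K.+ K.1# K.* K.1# K.* embed (SF.Q y′) K.+ α K.* K.1# K.* t)
             (trans (proj₂ root) (trans (-‿homo _) (cong K.-_ (*-homo i (SF.Q y′)))))
             (trans (polar-ext x y′) (trans (cong embed xy′≡0) 0#-homo)) ⟩
      K.- (embed i K.* embed (SF.Q y′)) K.* embed (SF.Q x) K.+ K.1# K.* K.1# K.* embed (SF.Q y′) K.+ α K.* K.1# K.* K.0#
        ≡⟨ solve 4 (λ i a b α → (:- (i :* b)) :* a :+ :1 :* :1 :* b :+ α :* :1 :* :0
             := b :- b :* (i :* a)) refl (embed i) (embed (SF.Q x)) (embed (SF.Q y′)) α ⟩
      embed (SF.Q y′) K.- embed (SF.Q y′) K.* (embed i K.* embed (SF.Q x))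
        ≡⟨ cong (λ u → embed (SF.Q y′) K.- embed (SF.Q y′) K.* u) (trans (sym (*-homo i (SF.Q x))) (trans (cong embed i*≡1) 1#-homo)) ⟩
      embed (SF.Q y′) K.- embed (SF.Q y′) K.* K.1#
        ≡⟨ solve 1 (λ b → b :- b :* :1 := :0) refl (embed (SF.Q y′)) ⟩
      K.0# ∎
    irr : ¬ Rational R
    irr (P , R≈P) = aniso P (rational-∈ {R} ℓ {P} R≈P R∈) (rational-Q {R} {P} R≈P QR≡0)

  orthogonal? : ∀ R → Decidable (λ P → SF.Q (F.rep P) ≡ F.0# × SK.polar (K.rep R) (ext (F.rep P)) ≡ K.0#)
  orthogonal? R P = (SF.Q (F.rep P) F.≟ F.0#) ×-dec (SK.polar (K.rep R) (ext (F.rep P)) K.≟ K.0#)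

  module OrthogonalPoints (nondeg : SF.Nondegenerate) (k : ℕ) (n≡ : n ≡ suc ((2 ℕ.+ k) ℕ.* 2)) where
    open FC.Parabolic nondeg k n≡

    -- In the usual indexing the value is `θ_{r-2,q}`, one index above the irrational case: a
    -- rational point cuts the small space in a hyperplane, an irrational one in a subspace of
    -- codimension two.
    orthogonal-rational : ∀ R S → R K.≈ᵖ extendPoint S → SK.Q (K.rep R) ≡ K.0# →
      F.countPoints (orthogonal? R) ≡ θ< (1 ℕ.+ (1 ℕ.+ k) ℕ.* 2) q
    orthogonal-rational R S R≈S QR≡0 = trans
      (FiniteProperties.count-cong F.points (orthogonal? R) (λ P → Subspace.zero? (whole ∩ F.rep S ⊥) (F.rep P))
        (λ P (QP , RP) → (tt , rational-⊥ R S R≈S (F.rep P) RP) , QP)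
        (λ { P ((_ , SP) , QP) → QP , ⊥-rational R S R≈S (F.rep P) SP }))
      (points-tangent (F.nonzero S) (rational-Q {R} {S} R≈S QR≡0))

    orthogonal-irrational : ∀ R → ¬ Rational R → SK.Q (K.rep R) ≡ K.0# → ∀ ℓ → R K.∈ˡ extLine ℓ →
      F.countPoints (orthogonal? R) ≡ θ< ((1 ℕ.+ k) ℕ.* 2) q
    orthogonal-irrational R irr QR≡0 ℓ R∈ = trans
      (FiniteProperties.count-cong F.points (orthogonal? R) (λ P → Subspace.zero? (whole ∩ F.rep (F.fst ℓ) ⊥ ∩ F.rep (F.snd ℓ) ⊥) (F.rep P))
        (λ P (QP , RP) → let xP , yP = irrational-⊥ R irr ℓ R∈ (F.rep P) RP in ((tt , xP) , yP) , QP)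
        (λ { P (((_ , xP) , yP) , QP) → QP , ⊥-irrational R ℓ R∈ (F.rep P) (xP , yP) }))
      (by-cases (dichotomy R irr QR≡0 ℓ R∈))
      where
      by-cases : Singular ℓ ⊎ Anisotropic ℓ →
        F.countPoints (λ P → Subspace.zero? (whole ∩ F.rep (F.fst ℓ) ⊥ ∩ F.rep (F.snd ℓ) ⊥) (F.rep P)) ≡ θ< ((1 ℕ.+ k) ℕ.* 2) q
      by-cases (inj₁ sing) = points-singular-line (F.line-independent ℓ) (sing (F.fst ℓ) (F.fst∈ˡ ℓ)) (sing (F.snd ℓ) (F.snd∈ˡ ℓ)) (singular-polar ℓ sing)
      by-cases (inj₂ aniso) = points-anisotropic-line (F.line-independent ℓ) vanishing
        where
        vanishing : ∀ a b → SF.Q (a F.• F.rep (F.fst ℓ) F.⊕ b F.• F.rep (F.snd ℓ)) ≡ F.0# →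
                    a F.• F.rep (F.fst ℓ) F.⊕ b F.• F.rep (F.snd ℓ) ≡ F.0ᵛ
        vanishing a b Qz≡0 with (a F.• F.rep (F.fst ℓ) F.⊕ b F.• F.rep (F.snd ℓ)) F.≟ᵛ F.0ᵛ
        ... | yes z≡0 = z≡0
        ... | no z≢0  = contradiction Qz≡0 (aniso (F.point _ z≢0) (a , b , refl))

open import Data.Nat.Base using (_+_; _*_; _∸_; _^_)

-- Double counting of incidences of the cover.

module CoverCounting {q : ℕ} {F : FiniteField q} {K : FiniteField (q ^ 2)} (E : Embedding F K) (n : ℕ)
    (S : ExtendedSpace E n)
    (2≢0 : FieldTheory._+_ F (FieldTheory.1# F) (FieldTheory.1# F) ≢ FieldTheory.0# F)
    (𝓛 : Pred (Projective.Line F n) 0ℓ) (m : ℕ) (cover : ExtendedQuadric.LineCover E n S 2≢0 𝓛 m) where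
  open ExtendedQuadric E n S 2≢0
  open LineCover cover
  open K using (solve; _:=_; _:+_; _:*_; :0)

  -- A line of the quadric is compared with the m lines of 𝓛 through one of
  -- its points.
  𝓛? : Decidable 𝓛
  𝓛? ℓ with SF.Q (F.rep (F.fst ℓ)) F.≟ F.0#
  ... | no ne = no λ ℓ∈ → ne (singular ℓ ℓ∈ (F.fst ℓ) (F.fst∈ˡ ℓ))
  ... | yes e with FiniteProperties.find (fin-finite m) (λ i → proj₁ (Inverse.from (covers (F.fst ℓ) e) i) F.≈ˡ? ℓ) (λ { refl p → p })
  ...   | yes (i , p) = yes (respects p (proj₁ (proj₂ (Inverse.from (covers (F.fst ℓ) e) i))))
  ...   | no ¬∃ = no λ ℓ∈ → ¬∃ (Inverse.to (covers (F.fst ℓ) e) (ℓ , ℓ∈ , F.fst∈ˡ ℓ) ,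
                    Inverse.inverseʳ (covers (F.fst ℓ) e) {ℓ , ℓ∈ , F.fst∈ˡ ℓ} refl)

  size : ℕ
  size = F.countLines 𝓛?

  through? : ∀ P → Decidable (λ ℓ → 𝓛 ℓ × P F.∈ˡ ℓ)
  through? P ℓ = 𝓛? ℓ ×-dec (P F.∈ˡ? ℓ)

  count-through : ∀ P → F.countLines (through? P) ≡ 𝟙 (SF.Q (F.rep P) F.≟ F.0#) * m
  count-through P with SF.Q (F.rep P) F.≟ F.0#
  ... | yes e = trans (HasSize⇒count F.lines (through? P) (λ e (ℓ∈ , P∈) → respects e ℓ∈ , Equivalence.to (e P) P∈) (covers P e))
                      (sym (ℕ.*-identityˡ m))
  ... | no ne = FiniteProperties.count-none F.lines (through? P) (λ ℓ (ℓ∈ , P∈) → ne (singular ℓ ℓ∈ P P∈))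

  kernel? : (φ : F.Vector → F.Carrier) → Decidable (λ ℓ → φ (F.rep (F.fst ℓ)) ≡ F.0# × φ (F.rep (F.snd ℓ)) ≡ F.0#)
  kernel? φ ℓ = (φ (F.rep (F.fst ℓ)) F.≟ F.0#) ×-dec (φ (F.rep (F.snd ℓ)) F.≟ F.0#)

  -- Common end of both double counts; `s` is `q` over the small field and `q ^ 2` over the large
  -- one.
  weighted : ∀ (s : ℕ) {D : Pred F.Line 0ℓ} (D? : Decidable D) →
    ∑[ ℓ ∈ F.allLines ] (𝟙 (𝓛? ℓ) * (1 + s * 𝟙 (D? ℓ))) ≡ size + s * F.countLines (λ ℓ → 𝓛? ℓ ×-dec D? ℓ)
  weighted s D? = begin
    ∑[ ℓ ∈ F.allLines ] (𝟙 (𝓛? ℓ) * (1 + s * 𝟙 (D? ℓ)))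
      ≡⟨ ∑-cong F.allLines (λ ℓ → trans (expand (𝟙 (𝓛? ℓ)) s (𝟙 (D? ℓ)))
           (cong (λ u → 𝟙 (𝓛? ℓ) + s * u) (sym (𝟙-× (𝓛? ℓ) (D? ℓ))))) ⟩
    ∑[ ℓ ∈ F.allLines ] (𝟙 (𝓛? ℓ) + s * 𝟙 (𝓛? ℓ ×-dec D? ℓ))
      ≡⟨ ∑-+ F.allLines _ _ ⟩
    size + ∑[ ℓ ∈ F.allLines ] (s * 𝟙 (𝓛? ℓ ×-dec D? ℓ))
      ≡⟨ cong (size +_) (∑-*ˡ F.allLines s (λ ℓ → 𝟙 (𝓛? ℓ ×-dec D? ℓ))) ⟩
    size + s * F.countLines (λ ℓ → 𝓛? ℓ ×-dec D? ℓ) ∎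
    where
    open ≡-Reasoning
    expand : ∀ a s b → a * (1 + s * b) ≡ a + s * (a * b)
    expand = solve-∀

  -- Pairs of a point in the kernel of `φ` and a line of `𝓛` through it, counted in both orders. The
  -- zero functional gives the size of the cover, and `polar` at a rational point gives the relation
  -- for its tangent hyperplane.
  incidences : ∀ {φ} → F.Linear φ →
    size + q * F.countLines (λ ℓ → 𝓛? ℓ ×-dec kernel? φ ℓ) ≡
    m * F.countPoints (λ P → (SF.Q (F.rep P) F.≟ F.0#) ×-dec (φ (F.rep P) F.≟ F.0#))
  incidences {φ} lin = begin
    size + q * F.countLines (λ ℓ → 𝓛? ℓ ×-dec kernel? φ ℓ)
      ≡⟨ weighted q (kernel? φ) ⟨
    ∑[ ℓ ∈ F.allLines ] (𝟙 (𝓛? ℓ) * (1 + q * 𝟙 (kernel? φ ℓ)))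
      ≡⟨ ∑-cong F.allLines (λ ℓ → trans (cong (𝟙 (𝓛? ℓ) *_) (sym (F.count-line∩kernel lin ℓ)))
           (sym (∑-*ˡ F.allPoints (𝟙 (𝓛? ℓ)) (λ P → 𝟙 ((P F.∈ˡ? ℓ) ×-dec (φ (F.rep P) F.≟ F.0#)))))) ⟩
    ∑[ ℓ ∈ F.allLines ] ∑[ P ∈ F.allPoints ] (𝟙 (𝓛? ℓ) * 𝟙 ((P F.∈ˡ? ℓ) ×-dec (φ (F.rep P) F.≟ F.0#)))
      ≡⟨ ∑-swap F.allLines F.allPoints _ ⟩
    ∑[ P ∈ F.allPoints ] ∑[ ℓ ∈ F.allLines ] (𝟙 (𝓛? ℓ) * 𝟙 ((P F.∈ˡ? ℓ) ×-dec (φ (F.rep P) F.≟ F.0#)))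
      ≡⟨ ∑-cong F.allPoints (λ P → trans (∑-cong F.allLines (λ ℓ → regroup P ℓ)) (trans
           (∑-*ʳ F.allLines (𝟙 (φ (F.rep P) F.≟ F.0#)) (λ ℓ → 𝟙 (through? P ℓ)))
           (trans (cong (_* 𝟙 (φ (F.rep P) F.≟ F.0#)) (count-through P))
             (trans (pull (𝟙 (SF.Q (F.rep P) F.≟ F.0#)) m (𝟙 (φ (F.rep P) F.≟ F.0#)))
               (cong (m *_) (sym (𝟙-× (SF.Q (F.rep P) F.≟ F.0#) (φ (F.rep P) F.≟ F.0#)))))))) ⟩
    ∑[ P ∈ F.allPoints ] (m * 𝟙 ((SF.Q (F.rep P) F.≟ F.0#) ×-dec (φ (F.rep P) F.≟ F.0#)))
      ≡⟨ ∑-*ˡ F.allPoints m (λ P → 𝟙 ((SF.Q (F.rep P) F.≟ F.0#) ×-dec (φ (F.rep P) F.≟ F.0#))) ⟩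
    m * F.countPoints (λ P → (SF.Q (F.rep P) F.≟ F.0#) ×-dec (φ (F.rep P) F.≟ F.0#)) ∎
    where
    open ≡-Reasoning
    regroup : ∀ P ℓ → 𝟙 (𝓛? ℓ) * 𝟙 ((P F.∈ˡ? ℓ) ×-dec (φ (F.rep P) F.≟ F.0#)) ≡ 𝟙 (through? P ℓ) * 𝟙 (φ (F.rep P) F.≟ F.0#)
    regroup P ℓ = trans (cong (𝟙 (𝓛? ℓ) *_) (𝟙-× (P F.∈ˡ? ℓ) (φ (F.rep P) F.≟ F.0#)))
      (trans (sym (ℕ.*-assoc (𝟙 (𝓛? ℓ)) _ _)) (cong (_* 𝟙 (φ (F.rep P) F.≟ F.0#)) (sym (𝟙-× (𝓛? ℓ) (P F.∈ˡ? ℓ)))))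
    pull : ∀ a m b → a * m * b ≡ m * (a * b)
    pull = solve-∀

  Covered : Pred K.Point 0ℓ
  Covered R = ∃ λ ℓ → 𝓛 ℓ × R K.∈ˡ extLine ℓ

  through-ext? : ∀ R → Decidable (λ ℓ → 𝓛 ℓ × R K.∈ˡ extLine ℓ)
  through-ext? R ℓ = 𝓛? ℓ ×-dec (R K.∈ˡ? extLine ℓ)

  covered? : Decidable Covered
  covered? R = FiniteProperties.find F.lines (through-ext? R)
    (λ {ℓ} {ℓ′} e (ℓ∈ , R∈) → respects e ℓ∈ , Equivalence.to (extLine-cong ℓ ℓ′ e R) R∈)

  covered-resp : Covered Respects K._≈ᵖ_
  covered-resp {R} {T} e (ℓ , ℓ∈ , R∈) = ℓ , ℓ∈ , K.∈ˡ-resp (extLine ℓ) {R} {T} e R∈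

  -- Positivity of `m` provides a line of `𝓛` through `P`.
  covered-rational : ∀ R P → R K.≈ᵖ extendPoint P → SF.Q (F.rep P) ≡ F.0# → Covered R
  covered-rational R P R≈P QP =
    let ℓ , ℓ∈ , P∈ = ∑-witness F.allLines (through? P) (subst (0 <_) (sym (trans (count-through P)
          (trans (cong (_* m) (𝟙-yes (SF.Q (F.rep P) F.≟ F.0#) QP)) (ℕ.*-identityˡ m)))) positive)
    in ℓ , ℓ∈ , ∈-rational {R} ℓ {P} R≈P P∈

  covered-irrational : ∀ R → ¬ Rational R → ∀ ℓ → R K.∈ˡ extLine ℓ → Covered R → 𝓛 ℓ
  covered-irrational R irr ℓ R∈ (ℓ′ , ℓ′∈ , R∈′) = respects
    (λ P → IsEquivalence.trans ⇔-isEquivalence (support-unique R irr ℓ′ R∈′ P)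
             (IsEquivalence.sym ⇔-isEquivalence (support-unique R irr ℓ R∈ P))) ℓ′∈

  singular-extLine : ∀ ℓ → Singular ℓ → ∀ R → R K.∈ˡ extLine ℓ → SK.Q (K.rep R) ≡ K.0#
  singular-extLine ℓ sing R (α , β , e) = trans (cong SK.Q e) (trans (SK.Q-combination α β _ _)
    (trans (cong₂ K._+_ (cong₂ (λ s t → α K.* α K.* s K.+ β K.* β K.* t)
        (lift (Q-ext _) (sing (F.fst ℓ) (F.fst∈ˡ ℓ))) (lift (Q-ext _) (sing (F.snd ℓ) (F.snd∈ˡ ℓ))))
        (cong (α K.* β K.*_) (lift (polar-ext _ _) (singular-polar ℓ sing))))
      (solve 2 (λ α β → α :* α :* :0 :+ β :* β :* :0 :+ α :* β :* :0 := :0) refl α β)))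
    where
    lift : ∀ {z a} → z ≡ embed a → a ≡ F.0# → z ≡ K.0#
    lift e a≡0 = trans e (trans (cong embed a≡0) 0#-homo)

  covered-singular : ∀ R → Covered R → SK.Q (K.rep R) ≡ K.0#
  covered-singular R (ℓ , ℓ∈ , R∈) = singular-extLine ℓ (singular ℓ ℓ∈) R R∈

  singular-rational? : Decidable (λ R → SK.Q (K.rep R) ≡ K.0# × Rational R)
  singular-rational? R = (SK.Q (K.rep R) K.≟ K.0#) ×-dec rational? R

  -- The number of lines is m if R is rational and 1 otherwise; the terms are
  -- arranged so that no subtraction occurs.
  count-through-ext : ∀ R → F.countLines (through-ext? R) + 𝟙 (singular-rational? R) ≡
                            𝟙 (covered? R) + m * 𝟙 (singular-rational? R)
  count-through-ext R = by-cases (rational? R)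
    where
    open ≡-Reasoning
    by-cases : Dec (Rational R) → F.countLines (through-ext? R) + 𝟙 (singular-rational? R) ≡
                                  𝟙 (covered? R) + m * 𝟙 (singular-rational? R)
    by-cases (yes (P , R≈P)) = trans (cong (_+ 𝟙 (singular-rational? R)) same) (rational-case (SF.Q (F.rep P) F.≟ F.0#))
      where
      same : F.countLines (through-ext? R) ≡ F.countLines (through? P)
      same = FiniteProperties.count-cong F.lines (through-ext? R) (through? P)
        (λ ℓ (ℓ∈ , R∈) → ℓ∈ , rational-∈ {R} ℓ {P} R≈P R∈) (λ ℓ (ℓ∈ , P∈) → ℓ∈ , ∈-rational {R} ℓ {P} R≈P P∈)
      rational-case : Dec (SF.Q (F.rep P) ≡ F.0#) → F.countLines (through? P) + 𝟙 (singular-rational? R) ≡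
                                                  𝟙 (covered? R) + m * 𝟙 (singular-rational? R)
      rational-case (yes QP) = begin
        F.countLines (through? P) + 𝟙 (singular-rational? R)
          ≡⟨ cong₂ _+_ (trans (count-through P) (cong (_* m) (𝟙-yes (SF.Q (F.rep P) F.≟ F.0#) QP))) sr≡1 ⟩
        1 * m + 1
          ≡⟨ swap m ⟩
        1 + m * 1
          ≡⟨ cong₂ (λ s t → s + m * t) (𝟙-yes (covered? R) (covered-rational R P R≈P QP)) sr≡1 ⟨
        𝟙 (covered? R) + m * 𝟙 (singular-rational? R) ∎
        where
        sr≡1 : 𝟙 (singular-rational? R) ≡ 1
        sr≡1 = 𝟙-yes (singular-rational? R) (Q-rational {R} {P} R≈P QP , P , R≈P)
        swap : ∀ m → 1 * m + 1 ≡ 1 + m * 1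
        swap = solve-∀
      rational-case (no ¬QP) = begin
        F.countLines (through? P) + 𝟙 (singular-rational? R)
          ≡⟨ cong₂ _+_ (trans (count-through P) (cong (_* m) (𝟙-no (SF.Q (F.rep P) F.≟ F.0#) ¬QP))) sr≡0 ⟩
        0
          ≡⟨ ℕ.*-zeroʳ m ⟨
        m * 0
          ≡⟨ cong₂ (λ s t → s + m * t) (𝟙-no (covered? R) (λ c → ¬QP (rational-Q {R} {P} R≈P (covered-singular R c)))) sr≡0 ⟨
        𝟙 (covered? R) + m * 𝟙 (singular-rational? R) ∎
        where
        sr≡0 : 𝟙 (singular-rational? R) ≡ 0
        sr≡0 = 𝟙-no (singular-rational? R) (λ (QR , _) → ¬QP (rational-Q {R} {P} R≈P QR))
    by-cases (no irr) = begin
      F.countLines (through-ext? R) + 𝟙 (singular-rational? R)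
        ≡⟨ cong₂ _+_ (irrational-case (𝓛? (support R irr))) sr≡0 ⟩
      𝟙 (covered? R) + 0
        ≡⟨ cong (𝟙 (covered? R) +_) (trans (cong (m *_) sr≡0) (ℕ.*-zeroʳ m)) ⟨
      𝟙 (covered? R) + m * 𝟙 (singular-rational? R) ∎
      where
      sr≡0 : 𝟙 (singular-rational? R) ≡ 0
      sr≡0 = 𝟙-no (singular-rational? R) (λ (_ , r) → irr r)
      irrational-case : Dec (𝓛 (support R irr)) → F.countLines (through-ext? R) ≡ 𝟙 (covered? R)
      irrational-case (yes s∈) = trans
        (FiniteProperties.count-one F.lines (through-ext? R) (support R irr)
          (λ ℓ (_ , R∈) → support-unique R irr ℓ R∈)
          (λ ℓ e → respects (λ P → ⇔.sym (e P)) s∈ , Equivalence.from (extLine-cong ℓ (support R irr) e R) (∈-support R irr)))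
        (sym (𝟙-yes (covered? R) (support R irr , s∈ , ∈-support R irr)))
        where
        module ⇔ = IsEquivalence (⇔-isEquivalence {0ℓ})
      irrational-case (no s∉) = trans
        (FiniteProperties.count-none F.lines (through-ext? R)
          (λ ℓ (ℓ∈ , R∈) → s∉ (covered-irrational R irr (support R irr) (∈-support R irr) (ℓ , ℓ∈ , R∈))))
        (sym (𝟙-no (covered? R) (λ c → s∉ (covered-irrational R irr (support R irr) (∈-support R irr) c))))

  tangent? : ∀ R → Decidable (λ Y → SK.polar (K.rep R) (K.rep Y) ≡ K.0#)
  tangent? R Y = SK.polar (K.rep R) (K.rep Y) K.≟ K.0#

  orthogonal-line? : ∀ R → Decidable (λ ℓ → SK.polar (K.rep R) (ext (F.rep (F.fst ℓ))) ≡ K.0# × SK.polar (K.rep R) (ext (F.rep (F.snd ℓ))) ≡ K.0#)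
  orthogonal-line? R ℓ = (SK.polar (K.rep R) (ext (F.rep (F.fst ℓ))) K.≟ K.0#) ×-dec (SK.polar (K.rep R) (ext (F.rep (F.snd ℓ))) K.≟ K.0#)

  -- Moves a count of rational points into a sum over the large space, where it combines termwise
  -- with the count of covering lines; `extendPoint` has fibres of size one over rational points and
  -- empty ones elsewhere.
  orthogonal-as-sum : ∀ R → F.countPoints (orthogonal? R) ≡ ∑[ Y ∈ K.allPoints ] (𝟙 (tangent? R Y) * 𝟙 (singular-rational? Y))
  orthogonal-as-sum R = begin
    F.countPoints (orthogonal? R)
      ≡⟨ ∑-cong F.allPoints (λ P → trans (𝟙-cong (orthogonal? R P) ((SK.Q (ext (F.rep P)) K.≟ K.0#) ×-dec tangent? R (extendPoint P))
           (λ (QP , RP) → trans (Q-ext _) (trans (cong embed QP) 0#-homo) , RP)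
           (λ (QP , RP) → embed≡0 (trans (sym (Q-ext _)) QP) , RP))
           (𝟙-× (SK.Q (ext (F.rep P)) K.≟ K.0#) (tangent? R (extendPoint P)))) ⟩
    ∑[ P ∈ F.allPoints ] w (extendPoint P)
      ≡⟨ FiniteProperties.∑-pushforward K.points F.allPoints extendPoint {w} (λ {Y} {Z} → w-resp {Y} {Z}) ⟩
    ∑[ Y ∈ K.allPoints ] (w Y * ∑[ P ∈ F.allPoints ] 𝟙 (Y K.≟ᵖ extendPoint P))
      ≡⟨ ∑-cong K.allPoints (λ Y → trans (cong (w Y *_) (count-rational Y (rational? Y)))
           (trans (rotate (𝟙 (SK.Q (K.rep Y) K.≟ K.0#)) (𝟙 (tangent? R Y)) (𝟙 (rational? Y)))
             (cong (𝟙 (tangent? R Y) *_) (sym (𝟙-× (SK.Q (K.rep Y) K.≟ K.0#) (rational? Y)))))) ⟩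
    ∑[ Y ∈ K.allPoints ] (𝟙 (tangent? R Y) * 𝟙 (singular-rational? Y)) ∎
    where
    open ≡-Reasoning
    w : K.Point → ℕ
    w Y = 𝟙 (SK.Q (K.rep Y) K.≟ K.0#) * 𝟙 (tangent? R Y)
    w-resp : ∀ {Y Z} → Y K.≈ᵖ Z → w Y ≡ w Z
    w-resp {Y} {Z} e = cong₂ _*_
      (𝟙-cong (SK.Q (K.rep Y) K.≟ K.0#) (SK.Q (K.rep Z) K.≟ K.0#) (SK.Q-resp Y Z e) (SK.Q-resp Z Y (K.≈ᵖ-sym Y Z e)))
      (𝟙-cong (tangent? R Y) (tangent? R Z) 
        (K.linear-resp (SK.polar-linear (K.rep R)) Y Z e) (K.linear-resp (SK.polar-linear (K.rep R)) Z Y (K.≈ᵖ-sym Y Z e)))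
    count-rational : ∀ Y (d : Dec (Rational Y)) → ∑[ P ∈ F.allPoints ] 𝟙 (Y K.≟ᵖ extendPoint P) ≡ 𝟙 d
    count-rational Y (no irr) = FiniteProperties.count-none F.points (λ P → Y K.≟ᵖ extendPoint P) (λ P e → irr (P , e))
    count-rational Y (yes (P , e)) = FiniteProperties.count-one F.points (λ P → Y K.≟ᵖ extendPoint P) P
      (λ T f → extendPoint-injective {T} {P} (K.≈ᵖ-trans (extendPoint T) Y (extendPoint P)
                 (K.≈ᵖ-sym Y (extendPoint T) f) e))
      (λ T f → K.≈ᵖ-trans Y (extendPoint P) (extendPoint T) e
                 (K.≈ᵖ-sym (extendPoint T) (extendPoint P) (extendPoint-cong {T} {P} f)))
    rotate : ∀ a b c → a * b * c ≡ b * (a * c)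
    rotate = solve-∀

  -- Double counting of the pairs (Y, ℓ) with Y on the extension of ℓ ∈ 𝓛
  -- and orthogonal to R.
  incidences-ext : ∀ R →
    K.countPoints (λ Y → tangent? R Y ×-dec covered? Y) + m * F.countPoints (orthogonal? R) ≡
    size + q ^ 2 * F.countLines (λ ℓ → 𝓛? ℓ ×-dec orthogonal-line? R ℓ) + F.countPoints (orthogonal? R)
  incidences-ext R = begin
    K.countPoints (λ Y → tangent? R Y ×-dec covered? Y) + m * F.countPoints (orthogonal? R)
      ≡⟨ cong₂ _+_ (∑-cong K.allPoints (λ Y → 𝟙-× (tangent? R Y) (covered? Y)))
           (trans (cong (m *_) (orthogonal-as-sum R)) (sym (∑-*ˡ K.allPoints m _))) ⟩
    ∑[ Y ∈ K.allPoints ] (𝟙 (tangent? R Y) * 𝟙 (covered? Y)) + ∑[ Y ∈ K.allPoints ] (m * (𝟙 (tangent? R Y) * 𝟙 (singular-rational? Y)))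
      ≡⟨ ∑-+ K.allPoints _ _ ⟨
    ∑[ Y ∈ K.allPoints ] (𝟙 (tangent? R Y) * 𝟙 (covered? Y) + m * (𝟙 (tangent? R Y) * 𝟙 (singular-rational? Y)))
      ≡⟨ ∑-cong K.allPoints (λ Y → trans (factor (𝟙 (tangent? R Y)) (𝟙 (covered? Y)) m (𝟙 (singular-rational? Y)))
           (trans (cong (𝟙 (tangent? R Y) *_) (sym (count-through-ext Y))) (ℕ.*-distribˡ-+ (𝟙 (tangent? R Y)) _ _))) ⟩
    ∑[ Y ∈ K.allPoints ] (𝟙 (tangent? R Y) * F.countLines (through-ext? Y) + 𝟙 (tangent? R Y) * 𝟙 (singular-rational? Y))
      ≡⟨ ∑-+ K.allPoints _ _ ⟩
    ∑[ Y ∈ K.allPoints ] (𝟙 (tangent? R Y) * F.countLines (through-ext? Y)) + ∑[ Y ∈ K.allPoints ] (𝟙 (tangent? R Y) * 𝟙 (singular-rational? Y))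
      ≡⟨ cong₂ _+_ pairs (sym (orthogonal-as-sum R)) ⟩
    size + q ^ 2 * F.countLines (λ ℓ → 𝓛? ℓ ×-dec orthogonal-line? R ℓ) + F.countPoints (orthogonal? R) ∎
    where
    open ≡-Reasoning
    factor : ∀ a b m c → a * b + m * (a * c) ≡ a * (b + m * c)
    factor = solve-∀
    regroup : ∀ Y ℓ → 𝟙 (tangent? R Y) * 𝟙 (through-ext? Y ℓ) ≡ 𝟙 (𝓛? ℓ) * 𝟙 ((Y K.∈ˡ? extLine ℓ) ×-dec tangent? R Y)
    regroup Y ℓ = trans (cong (𝟙 (tangent? R Y) *_) (𝟙-× (𝓛? ℓ) (Y K.∈ˡ? extLine ℓ)))
      (trans (rotate (𝟙 (tangent? R Y)) (𝟙 (𝓛? ℓ)) (𝟙 (Y K.∈ˡ? extLine ℓ))) (cong (𝟙 (𝓛? ℓ) *_) (sym (𝟙-× (Y K.∈ˡ? extLine ℓ) (tangent? R Y)))))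
      where
      rotate : ∀ a b c → a * (b * c) ≡ b * (c * a)
      rotate = solve-∀
    pairs : ∑[ Y ∈ K.allPoints ] (𝟙 (tangent? R Y) * F.countLines (through-ext? Y)) ≡
            size + q ^ 2 * F.countLines (λ ℓ → 𝓛? ℓ ×-dec orthogonal-line? R ℓ)
    pairs = begin
      ∑[ Y ∈ K.allPoints ] (𝟙 (tangent? R Y) * F.countLines (through-ext? Y))
        ≡⟨ ∑-cong K.allPoints (λ Y → trans (sym (∑-*ˡ F.allLines (𝟙 (tangent? R Y)) (λ ℓ → 𝟙 (through-ext? Y ℓ))))
             (∑-cong F.allLines (regroup Y))) ⟩
      ∑[ Y ∈ K.allPoints ] ∑[ ℓ ∈ F.allLines ] (𝟙 (𝓛? ℓ) * 𝟙 ((Y K.∈ˡ? extLine ℓ) ×-dec tangent? R Y))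
        ≡⟨ ∑-swap K.allPoints F.allLines _ ⟩
      ∑[ ℓ ∈ F.allLines ] ∑[ Y ∈ K.allPoints ] (𝟙 (𝓛? ℓ) * 𝟙 ((Y K.∈ˡ? extLine ℓ) ×-dec tangent? R Y))
        ≡⟨ ∑-cong F.allLines (λ ℓ → trans (∑-*ˡ K.allPoints (𝟙 (𝓛? ℓ)) (λ Y → 𝟙 ((Y K.∈ˡ? extLine ℓ) ×-dec tangent? R Y)))
             (cong (𝟙 (𝓛? ℓ) *_) (K.count-line∩kernel (SK.polar-linear (K.rep R)) (extLine ℓ)))) ⟩
      ∑[ ℓ ∈ F.allLines ] (𝟙 (𝓛? ℓ) * (1 + q ^ 2 * 𝟙 (orthogonal-line? R ℓ)))
        ≡⟨ weighted (q ^ 2) (orthogonal-line? R) ⟩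
      size + q ^ 2 * F.countLines (λ ℓ → 𝓛? ℓ ×-dec orthogonal-line? R ℓ) ∎

-- Identities for the numbers θ and the tightness parameter.

-- Splits off the constant term, whereas the definition splits off the highest power.
θ<-suc : ∀ k s → θ< (suc k) s ≡ 1 + s * θ< k s
θ<-suc zero    s = cong suc (sym (ℕ.*-zeroʳ s))
θ<-suc (suc k) s = trans (cong (s * s ^ k +_) (θ<-suc k s)) (rearrange s (s ^ k) (θ< k s))
  where
  rearrange : ∀ s a b → s * a + (1 + s * b) ≡ 1 + s * (a + b)
  rearrange = solve-∀

-- Consecutive powers pair up as `q ^ (2 j + 1) + q ^ (2 j) = (q + 1) (q ^ 2) ^
-- j`. This is why the division by `q + 1` in the dual condition is exact.
θ<-double : ∀ k q → θ< (k * 2) q ≡ suc q * θ< k (q ^ 2)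
θ<-double zero    q = sym (ℕ.*-zeroʳ (suc q))
θ<-double (suc k) q = begin
  q * q ^ (k * 2) + (q ^ (k * 2) + θ< (k * 2) q)
    ≡⟨ cong (λ u → q * q ^ (k * 2) + (q ^ (k * 2) + u)) (θ<-double k q) ⟩
  q * q ^ (k * 2) + (q ^ (k * 2) + suc q * θ< k (q ^ 2))
    ≡⟨ cong (λ u → q * u + (u + suc q * θ< k (q ^ 2))) (trans (cong (q ℕ.^_) (ℕ.*-comm k 2)) (sym (ℕ.^-*-assoc q 2 k))) ⟩
  q * (q ^ 2) ^ k + ((q ^ 2) ^ k + suc q * θ< k (q ^ 2))
    ≡⟨ rearrange q ((q ^ 2) ^ k) (θ< k (q ^ 2)) ⟩
  suc q * θ< (suc k) (q ^ 2) ∎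
  where
  open ≡-Reasoning
  rearrange : ∀ q a b → q * a + (a + suc q * b) ≡ suc q * (a + b)
  rearrange = solve-∀

-- Θ and Ψ stand for θ_{(r-4)/2,q²} and θ_{(r-6)/2,q²}; in these terms
-- |𝓛| = m (1 + q² Θ), and (q + 1) Θ is the value of h for irrational points.
module TightArithmetic (q m Θ Ψ : ℕ) (Θ≡ : Θ ≡ 1 + q ^ 2 * Ψ) .{{_ : ℕ.NonZero q}} where
  private
    s d i : ℕ
    s = q ^ 2
    d = s ∸ q
    i = m * d + q + 1
    s≡q*q : s ≡ q * q
    s≡q*q = cong (q *_) (ℕ.*-identityʳ q)
    q+d≡s : q + d ≡ s
    q+d≡s = ℕ.m+[n∸m]≡n (subst (q ≤_) (sym s≡q*q) (ℕ.m≤m*n q q))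

  -- The double count with `T` and `a` replaced by their prescribed values. Writing `q + d = q ^ 2`
  -- avoids subtraction, and `Θ = 1 + q ^ 2 Ψ` exchanges `m Θ` on the left for `m + q ^ 2 m Ψ` on
  -- the right.
  irrational-identity : ∀ ε → (i * Θ + s * ε) + m * (suc q * Θ) ≡
    m * (1 + s * Θ) + s * (m * Ψ + ε) + suc q * Θ
  irrational-identity ε = begin
    (i * Θ + s * ε) + m * (suc q * Θ)
      ≡⟨ left m q d Θ (s * ε) ⟩
    m * Θ + m * ((q + d) * Θ) + s * ε + suc q * Θ
      ≡⟨ cong₂ (λ u v → m * u + m * (v * Θ) + s * ε + suc q * Θ) Θ≡ q+d≡s ⟩
    m * (1 + s * Ψ) + m * (s * Θ) + s * ε + suc q * Θ
      ≡⟨ right m q s Θ Ψ ε ⟩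
    m * (1 + s * Θ) + s * (m * Ψ + ε) + suc q * Θ ∎
    where
    open ≡-Reasoning
    left : ∀ m q d Θ e → ((m * d + q + 1) * Θ + e) + m * (suc q * Θ) ≡
                         m * Θ + m * ((q + d) * Θ) + e + suc q * Θ
    left = solve-∀
    right : ∀ m q s Θ Ψ ε → m * (1 + s * Ψ) + m * (s * Θ) + s * ε + suc q * Θ ≡
                            m * (1 + s * Θ) + s * (m * Ψ + ε) + suc q * Θ
    right = solve-∀

  -- The double count is linear in `T` and `a` with coefficients 1 and `q ^ 2`; compared with the
  -- identity above, each of the two values forces the other.
  irrational-tight : ∀ {T a ε} → T + m * (suc q * Θ) ≡ m * (1 + s * Θ) + s * a + suc q * Θ →
                     T ≡ i * Θ + s * ε ⇔ a ≡ m * Ψ + ε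
  irrational-tight {T} {a} {ε} e = mk⇔
    (λ T≡ → ℕ.*-cancelˡ-≡ a (m * Ψ + ε) s {{ℕ.m^n≢0 q 2}} (ℕ.+-cancelˡ-≡ (m * (1 + s * Θ)) _ _ (ℕ.+-cancelʳ-≡ (suc q * Θ) _ _
      (trans (sym e) (trans (cong (_+ m * (suc q * Θ)) T≡) (irrational-identity ε))))))
    (λ { refl → ℕ.+-cancelʳ-≡ (m * (suc q * Θ)) _ _ (trans e (sym (irrational-identity ε))) })

  -- The count over the small field gives `a = m Θ`, and the one over the large field then fixes
  -- `T`. The shape of `h` with `p` split off produces the surplus of a point inside the set.
  rational-tight : ∀ {T a h p} → h ≡ 1 + q * (suc q * Θ) → h ≡ p + suc q * Θ →
    m * (1 + s * Θ) + q * a ≡ m * h →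
    T + m * h ≡ m * (1 + s * Θ) + s * a + h →
    T ≡ i * Θ + p
  rational-tight {T} {a} {h} {p} h≡ h≡′ small large = ℕ.+-cancelʳ-≡ (m * h) T (i * Θ + p) (begin
    T + m * h
      ≡⟨ large ⟩
    m * (1 + s * Θ) + s * a + h
      ≡⟨ cong₂ (λ u v → m * (1 + s * Θ) + u * v + h) (sym q+d≡s) a≡mΘ ⟩
    m * (1 + s * Θ) + (q + d) * (m * Θ) + h
      ≡⟨ cong₂ (λ u v → m * (1 + u * Θ) + (q + d) * (m * Θ) + v) s≡q*q h≡′ ⟩
    m * (1 + q * q * Θ) + (q + d) * (m * Θ) + (p + suc q * Θ)
      ≡⟨ rearrange m q d Θ p ⟩
    (m * d + q + 1) * Θ + p + m * (1 + q * (suc q * Θ))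
      ≡⟨ cong (λ u → i * Θ + p + m * u) h≡ ⟨
    i * Θ + p + m * h ∎)
    where
    open ≡-Reasoning
    rearrange : ∀ m q d Θ p → m * (1 + q * q * Θ) + (q + d) * (m * Θ) + (p + suc q * Θ) ≡
                              (m * d + q + 1) * Θ + p + m * (1 + q * (suc q * Θ))
    rearrange = solve-∀
    expand : ∀ m q Θ → m * (1 + q * (suc q * Θ)) ≡ m * (1 + q * q * Θ) + q * (m * Θ)
    expand = solve-∀
    a≡mΘ : a ≡ m * Θ
    a≡mΘ = ℕ.*-cancelˡ-≡ a (m * Θ) q (ℕ.+-cancelˡ-≡ (m * (1 + s * Θ)) _ _ (begin
      m * (1 + s * Θ) + q * a                     ≡⟨ small ⟩
      m * h                                               ≡⟨ cong (m *_) h≡ ⟩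
      m * (1 + q * (suc q * Θ))                     ≡⟨ expand m q Θ ⟩
      m * (1 + q * q * Θ) + q * (m * Θ)       ≡⟨ cong (λ u → m * (1 + u * Θ) + q * (m * Θ)) s≡q*q ⟨
      m * (1 + s * Θ) + q * (m * Θ)             ∎))

-- Tightness at a point against duality at a line.

module CoverTightness {q : ℕ} {F : FiniteField q} {K : FiniteField (q ^ 2)} (E : Embedding F K) (n : ℕ)
    (S : ExtendedSpace E n)
    (2≢0 : FieldTheory._+_ F (FieldTheory.1# F) (FieldTheory.1# F) ≢ FieldTheory.0# F)
    (nondeg : QuadraticSpace.Nondegenerate (ExtendedSpace.small S))
    (k : ℕ) (n≡ : n ≡ suc ((2 + k) * 2))
    (𝓛 : Pred (Projective.Line F n) 0ℓ) (m : ℕ) (cover : ExtendedQuadric.LineCover E n S 2≢0 𝓛 m) where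
  open ExtendedQuadric E n S 2≢0
  open LineCover cover
  open CoverCounting E n S 2≢0 𝓛 m cover public
  open OrthogonalPoints nondeg k n≡
  open FC.Parabolic nondeg k n≡ using (points-whole)
  open FC using (q-nonZero; whole; module Subspace)

  Θ Ψ : ℕ
  Θ = θ< (suc k) (q ^ 2)
  Ψ = θ< k (q ^ 2)

  open TightArithmetic q m Θ Ψ (θ<-suc k (q ^ 2)) {{q-nonZero}}

  -- With the zero functional every point of the quadric and every line of `𝓛` counts; the factor
  -- `q + 1` shared by both sides is cancelled.
  size≡ : size ≡ m * (1 + q ^ 2 * Θ)
  size≡ = ℕ.*-cancelˡ-≡ size _ (suc q) (begin
    size + q * size
      ≡⟨ cong (λ u → size + q * u) (FiniteProperties.count-cong F.lines 𝓛? (λ ℓ → 𝓛? ℓ ×-dec kernel? zero′ ℓ)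
           (λ ℓ ℓ∈ → ℓ∈ , refl , refl) (λ ℓ → proj₁)) ⟩
    size + q * F.countLines (λ ℓ → 𝓛? ℓ ×-dec kernel? zero′ ℓ)
      ≡⟨ incidences zero′-linear ⟩
    m * F.countPoints (λ P → (SF.Q (F.rep P) F.≟ F.0#) ×-dec (F.0# F.≟ F.0#))
      ≡⟨ cong (m *_) (trans (FiniteProperties.count-cong F.points
           (λ P → (SF.Q (F.rep P) F.≟ F.0#) ×-dec (F.0# F.≟ F.0#)) (λ P → Subspace.zero? whole (F.rep P))
           (λ P (QP , _) → _ , QP) (λ P (_ , QP) → QP , refl)) points-whole) ⟩
    m * θ< ((2 + k) * 2) q
      ≡⟨ cong (m *_) (trans (θ<-double (2 + k) q) (cong (suc q *_) (θ<-suc (suc k) (q ^ 2)))) ⟩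
    m * (suc q * (1 + q ^ 2 * Θ))
      ≡⟨ swap m (suc q) _ ⟩
    suc q * (m * (1 + q ^ 2 * Θ)) ∎)
    where
    open ≡-Reasoning
    zero′ : F.Vector → F.Carrier
    zero′ _ = F.0#
    zero′-linear : F.Linear zero′
    zero′-linear a b x y = sym (trans (cong₂ F._+_ (F.zeroʳ a) (F.zeroʳ b)) (F.+-identityʳ F.0#))
    swap : ∀ a b c → a * (b * c) ≡ b * (a * c)
    swap = solve-∀

  -- The unfolded form of `ℓ′ ⊆ˡ ℓ ^⊥ˡ`, so that sizes proved for it are those of the dual condition
  -- without conversion.
  Orthogonal : F.Line → F.Line → Set
  Orthogonal ℓ ℓ′ = ∀ P → P F.∈ˡ ℓ′ → ∀ R → R F.∈ˡ ℓ → SF.polar (F.rep R) (F.rep P) ≡ F.0#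

  OrthogonalAt : K.Point → F.Line → Set
  OrthogonalAt R ℓ = SK.polar (K.rep R) (ext (F.rep (F.fst ℓ))) ≡ K.0# × SK.polar (K.rep R) (ext (F.rep (F.snd ℓ))) ≡ K.0#

  orthogonal⇒at : ∀ R ℓ → R K.∈ˡ extLine ℓ → ∀ ℓ′ → Orthogonal ℓ ℓ′ → OrthogonalAt R ℓ′
  orthogonal⇒at R ℓ R∈ ℓ′ o =
    ⊥-irrational R ℓ R∈ (F.rep (F.fst ℓ′)) (o (F.fst ℓ′) (F.fst∈ˡ ℓ′) (F.fst ℓ) (F.fst∈ˡ ℓ) , o (F.fst ℓ′) (F.fst∈ˡ ℓ′) (F.snd ℓ) (F.snd∈ˡ ℓ)) ,
    ⊥-irrational R ℓ R∈ (F.rep (F.snd ℓ′)) (o (F.snd ℓ′) (F.snd∈ˡ ℓ′) (F.fst ℓ) (F.fst∈ˡ ℓ) , o (F.snd ℓ′) (F.snd∈ˡ ℓ′) (F.snd ℓ) (F.snd∈ˡ ℓ))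

  at⇒orthogonal : ∀ R → ¬ Rational R → ∀ ℓ → R K.∈ˡ extLine ℓ → ∀ ℓ′ → OrthogonalAt R ℓ′ → Orthogonal ℓ ℓ′
  at⇒orthogonal R irr ℓ R∈ ℓ′ (o₁ , o₂) P P∈ T T∈ = trans (SF.polar-sym _ _)
    (F.linear-span (SF.polar-linear (F.rep P)) T∈ (vanish (F.rep (F.fst ℓ)) (proj₁ xy₁) (proj₁ xy₂)) (vanish (F.rep (F.snd ℓ)) (proj₂ xy₁) (proj₂ xy₂)))
    where
    xy₁ = irrational-⊥ R irr ℓ R∈ (F.rep (F.fst ℓ′)) o₁
    xy₂ = irrational-⊥ R irr ℓ R∈ (F.rep (F.snd ℓ′)) o₂
    vanish : ∀ x → SF.polar x (F.rep (F.fst ℓ′)) ≡ F.0# → SF.polar x (F.rep (F.snd ℓ′)) ≡ F.0# → SF.polar (F.rep P) x ≡ F.0#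
    vanish x e f = trans (SF.polar-sym _ _) (F.linear-span (SF.polar-linear x) P∈ e f)

  OrthogonalIn : F.Line → Pred F.Line 0ℓ
  OrthogonalIn ℓ ℓ′ = 𝓛 ℓ′ × Orthogonal ℓ ℓ′

  -- Orthogonality of two lines quantifies over all their points; at a generic point of `ℓ` it
  -- becomes two equations over the large field, which can be decided.
  orthogonalIn? : ∀ ℓ → Decidable (OrthogonalIn ℓ)
  orthogonalIn? ℓ ℓ′ = 𝓛? ℓ′ ×-dec map′
    (at⇒orthogonal (generic-point ℓ) (generic-point-irrational ℓ) ℓ (generic-point-∈ ℓ) ℓ′)
    (orthogonal⇒at (generic-point ℓ) ℓ (generic-point-∈ ℓ) ℓ′)
    (orthogonal-line? (generic-point ℓ) ℓ′)

  orthogonalIn-resp : ∀ ℓ → OrthogonalIn ℓ Respects F._≈ˡ_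
  orthogonalIn-resp ℓ e (ℓ∈ , o) = respects e ℓ∈ , λ P P∈ → o P (Equivalence.from (e P) P∈)

  count-orthogonal : ∀ R → ¬ Rational R → ∀ ℓ → R K.∈ˡ extLine ℓ →
    F.countLines (λ ℓ′ → 𝓛? ℓ′ ×-dec orthogonal-line? R ℓ′) ≡ F.countLines (orthogonalIn? ℓ)
  count-orthogonal R irr ℓ R∈ = FiniteProperties.count-cong F.lines (λ ℓ′ → 𝓛? ℓ′ ×-dec orthogonal-line? R ℓ′) (orthogonalIn? ℓ)
    (λ ℓ′ (ℓ′∈ , o) → ℓ′∈ , at⇒orthogonal R irr ℓ R∈ ℓ′ o) (λ ℓ′ (ℓ′∈ , o) → ℓ′∈ , orthogonal⇒at R ℓ R∈ ℓ′ o)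

  TangentCovered : K.Point → Pred K.Point 0ℓ
  TangentCovered R Y = SK.polar (K.rep R) (K.rep Y) ≡ K.0# × Covered Y

  tangentCovered? : ∀ R → Decidable (TangentCovered R)
  tangentCovered? R Y = tangent? R Y ×-dec covered? Y

  tangentCovered-resp : ∀ R → TangentCovered R Respects K._≈ᵖ_
  tangentCovered-resp R {Y} {Z} e (p , c) = K.linear-resp (SK.polar-linear (K.rep R)) Y Z e p , covered-resp {Y} {Z} e c

  tightness : ℕ
  tightness = m * (q ^ 2 ∸ q) + q + 1

  -- `ε` is the surplus: `q ^ (r - 4)` for a line of `𝓛` and 0 otherwise. Each further line in the
  -- perp adds `q ^ 2` points, whence the factor on the left.
  irrational-size : ∀ R → ¬ Rational R → SK.Q (K.rep R) ≡ K.0# → ∀ ℓ → R K.∈ˡ extLine ℓ → ∀ ε →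
    HasSize K.Points (TangentCovered R) (tightness * Θ + q ^ 2 * ε) ⇔ HasSize F.Lines (OrthogonalIn ℓ) (m * Ψ + ε)
  irrational-size R irr QR ℓ R∈ ε = mk⇔
    (λ T → count⇒HasSize F.lines (orthogonalIn? ℓ) (orthogonalIn-resp ℓ)
       (Equivalence.to equation (HasSize⇒count K.points (tangentCovered? R) (λ {Y} {Z} → tangentCovered-resp R {Y} {Z}) T)))
    (λ a → count⇒HasSize K.points (tangentCovered? R) (λ {Y} {Z} → tangentCovered-resp R {Y} {Z})
       (Equivalence.from equation (HasSize⇒count F.lines (orthogonalIn? ℓ) (orthogonalIn-resp ℓ) a)))
    where
    open ≡-Reasoning
    T = K.countPoints (tangentCovered? R)
    h = F.countPoints (orthogonal? R)
    a = F.countLines (orthogonalIn? ℓ)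
    h≡ : h ≡ suc q * Θ
    h≡ = trans (orthogonal-irrational R irr QR ℓ R∈) (θ<-double (suc k) q)
    equation : T ≡ tightness * Θ + q ^ 2 * ε ⇔ a ≡ m * Ψ + ε
    equation = irrational-tight {T} {a} {ε} (begin
      T + m * (suc q * Θ)
        ≡⟨ cong (λ u → T + m * u) h≡ ⟨
      T + m * h
        ≡⟨ incidences-ext R ⟩
      size + q ^ 2 * F.countLines (λ ℓ′ → 𝓛? ℓ′ ×-dec orthogonal-line? R ℓ′) + h
        ≡⟨ cong₂ (λ u v → size + q ^ 2 * u + v) (count-orthogonal R irr ℓ R∈) h≡ ⟩
      size + q ^ 2 * a + suc q * Θ
        ≡⟨ cong (λ u → u + q ^ 2 * a + suc q * Θ) size≡ ⟩
      m * (1 + q ^ 2 * Θ) + q ^ 2 * a + suc q * Θ ∎)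

  rational-size : ∀ R → Rational R → SK.Q (K.rep R) ≡ K.0# →
    HasSize K.Points (TangentCovered R) (tightness * Θ + q ^ (2 + k * 2))
  rational-size R (P , R≈P) QR = count⇒HasSize K.points (tangentCovered? R) (λ {Y} {Z} → tangentCovered-resp R {Y} {Z})
    (rational-tight {T} {a} {h} {q ^ (2 + k * 2)} h≡ h≡′ small-incidences large-incidences)
    where
    open ≡-Reasoning
    φ : F.Vector → F.Carrier
    φ = SF.polar (F.rep P)
    T = K.countPoints (tangentCovered? R)
    h = F.countPoints (orthogonal? R)
    a = F.countLines (λ ℓ → 𝓛? ℓ ×-dec kernel? φ ℓ)
    -- `θ_{r-2,q}` is split at its highest power here and at its constant term in `h≡`; both
    -- remainders are multiples of `θ_{r-3,q} = (q + 1) Θ`.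
    h≡′ : h ≡ q ^ ((1 + k) * 2) + suc q * Θ
    h≡′ = trans (orthogonal-rational R P R≈P QR) (cong (q ^ ((1 + k) * 2) +_) (θ<-double (suc k) q))
    h≡ : h ≡ 1 + q * (suc q * Θ)
    h≡ = trans (orthogonal-rational R P R≈P QR) (trans (θ<-suc ((1 + k) * 2) q)
      (cong (λ u → 1 + q * u) (θ<-double (suc k) q)))
    small-incidences : m * (1 + q ^ 2 * Θ) + q * a ≡ m * h
    small-incidences = begin
      m * (1 + q ^ 2 * Θ) + q * a    ≡⟨ cong (_+ q * a) size≡ ⟨
      size + q * a                           ≡⟨ incidences (SF.polar-linear (F.rep P)) ⟩
      m * F.countPoints (λ T → (SF.Q (F.rep T) F.≟ F.0#) ×-dec (φ (F.rep T) F.≟ F.0#))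
        ≡⟨ cong (m *_) (FiniteProperties.count-cong F.points
             (λ T → (SF.Q (F.rep T) F.≟ F.0#) ×-dec (φ (F.rep T) F.≟ F.0#)) (orthogonal? R)
             (λ T (QT , PT) → QT , ⊥-rational R P R≈P (F.rep T) PT) (λ T (QT , RT) → QT , rational-⊥ R P R≈P (F.rep T) RT)) ⟩
      m * h                                    ∎
    large-incidences : T + m * h ≡ m * (1 + q ^ 2 * Θ) + q ^ 2 * a + h
    large-incidences = begin
      T + m * h
        ≡⟨ incidences-ext R ⟩
      size + q ^ 2 * F.countLines (λ ℓ → 𝓛? ℓ ×-dec orthogonal-line? R ℓ) + h
        ≡⟨ cong₂ (λ u v → u + q ^ 2 * v + h) size≡
             (FiniteProperties.count-cong F.lines (λ ℓ → 𝓛? ℓ ×-dec orthogonal-line? R ℓ) (λ ℓ → 𝓛? ℓ ×-dec kernel? φ ℓ)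
               (λ ℓ (ℓ∈ , e , f) → ℓ∈ , rational-⊥ R P R≈P _ e , rational-⊥ R P R≈P _ f)
               (λ ℓ (ℓ∈ , e , f) → ℓ∈ , ⊥-rational R P R≈P _ e , ⊥-rational R P R≈P _ f)) ⟩
      m * (1 + q ^ 2 * Θ) + q ^ 2 * a + h ∎

  on-line? : ∀ ℓ → Decidable (λ P → P F.∈ˡ ℓ × SF.Q (F.rep P) ≡ F.0#)
  on-line? ℓ P = (P F.∈ˡ? ℓ) ×-dec (SF.Q (F.rep P) F.≟ F.0#)

  on-line-resp : ∀ ℓ → (λ P → P F.∈ˡ ℓ × SF.Q (F.rep P) ≡ F.0#) Respects F._≈ᵖ_
  on-line-resp ℓ {P} {R} P≈R (P∈ , QP) = F.∈ˡ-resp ℓ {P} {R} P≈R P∈ , SF.Q-resp P R P≈R QP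

  singular⇒size : ∀ ℓ → Singular ℓ → HasSize F.Points (λ P → P F.∈ˡ ℓ × SF.Q (F.rep P) ≡ F.0#) (suc q)
  singular⇒size ℓ sing = count⇒HasSize F.points (on-line? ℓ) (λ {P} {R} → on-line-resp ℓ {P} {R})
    (trans (FiniteProperties.count-cong F.points (on-line? ℓ) (F._∈ˡ? ℓ) (λ P → proj₁) (λ P P∈ → P∈ , sing P P∈)) (F.count-line ℓ))

  anisotropic⇒size : ∀ ℓ → Anisotropic ℓ → HasSize F.Points (λ P → P F.∈ˡ ℓ × SF.Q (F.rep P) ≡ F.0#) 0
  anisotropic⇒size ℓ aniso = count⇒HasSize F.points (on-line? ℓ) (λ {P} {R} → on-line-resp ℓ {P} {R})
    (FiniteProperties.count-none F.points (on-line? ℓ) (λ P (P∈ , QP) → aniso P P∈ QP))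

  size⇒anisotropic : ∀ ℓ → HasSize F.Points (λ P → P F.∈ˡ ℓ × SF.Q (F.rep P) ≡ F.0#) 0 → Anisotropic ℓ
  size⇒anisotropic ℓ none P P∈ QP = ¬Fin0 (Inverse.to none (P , P∈ , QP))

  -- The line has `suc q` points altogether, so a section with `suc q` points leaves none off the
  -- quadric.
  size⇒singular : ∀ ℓ → HasSize F.Points (λ P → P F.∈ˡ ℓ × SF.Q (F.rep P) ≡ F.0#) (suc q) → Singular ℓ
  size⇒singular ℓ all P P∈ = decide (SF.Q (F.rep P) F.≟ F.0#)
    where
    open ≡-Reasoning
    off? : Decidable (λ R → R F.∈ˡ ℓ × SF.Q (F.rep R) ≢ F.0#)
    off? R = (R F.∈ˡ? ℓ) ×-dec ¬? (SF.Q (F.rep R) F.≟ F.0#)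
    off-resp : (λ R → R F.∈ˡ ℓ × SF.Q (F.rep R) ≢ F.0#) Respects F._≈ᵖ_
    off-resp {R} {T} R≈T (R∈ , ne) = F.∈ˡ-resp ℓ {R} {T} R≈T R∈ ,
      λ QT → ne (SF.Q-resp T R (F.≈ᵖ-sym R T R≈T) QT)
    none : F.countPoints off? ≡ 0
    none = ℕ.+-cancelˡ-≡ (suc q) (F.countPoints off?) 0 (begin
      suc q + F.countPoints off?
        ≡⟨ cong (_+ F.countPoints off?) (HasSize⇒count F.points (on-line? ℓ) (λ {P} {R} → on-line-resp ℓ {P} {R}) all) ⟨
      F.countPoints (on-line? ℓ) + F.countPoints off?
        ≡⟨ FiniteProperties.count-split F.points (F._∈ˡ? ℓ) (λ R → SF.Q (F.rep R) F.≟ F.0#) ⟨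
      F.countPoints (F._∈ˡ? ℓ)
        ≡⟨ F.count-line ℓ ⟩
      suc q
        ≡⟨ ℕ.+-identityʳ (suc q) ⟨
      suc q + 0 ∎)
    decide : Dec (SF.Q (F.rep P) ≡ F.0#) → SF.Q (F.rep P) ≡ F.0#
    decide (yes QP) = QP
    decide (no ¬QP) = contradiction (Inverse.to (count⇒HasSize F.points off? (λ {R} {T} → off-resp {R} {T}) none) (P , P∈ , ¬QP)) ¬Fin0

-- The equivalence of the two conditions.

HasSize-cong : {S : Setoid 0ℓ 0ℓ} {P R : Pred (Setoid.Carrier S) 0ℓ} {n : ℕ} →
               (∀ a → P a → R a) → (∀ a → R a → P a) → HasSize S P n → HasSize S R n
HasSize-cong {S} f g size = record
  { to        = λ (a , r) → to (a , g a r)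
  ; from      = λ i → proj₁ (from i) , f _ (proj₂ (from i))
  ; to-cong   = λ e → to-cong e
  ; from-cong = λ { refl → Setoid.refl S }
  ; inverse   = (λ e → inverseˡ e) , (λ e → inverseʳ e)
  }
  where open Inverse size

module Equivalent {q : ℕ} {F : FiniteField q} {K : FiniteField (q ^ 2)} (E : Embedding F K) (k : ℕ) (2∤q : ¬ (2 ∣ q))
    (A : Projective.QuadraticForm F (suc ((2 + k) * 2)))
    (nondeg : Projective.Quadric.Nondegenerate F (suc ((2 + k) * 2)) A)
    (𝓛 : Pred (Projective.Line F (suc ((2 + k) * 2))) 0ℓ)
    (𝓛-resp : 𝓛 Respects (Projective._≈ˡ_ F (suc ((2 + k) * 2))))
    (m : ℕ) (isCover : Cover.IsCover F ((2 + k) * 2) A m 𝓛) where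

  private
    -- In this form `r ∸ 4` and `r ∸ 2` compute to `k * 2` and `2 + k * 2`.
    r = (2 + k) * 2
    module FP = Projective F (suc r)
    module KP = Projective K (suc r)
    2≢0 = FieldTheory.odd⇒2≢0 F 2∤q
    space = extendedSpace E (suc r) A
  open Cover F r A using (IsDualOfTypeII; module IsCover)
  open Tight {q} K r (Extension.extendForm E (suc r) A) using (IsTight)
  open ExtendedQuadric E (suc r) space 2≢0

  private
    cover : LineCover 𝓛 m
    cover = record { respects = 𝓛-resp ; positive = positive ; singular = singular ; covers = covers }
      where open IsCover isCover

  open LineCover cover
  open CoverTightness E (suc r) space 2≢0 nondeg k refl 𝓛 m cover

  private
    X : Pred KP.Point 0ℓ
    X = Extension.extendedPoints E (suc r) A 𝓛

    X⇒covered : ∀ R → X R → Covered R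
    X⇒covered R (_ , ℓ , ℓ∈ , ℓ′ , isExt , R∈) = ℓ , ℓ∈ , Equivalence.to (extLine-unique ℓ ℓ′ isExt R) R∈

    covered⇒X : ∀ R → Covered R → X R
    covered⇒X R c@(ℓ , ℓ∈ , R∈) = covered-singular R c , ℓ , ℓ∈ , extLine ℓ , extLine-isExtended ℓ , R∈

    TangentX : KP.Point → Pred KP.Point 0ℓ
    TangentX R Y = SK.polar (KP.rep R) (KP.rep Y) ≡ K.0# × X Y

    to-covered : ∀ {R N} → HasSize KP.Points (TangentX R) N → HasSize KP.Points (TangentCovered R) N
    to-covered = HasSize-cong (λ Y (p , x) → p , X⇒covered Y x) (λ Y (p , c) → p , covered⇒X Y c)

    from-covered : ∀ {R N} → HasSize KP.Points (TangentCovered R) N → HasSize KP.Points (TangentX R) N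
    from-covered = HasSize-cong (λ Y (p , c) → p , covered⇒X Y c) (λ Y (p , x) → p , X⇒covered Y x)

    tight-small tight-large dual-small dual-large : ℕ
    tight-small = tightness * θ< (suc ((r ∸ 4) / 2)) (q ^ 2)
    tight-large = tight-small + q ^ (r ∸ 2)
    dual-small  = m * θ< (r ∸ 4) q / suc q
    dual-large  = dual-small + q ^ (r ∸ 4)

    tight-Θ : tight-small ≡ tightness * Θ
    tight-Θ = cong (λ u → tightness * θ< (suc u) (q ^ 2)) (m*n/n≡m k 2)

    tight-small≡ : tight-small ≡ tightness * Θ + q ^ 2 * 0
    tight-small≡ = trans tight-Θ (trans (sym (ℕ.+-identityʳ _)) (cong (tightness * Θ +_) (sym (ℕ.*-zeroʳ (q ^ 2)))))

    tight-rational≡ : tight-large ≡ tightness * Θ + q ^ (2 + k * 2)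
    tight-rational≡ = cong (_+ q ^ (2 + k * 2)) tight-Θ

    -- The surplus `q ^ (r - 2)` of tightness is `q ^ 2` times the surplus `q ^ (r - 4)` of duality,
    -- as the count at irrational points demands.
    tight-large≡ : tight-large ≡ tightness * Θ + q ^ 2 * q ^ (k * 2)
    tight-large≡ = trans tight-rational≡ (cong (tightness * Θ +_) (ℕ.^-distribˡ-+-* q 2 (k * 2)))

    -- The division is exact by `θ<-double`, which turns `θ_{r-5,q}` into `(q + 1) Ψ`.
    dual-Ψ : dual-small ≡ m * Ψ
    dual-Ψ = trans (cong (λ u → m * u / suc q) (trans (θ<-double k q) (ℕ.*-comm (suc q) Ψ)))
      (trans (cong (_/ suc q) (sym (ℕ.*-assoc m Ψ (suc q)))) (m*n/n≡m (m * Ψ) (suc q)))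

    dual-small≡ : dual-small ≡ m * Ψ + 0
    dual-small≡ = trans dual-Ψ (sym (ℕ.+-identityʳ _))

    dual-large≡ : dual-large ≡ m * Ψ + q ^ (k * 2)
    dual-large≡ = cong (_+ q ^ (k * 2)) dual-Ψ

    line-of-tight : ∀ R → ¬ Rational R → SK.Q (KP.rep R) ≡ K.0# → ∀ ℓ → R K.∈ˡ extLine ℓ → ∀ {N M} ε →
      N ≡ tightness * Θ + q ^ 2 * ε → M ≡ m * Ψ + ε →
      HasSize KP.Points (TangentX R) N → HasSize FP.Lines (OrthogonalIn ℓ) M
    line-of-tight R irr QR ℓ R∈ ε N≡ M≡ size = subst (HasSize FP.Lines (OrthogonalIn ℓ)) (sym M≡)
      (Equivalence.to (irrational-size R irr QR ℓ R∈ ε) (subst (HasSize KP.Points (TangentCovered R)) N≡ (to-covered {R} size)))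

    tight-of-line : ∀ R → ¬ Rational R → SK.Q (KP.rep R) ≡ K.0# → ∀ ℓ → R K.∈ˡ extLine ℓ → ∀ {N M} ε →
      N ≡ tightness * Θ + q ^ 2 * ε → M ≡ m * Ψ + ε →
      HasSize FP.Lines (OrthogonalIn ℓ) M → HasSize KP.Points (TangentX R) N
    tight-of-line R irr QR ℓ R∈ ε N≡ M≡ size = from-covered {R} (subst (HasSize KP.Points (TangentCovered R)) (sym N≡)
      (Equivalence.from (irrational-size R irr QR ℓ R∈ ε) (subst (HasSize FP.Lines (OrthogonalIn ℓ)) M≡ size)))

  -- A line is tested at an irrational singular point of its extension. On a line of the quadric the
  -- generic point will do; on a line disjoint from the quadric a root in the large field is
  -- required.
  tight⇒dual : IsTight tightness X → IsDualOfTypeII m 𝓛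
  tight⇒dual tight = record { inside = inside′ ; outside = outside′ }
    where
    open IsTight tight
    inside′ : ∀ ℓ → 𝓛 ℓ → HasSize FP.Lines (OrthogonalIn ℓ) dual-large
    inside′ ℓ ℓ∈ = line-of-tight R (generic-point-irrational ℓ) QR ℓ R∈ (q ^ (k * 2)) tight-large≡ dual-large≡
      (inside R QR (covered⇒X R (ℓ , ℓ∈ , R∈)))
      where
      R = generic-point ℓ
      R∈ : R K.∈ˡ extLine ℓ
      R∈ = generic-point-∈ ℓ
      QR : SK.Q (KP.rep R) ≡ K.0#
      QR = singular-extLine ℓ (singular ℓ ℓ∈) R R∈
    outside-at : ∀ ℓ → ¬ 𝓛 ℓ → ∀ R → ¬ Rational R → SK.Q (KP.rep R) ≡ K.0# → R K.∈ˡ extLine ℓ →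
                 HasSize FP.Lines (OrthogonalIn ℓ) dual-small
    outside-at ℓ ℓ∉ R irr QR R∈ = line-of-tight R irr QR ℓ R∈ 0 tight-small≡ dual-small≡
      (outside R QR (λ x → ℓ∉ (covered-irrational R irr ℓ R∈ (X⇒covered R x))))
    outside′ : ∀ ℓ → ¬ 𝓛 ℓ →
      HasSize FP.Points (λ P → P FP.∈ˡ ℓ × SF.Q (FP.rep P) ≡ F.0#) 0 ⊎
      HasSize FP.Points (λ P → P FP.∈ˡ ℓ × SF.Q (FP.rep P) ≡ F.0#) (suc q) →
      HasSize FP.Lines (OrthogonalIn ℓ) dual-small
    outside′ ℓ ℓ∉ (inj₁ none) =
      let R , R∈ , QR , irr = singular-point ℓ (size⇒anisotropic ℓ none) in outside-at ℓ ℓ∉ R irr QR R∈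
    outside′ ℓ ℓ∉ (inj₂ all) = outside-at ℓ ℓ∉ (generic-point ℓ) (generic-point-irrational ℓ)
      (singular-extLine ℓ (size⇒singular ℓ all) (generic-point ℓ) (generic-point-∈ ℓ)) (generic-point-∈ ℓ)

  -- Rational points satisfy the condition for every cover; an irrational singular point is referred
  -- to its support, which is singular or anisotropic and so falls under the dual condition.
  dual⇒tight : IsDualOfTypeII m 𝓛 → IsTight tightness X
  dual⇒tight dual = record { onQuadric = λ P → proj₁ ; inside = inside′ ; outside = outside′ }
    where
    open IsDualOfTypeII dual
    inside′ : ∀ R → SK.Q (KP.rep R) ≡ K.0# → X R → HasSize KP.Points (TangentX R) tight-large
    inside′ R QR x = by-cases (rational? R)
      where
      by-cases : Dec (Rational R) → HasSize KP.Points (TangentX R) tight-large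
      by-cases (yes rat) = from-covered {R} (subst (HasSize KP.Points (TangentCovered R)) (sym tight-rational≡) (rational-size R rat QR))
      by-cases (no irr)  = tight-of-line R irr QR ℓ (∈-support R irr) (q ^ (k * 2)) tight-large≡ dual-large≡
        (inside ℓ (covered-irrational R irr ℓ (∈-support R irr) (X⇒covered R x)))
        where ℓ = support R irr
    outside′ : ∀ R → SK.Q (KP.rep R) ≡ K.0# → ¬ X R → HasSize KP.Points (TangentX R) tight-small
    outside′ R QR ¬x = by-cases (rational? R)
      where
      by-cases : Dec (Rational R) → HasSize KP.Points (TangentX R) tight-small
      -- A rational singular point always lies on a line of `𝓛`, hence never outside `X`.
      by-cases (yes (P , R≈P)) = contradiction (covered⇒X R (covered-rational R P R≈P (rational-Q {R} {P} R≈P QR))) ¬x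
      by-cases (no irr) = tight-of-line R irr QR ℓ (∈-support R irr) 0 tight-small≡ dual-small≡
        (outside ℓ (λ ℓ∈ → ¬x (covered⇒X R (ℓ , ℓ∈ , ∈-support R irr))) (line-size (dichotomy R irr QR ℓ (∈-support R irr))))
        where
        ℓ = support R irr
        line-size : Singular ℓ ⊎ Anisotropic ℓ →
          HasSize FP.Points (λ P → P FP.∈ˡ ℓ × SF.Q (FP.rep P) ≡ F.0#) 0 ⊎
          HasSize FP.Points (λ P → P FP.∈ˡ ℓ × SF.Q (FP.rep P) ≡ F.0#) (suc q)
        line-size (inj₁ sing)  = inj₂ (singular⇒size ℓ sing)
        line-size (inj₂ aniso) = inj₁ (anisotropic⇒size ℓ aniso)

theorem4p10 : (r : ℕ) → 4 ≤ r → 2 ∣ r →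
    (q : ℕ) → IsPrimePower q → ¬ (2 ∣ q) →
    (F : FiniteField q) (K : FiniteField (q ^ 2)) (E : Embedding F K) →
    (A : Projective.QuadraticForm F (suc r)) →
    Projective.Quadric.Nondegenerate F (suc r) A →
    (𝓛 : Pred (Projective.Line F (suc r)) 0ℓ) →
    𝓛 Respects (Projective._≈ˡ_ F (suc r)) →
    (m : ℕ) → Cover.IsCover F r A m 𝓛 →
    Tight.IsTight {q} K r (Extension.extendForm E (suc r) A)
    (m * (q ^ 2 ∸ q) + q + 1)
    (Extension.extendedPoints E (suc r) A 𝓛)
    ⇔ Cover.IsDualOfTypeII F r A m 𝓛
-- Half of `r` is at least 2: the value 1 would make `r = 2`, and for 0 the hypothesis `4 ≤ r` is
-- empty. The remaining halves have the form `2 + k`.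
theorem4p10 r (s≤s (s≤s ())) (divides 1 refl)
theorem4p10 r 4≤r (divides (suc (suc k)) refl) q _ 2∤q F K E A nondeg 𝓛 𝓛-resp m cover =
  mk⇔ tight⇒dual dual⇒tight
  where open Equivalent E k 2∤q A nondeg 𝓛 𝓛-resp m cover
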